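{- We have $$\sum_{k, l \ge 0} \Big( \sum_{\mathbf k \in I_0(k, l, l)} \zeta^{t}_{q}(\mathbf k) \Big) u_1^{k-2l} u_3^l = \exp \left\{ \sum_{n=2}^{\infty} \zeta_{q}(n) \sum_{m=0}^{\infty} \frac{(q-1)^m}{m+n} (w_1^{m+n} + w_2^{m+n} -z_1^{m+n} - z_2^{m+n}) \right\} -1,$$ where $z_1,z_2,w_1,w_2$ are determined by $z_1+z_2=u_1-(1-t)(1-q)u_3$, $z_1z_2=(1-t)u_3$, $w_1+w_2=u_1+t(1-q)u_3$, $w_1w_2=-tu_3$.
   Context: $q$ is a formal parameter, $[n]=(1-q^n)/(1-q)$. For an index $\mathbf k=(k_1,\dots,k_l)$ of positive integers: weight $k_1+\dots+k_l$, depth $l$, $1$-height $\#\{j:k_j\ge2\}$; admissible means $k_1\ge2$. $I_0(k,l,h)$ is the set of admissible indices of weight $k$, depth $l$ and $1$-height $h$ (an empty inner sum is $0$). $\zeta_q(\mathbf k)=\sum_{m_1>\cdots>m_l\ge1}\prod_j q^{(k_j-1)m_j}/[m_j]^{k_j}$, and $\zeta^t_q(\mathbf k)=\sum_{\mathbf p}(1-q)^{\mathrm{wt}(\mathbf k)-\mathrm{wt}(\mathbf p)}\zeta_q(\mathbf p)t^{l-\mathrm{dep}(\mathbf p)}$, where $\mathbf p$ runs over indices $(k_1\,\square\cdots\square\,k_l)$ with each $\square$ filled by ``$,$'', ``$+$'' or ``$-1+$'' (neighbouring $a,b$ replaced by $a+b-1$). -}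

module Defs where

open import Data.Bool using (Bool; true; false; if_then_else_; _∧_)
open import Data.Nat as ℕ using (ℕ; zero; suc; _≡ᵇ_; _≤ᵇ_; _∸_)
open import Data.Nat.DivMod using (_%_)
open import Data.Nat.Base using () renaming (_! to fact)
open import Data.Integer using (+_)
open import Data.List using (List; []; _∷_; map; filter; _++_; foldr; length; concatMap)
open import Data.Product using (_×_; _,_)
open import Data.Rational using (ℚ; 0ℚ; 1ℚ; _+_; _*_; -_; _/_)
open import Relation.Binary.PropositionalEquality using (_≡_)
open import Relation.Nullary.Decidable using ()
open import Data.Bool.Properties using (T?)
open import Data.Bool using (T)

-- Indices: finite lists of positive integers

Index : Set
Index = List ℕ

weight : Index → ℕ
weight = foldr ℕ._+_ 0

depth : Index → ℕ
depth = length

height : Index → ℕ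
height [] = 0
height (k ∷ ks) = (if 2 ≤ᵇ k then 1 else 0) ℕ.+ height ks

admissibleᵇ : Index → Bool
admissibleᵇ [] = false
admissibleᵇ (k ∷ _) = 2 ≤ᵇ k

incHead : Index → List Index
incHead [] = []
incHead (x ∷ xs) = (suc x ∷ xs) ∷ []

compositions : ℕ → List Index
compositions zero = [] ∷ []
compositions (suc n) = map (1 ∷_) (compositions n) ++ concatMap incHead (compositions n)

I₀ : ℕ → ℕ → ℕ → List Index
I₀ k l h = filter (λ ks → T? ((depth ks ≡ᵇ l) ∧ (height ks ≡ᵇ h) ∧ admissibleᵇ ks))
                  (compositions k)

-- Formal power series in q, t, u₁, u₃ with rational coefficients.
-- f i j a b is the coefficient of q^i t^j u₁^a u₃^b.

Series : Set
Series = ℕ → ℕ → ℕ → ℕ → ℚ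

Σ< : ℕ → (ℕ → ℚ) → ℚ
Σ< zero f = 0ℚ
Σ< (suc n) f = Σ< n f + f n

δ : ℕ → ℕ → ℚ
δ i k = if i ≡ᵇ k then 1ℚ else 0ℚ

zeroS : Series
zeroS _ _ _ _ = 0ℚ

scal : ℚ → Series
scal c i j a b = c * (δ i 0 * (δ j 0 * (δ a 0 * δ b 0)))

oneS : Series
oneS = scal 1ℚ

qS tS u₁S u₃S : Series
qS  i j a b = δ i 1 * (δ j 0 * (δ a 0 * δ b 0))
tS  i j a b = δ i 0 * (δ j 1 * (δ a 0 * δ b 0))
u₁S i j a b = δ i 0 * (δ j 0 * (δ a 1 * δ b 0))
u₃S i j a b = δ i 0 * (δ j 0 * (δ a 0 * δ b 1))

infixl 6 _⊕_ _⊖_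
infixl 7 _⊗_

_⊕_ : Series → Series → Series
(f ⊕ g) i j a b = f i j a b + g i j a b

⊝_ : Series → Series
(⊝ f) i j a b = - f i j a b

_⊖_ : Series → Series → Series
f ⊖ g = f ⊕ (⊝ g)

_⊗_ : Series → Series → Series
(f ⊗ g) i j a b =
  Σ< (suc i) λ i₁ → Σ< (suc j) λ j₁ → Σ< (suc a) λ a₁ → Σ< (suc b) λ b₁ →
    f i₁ j₁ a₁ b₁ * g (i ∸ i₁) (j ∸ j₁) (a ∸ a₁) (b ∸ b₁)

pow : Series → ℕ → Series
pow f zero = oneS
pow f (suc n) = f ⊗ pow f n

ΣS< : ℕ → (ℕ → Series) → Series
ΣS< zero F = zeroS
ΣS< (suc n) F = ΣS< n F ⊕ F n

sumS : List Series → Series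
sumS = foldr _⊕_ zeroS

-- 1/n as a rational (only used with n ≠ 0)
inv : ℕ → ℚ
inv zero = 0ℚ
inv (suc n) = + 1 / suc n

-- 1/(1 - q^m) = Σ_r q^{m r}   (m ≥ 1)
geom : ℕ → Series
geom zero = zeroS   -- never used
geom (suc m) i j a b = (if i % suc m ≡ᵇ 0 then 1ℚ else 0ℚ) * (δ j 0 * (δ a 0 * δ b 0))

-- q^{(k-1)m} / [m]^k = q^{(k-1)m} (1-q)^k (1/(1-q^m))^k
ζterm : ℕ → ℕ → Series
ζterm k m = pow qS ((k ∸ 1) ℕ.* m) ⊗ pow (oneS ⊖ qS) k ⊗ pow (geom m) k

ζtr : Index → ℕ → Series
ζtr [] M = oneS
ζtr (k ∷ ks) M = ΣS< M λ m → if 1 ≤ᵇ m then ζterm k m ⊗ ζtr ks m else zeroS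

-- ζ_q(k) for admissible k: the coefficient of q^i only involves m_1 ≤ i,
-- since the term indexed by m_1 has q-adic valuation ≥ (k_1-1) m_1 ≥ m_1.
ζq : Index → Series
ζq ks i j a b = ζtr ks (suc i) i j a b

-- all ways to fill the boxes of (k_1 □ ... □ k_l) with ",", "+", "-1+":
-- returns (p, number of non-comma boxes, number of "-1+" boxes)
fillGo : ℕ → Index → List (Index × ℕ × ℕ)
fillGo cur [] = ((cur ∷ []) , 0 , 0) ∷ []
fillGo cur (y ∷ rest) =
     map (λ { (p , s , r) → ((cur ∷ p) , s , r) }) (fillGo y rest)
  ++ map (λ { (p , s , r) → (p , suc s , r) }) (fillGo (cur ℕ.+ y) rest)
  ++ map (λ { (p , s , r) → (p , suc s , suc r) }) (fillGo (cur ℕ.+ y ∸ 1) rest)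

fillings : Index → List (Index × ℕ × ℕ)
fillings [] = ([] , 0 , 0) ∷ []
fillings (k ∷ ks) = fillGo k ks

-- ζ^t_q(k) = Σ_p (1-q)^{wt k - wt p} ζ_q(p) t^{dep k - dep p}
-- (wt k - wt p = number of "-1+", dep k - dep p = number of non-comma boxes)
ζtq : Index → Series
ζtq ks = sumS (map (λ { (p , s , r) → pow tS s ⊗ pow (oneS ⊖ qS) r ⊗ ζq p }) (fillings ks))

-- Left-hand side: Σ_{k,l} (Σ_{k ∈ I_0(k,l,l)} ζ^t_q(k)) u₁^{k-2l} u₃^l.
-- The coefficient of u₁^a u₃^b is the inner sum for k = a + 2b, l = b
-- (for k < 2l the set I_0(k,l,l) is empty).

LHS : Series
LHS i j a b = sumS (map ζtq (I₀ (a ℕ.+ 2 ℕ.* b) b b)) i j 0 0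

-- power sums p_N = x₁^N + x₂^N of the roots of X² - e₁ X + e₂,
-- via Newton: p_0 = 2, p_1 = e₁, p_{N+2} = e₁ p_{N+1} - e₂ p_N
powSum : Series → Series → ℕ → Series
powSum e₁ e₂ zero = scal (+ 2 / 1)
powSum e₁ e₂ (suc zero) = e₁
powSum e₁ e₂ (suc (suc n)) = e₁ ⊗ powSum e₁ e₂ (suc n) ⊖ e₂ ⊗ powSum e₁ e₂ n

ez₁ ez₂ : Series
ez₁ = u₁S ⊖ (oneS ⊖ tS) ⊗ (oneS ⊖ qS) ⊗ u₃S
ez₂ = (oneS ⊖ tS) ⊗ u₃S

ew₁ ew₂ : Series
ew₁ = u₁S ⊕ tS ⊗ (oneS ⊖ qS) ⊗ u₃S
ew₂ = ⊝ (tS ⊗ u₃S)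

Xterm : ℕ → ℕ → Series
Xterm n m = ζq (n ∷ []) ⊗ scal (inv (m ℕ.+ n)) ⊗ pow (qS ⊖ oneS) m
            ⊗ (powSum ew₁ ew₂ (m ℕ.+ n) ⊖ powSum ez₁ ez₂ (m ℕ.+ n))

XN : ℕ → Series
XN N = ΣS< (suc N) λ n → if 2 ≤ᵇ n then Xterm n (N ∸ n) else zeroS

-- X = Σ_{n ≥ 2} Σ_{m ≥ 0} Xterm n m.  The power sums of degree N have
-- (u₁,u₃)-total degree ≥ ⌈N/2⌉, so only N ≤ 2(a+b) contribute to u₁^a u₃^b.
Xser : Series
Xser i j a b = ΣS< (suc (2 ℕ.* (a ℕ.+ b))) XN i j a b

-- exp(X) - 1 = Σ_{r ≥ 1} X^r / r!;  X has (u₁,u₃)-valuation ≥ 1,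
-- so only r ≤ a + b contributes to u₁^a u₃^b.
RHS : Series
RHS i j a b =
  ΣS< (suc (a ℕ.+ b)) (λ r → if 1 ≤ᵇ r then scal (inv (fact r)) ⊗ pow Xser r else zeroS) i j a b

-- Merging two boxes of an index adds q^((a+b-1)m)/[m]^(a+b) and (1-q) q^((a+b-2)m)/[m]^(a+b-1), which together are
-- q^((a-1)m)/[m]^a · q^((b-1)m)/[m]^b.  So ζ^t_q(k) is the sum over m₁ ≥ … ≥ m_l of the usual summands, with a factor t
-- for each equality, and the generating function over all indices without entry 1 is, with y = q^m/[m],
--   Π_m (1 - z₁ y)(1 - z₂ y) / ((1 - w₁ y)(1 - w₂ y)).
-- Its logarithm is Σ_m Σ_N (w₁^N + w₂^N - z₁^N - z₂^N) y^N / N.  The exponent of the theorem telescopes in n to the same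
-- sum minus multiples of its value at y = q - 1, where both quadratics equal 1 - (q - 1) u₁, so that the value is 0.
-- Logarithms are avoided: modulo a power of q and of (u₁, u₃), both sides plus 1 satisfy D f = D X · f for the Euler derivation D
-- in u₁, u₃ and the exponent X, and they agree in degree 0.
module Submission where

open import Defs
open import Algebra.Bundles using (CommutativeRing; RawRing)
import Algebra.Properties.CommutativeSemigroup as CommutativeSemigroupProperties
import Algebra.Properties.Group as GroupProperties
import Algebra.Properties.Ring as RingProperties
import Algebra.Properties.Semiring.Exp as Exponentiation
import Algebra.Properties.Semiring.Mult.TCOptimised as SemiringMult
import Algebra.Solver.Ring as RingSolver
open import Algebra.Solver.Ring.AlmostCommutativeRing using (_-Raw-AlmostCommutative⟶_; fromCommutativeRing)
open import Data.Bool.Base using (Bool; true; false; if_then_else_; _∧_; T)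
open import Data.Bool.Properties using (∧-assoc)
open import Data.Integer.Base as ℤ using (ℤ; +_; -[1+_])
import Data.Integer.Properties as ℤ
open import Data.List.Base using (List; []; _∷_; map; _++_; foldr; concatMap; filterᵇ)
import Data.List.Properties as List
open import Data.List.Relation.Unary.All as All using (All; []; _∷_)
import Data.List.Relation.Unary.All.Properties as All
open import Data.Maybe.Base using (Maybe; just; nothing)
open import Data.Nat.Base as ℕ using (ℕ; zero; suc; _∸_; _≤_; _<_; z≤n; s≤s; _≤ᵇ_; _≡ᵇ_) renaming (_! to fact)
open import Data.Nat.DivMod using (_%_; m<n⇒m%n≡m; [m+n]%n≡m%n)
import Data.Nat.Properties as ℕ
open import Data.Product as Product using (_,_; proj₁)
import Data.Rational.Properties as ℚ
open import Data.Rational.Unnormalised.Base as ℚᵘ using (mkℚᵘ; *≡*)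
import Data.Rational.Unnormalised.Properties as ℚᵘ
open import Data.Sum using (_⊎_; inj₁; inj₂; [_,_]′)
open import Data.Unit using (tt)
open import Function using (_∘_)
open import Level using (0ℓ)
open import Relation.Binary using (IsEquivalence)
open import Relation.Binary.PropositionalEquality as ≡ using (_≡_; cong; cong₂; module ≡-Reasoning)
import Relation.Binary.Reasoning.Setoid as SetoidReasoning
open import Relation.Nullary using (yes; no)

-- The product is built one factor at a time. Sorting indices by their first entry, 2 or larger,
-- gives Δ = u₃ y (y - c) (G + t Δ) + u₁ y Δ with c = q - 1. Collected on the left, Δ has the
-- coefficient 1 - (w₁ + w₂) y + w₁ w₂ y², and adding u₃ y (y - c) to it gives the quadratic of z₁,
-- z₂. This is where the four parameters come from. The roots are never adjoined: only their
-- elementary symmetric functions occur, and power sums are handled through Newton's recurrence.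
-- Neither y nor c involves u₁, u₃, and c is not small q-adically either. The logarithmic series
-- make sense only because the N-th power sums have order at least N/2 in u₁, u₃. Hence the
-- filtration is by degree in u₁, u₃, the derivation is the one that detects this degree, and q and
-- t count as constants. Truncation in q serves to replace the infinite sums and products over m by
-- finite ones.

module IntegerCoefficients {c ℓ} (R : CommutativeRing c ℓ) where

  open CommutativeRing R
  open RingProperties ring using (-0#≈0#; -‿involutive; -‿+-comm; -‿distribˡ-*; -‿distribʳ-*)
  open SemiringMult semiring using (_×_; ×-homo-+; ×1-homo-*; 1+×)
  open SetoidReasoning setoid

  ⟦_⟧ℤ : ℤ → Carrier
  ⟦ + n ⟧ℤ = n × 1#
  ⟦ -[1+ n ] ⟧ℤ = - (suc n × 1#)

  cancelˡ-difference : ∀ x y z → x + y - (x + z) ≈ y - z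
  cancelˡ-difference x y z = begin
    x + y - (x + z)         ≈⟨ +-congˡ (-‿+-comm x z) ⟨
    x + y + (- x - z)       ≈⟨ +-congʳ (+-comm x y) ⟩
    y + x + (- x - z)       ≈⟨ +-assoc y x _ ⟩
    y + (x + (- x - z))     ≈⟨ +-congˡ (+-assoc x (- x) (- z)) ⟨
    y + (x - x - z)         ≈⟨ +-congˡ (+-congʳ (-‿inverseʳ x)) ⟩
    y + (0# - z)            ≈⟨ +-congˡ (+-identityˡ (- z)) ⟩
    y - z                   ∎

  ⊖-homo : ∀ m n → ⟦ m ℤ.⊖ n ⟧ℤ ≈ m × 1# - n × 1#
  ⊖-homo m zero = sym (trans (+-congˡ -0#≈0#) (+-identityʳ _))
  ⊖-homo zero (suc n) = sym (+-identityˡ _)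
  ⊖-homo (suc m) (suc n) = begin
    ⟦ suc m ℤ.⊖ suc n ⟧ℤ              ≡⟨ ≡.cong ⟦_⟧ℤ (ℤ.[1+m]⊖[1+n]≡m⊖n m n) ⟩
    ⟦ m ℤ.⊖ n ⟧ℤ                      ≈⟨ ⊖-homo m n ⟩
    m × 1# - n × 1#                 ≈⟨ cancelˡ-difference 1# _ _ ⟨
    1# + m × 1# - (1# + n × 1#)     ≈⟨ +-cong (1+× m 1#) (-‿cong (1+× n 1#)) ⟨
    suc m × 1# - suc n × 1#         ∎

  +-homo : ∀ m n → ⟦ m ℤ.+ n ⟧ℤ ≈ ⟦ m ⟧ℤ + ⟦ n ⟧ℤ
  +-homo (+ m) (+ n) = ×-homo-+ 1# m n
  +-homo (+ m) -[1+ n ] = ⊖-homo m (suc n)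
  +-homo -[1+ m ] (+ n) = trans (⊖-homo n (suc m)) (+-comm _ _)
  +-homo -[1+ m ] -[1+ n ] = begin
    - (suc (suc (m ℕ.+ n)) × 1#)      ≡⟨ ≡.cong (λ k → - (k × 1#)) (ℕ.+-suc (suc m) n) ⟨
    - ((suc m ℕ.+ suc n) × 1#)        ≈⟨ -‿cong (×-homo-+ 1# (suc m) (suc n)) ⟩
    - (suc m × 1# + suc n × 1#)       ≈⟨ -‿+-comm _ _ ⟨
    - (suc m × 1#) - (suc n × 1#)     ∎

  -‿homo : ∀ m → ⟦ ℤ.- m ⟧ℤ ≈ - ⟦ m ⟧ℤ
  -‿homo (+ zero) = sym -0#≈0#
  -‿homo (+ suc n) = refl
  -‿homo -[1+ n ] = sym (-‿involutive _)

  *-homo-+ : ∀ m n → ⟦ + m ℤ.* n ⟧ℤ ≈ ⟦ + m ⟧ℤ * ⟦ n ⟧ℤ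
  *-homo-+ m (+ n) = trans (reflexive (≡.cong ⟦_⟧ℤ (≡.sym (ℤ.pos-* m n)))) (×1-homo-* m n)
  *-homo-+ m -[1+ n ] = begin
    ⟦ + m ℤ.* -[1+ n ] ⟧ℤ             ≡⟨ ≡.cong ⟦_⟧ℤ (ℤ.neg-distribʳ-* (+ m) (+ suc n)) ⟨
    ⟦ ℤ.- (+ m ℤ.* + suc n) ⟧ℤ        ≈⟨ -‿homo (+ m ℤ.* + suc n) ⟩
    - ⟦ + m ℤ.* + suc n ⟧ℤ            ≈⟨ -‿cong (*-homo-+ m (+ suc n)) ⟩
    - (⟦ + m ⟧ℤ * ⟦ + suc n ⟧ℤ)       ≈⟨ -‿distribʳ-* _ _ ⟩
    ⟦ + m ⟧ℤ * ⟦ -[1+ n ] ⟧ℤ          ∎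

  *-homo : ∀ m n → ⟦ m ℤ.* n ⟧ℤ ≈ ⟦ m ⟧ℤ * ⟦ n ⟧ℤ
  *-homo (+ m) n = *-homo-+ m n
  *-homo -[1+ m ] n = begin
    ⟦ -[1+ m ] ℤ.* n ⟧ℤ               ≡⟨ ≡.cong ⟦_⟧ℤ (ℤ.neg-distribˡ-* (+ suc m) n) ⟨
    ⟦ ℤ.- (+ suc m ℤ.* n) ⟧ℤ          ≈⟨ -‿homo (+ suc m ℤ.* n) ⟩
    - ⟦ + suc m ℤ.* n ⟧ℤ              ≈⟨ -‿cong (*-homo-+ (suc m) n) ⟩
    - (⟦ + suc m ⟧ℤ * ⟦ n ⟧ℤ)         ≈⟨ -‿distribˡ-* _ _ ⟩
    ⟦ -[1+ m ] ⟧ℤ * ⟦ n ⟧ℤ            ∎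

  ℤ-rawRing : RawRing _ _
  ℤ-rawRing = record
    { Carrier = ℤ ; _≈_ = ≡._≡_ ; _+_ = ℤ._+_ ; _*_ = ℤ._*_ ; -_ = ℤ.-_ ; 0# = ℤ.0ℤ ; 1# = ℤ.1ℤ }

  homomorphism : ℤ-rawRing -Raw-AlmostCommutative⟶ fromCommutativeRing R
  homomorphism = record
    { ⟦_⟧ = ⟦_⟧ℤ ; +-homo = +-homo ; *-homo = *-homo ; -‿homo = -‿homo
    ; 0-homo = refl ; 1-homo = refl }

  -- Equality in R need not be decidable. The solver only has to recognise equal integer
  -- coefficients, and `nothing` costs completeness, not soundness.
  coefficient≟ : ∀ m n → Maybe (⟦ m ⟧ℤ ≈ ⟦ n ⟧ℤ)
  coefficient≟ m n with m ℤ.≟ n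
  ... | yes m≡n = just (reflexive (≡.cong ⟦_⟧ℤ m≡n))
  ... | no _ = nothing

  open RingSolver ℤ-rawRing (fromCommutativeRing R) homomorphism coefficient≟ public
    using (solve; _:=_; _:+_; _:*_; _:-_; :-_; con; Polynomial)

-- Power series rings

-- Both indices are produced by the recursion, so no truncated subtraction occurs, and the Cauchy
-- product can be unfolded by splitting off the constant term of its left factor.
antidiagonalSum : {A : Set} → (A → A → A) → ℕ → (ℕ → ℕ → A) → A
antidiagonalSum _+_ zero Φ = Φ zero zero
antidiagonalSum _+_ (suc n) Φ = Φ zero (suc n) + antidiagonalSum _+_ n (λ k → Φ (suc k))

module PowerSeries (R : CommutativeRing 0ℓ 0ℓ) where

  open CommutativeRing R
  open IntegerCoefficients R using (solve; _:=_; _:+_; _:*_; _:-_; :-_)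
  open SetoidReasoning setoid

  PS : Set
  PS = ℕ → Carrier

  infix 4 _≋_
  _≋_ : PS → PS → Set
  f ≋ g = ∀ n → f n ≈ g n

  _+ₛ_ _*ₛ_ : PS → PS → PS
  (f +ₛ g) n = f n + g n
  (f *ₛ g) n = antidiagonalSum _+_ n (λ k l → f k * g l)

  1ₛ : PS
  1ₛ zero = 1#
  1ₛ (suc n) = 0#

  private
    tail : PS → PS
    tail f = f ∘ suc

  *ₛ-cong : ∀ {f g h k} → f ≋ g → h ≋ k → (f *ₛ h) ≋ (g *ₛ k)
  *ₛ-cong f≋g h≋k zero = *-cong (f≋g 0) (h≋k 0)
  *ₛ-cong f≋g h≋k (suc n) = +-cong (*-cong (f≋g 0) (h≋k (suc n))) (*ₛ-cong (f≋g ∘ suc) h≋k n)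

  -- The definition peels the product off at the front of f; this peels it off at the front of g.
  -- Commutativity follows by comparing the two.
  *ₛ-suc : ∀ f g n → (f *ₛ g) (suc n) ≈ (f *ₛ tail g) n + f (suc n) * g 0
  *ₛ-suc f g zero = refl
  *ₛ-suc f g (suc n) = trans (+-congˡ (*ₛ-suc (tail f) g n)) (sym (+-assoc _ _ _))

  *ₛ-comm : ∀ f g → (f *ₛ g) ≋ (g *ₛ f)
  *ₛ-comm f g zero = *-comm _ _
  *ₛ-comm f g (suc n) = begin
    f 0 * g (suc n) + (tail f *ₛ g) n  ≈⟨ +-cong (*-comm _ _) (*ₛ-comm (tail f) g n) ⟩
    g (suc n) * f 0 + (g *ₛ tail f) n  ≈⟨ +-comm _ _ ⟩
    (g *ₛ tail f) n + g (suc n) * f 0  ≈⟨ *ₛ-suc g f n ⟨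
    (g *ₛ f) (suc n)                   ∎

  *ₛ-distribʳ : ∀ h f g → ((f +ₛ g) *ₛ h) ≋ ((f *ₛ h) +ₛ (g *ₛ h))
  *ₛ-distribʳ h f g zero = distribʳ _ _ _
  *ₛ-distribʳ h f g (suc n) = begin
    (f 0 + g 0) * h (suc n) + ((tail f +ₛ tail g) *ₛ h) n                  ≈⟨ +-congˡ (*ₛ-distribʳ h (tail f) (tail g) n) ⟩
    (f 0 + g 0) * h (suc n) + ((tail f *ₛ h) n + (tail g *ₛ h) n)          ≈⟨ lemma _ _ _ _ _ ⟩
    f 0 * h (suc n) + (tail f *ₛ h) n + (g 0 * h (suc n) + (tail g *ₛ h) n) ∎
    where
    lemma : ∀ a b c u v → (a + b) * c + (u + v) ≈ a * c + u + (b * c + v)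
    lemma = solve 5 (λ a b c u v → (a :+ b) :* c :+ (u :+ v) := a :* c :+ u :+ (b :* c :+ v)) refl

  *ₛ-scale : ∀ c f g n → ((λ k → c * f k) *ₛ g) n ≈ c * (f *ₛ g) n
  *ₛ-scale c f g zero = *-assoc _ _ _
  *ₛ-scale c f g (suc n) = begin
    c * f 0 * g (suc n) + ((λ k → c * tail f k) *ₛ g) n  ≈⟨ +-cong (*-assoc _ _ _) (*ₛ-scale c (tail f) g n) ⟩
    c * (f 0 * g (suc n)) + c * (tail f *ₛ g) n          ≈⟨ distribˡ _ _ _ ⟨
    c * (f *ₛ g) (suc n)                                 ∎

  *ₛ-assoc : ∀ f g h → ((f *ₛ g) *ₛ h) ≋ (f *ₛ (g *ₛ h))
  *ₛ-assoc f g h zero = *-assoc _ _ _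
  *ₛ-assoc f g h (suc n) = begin
    f 0 * g 0 * h (suc n) + (((λ k → f 0 * tail g k) +ₛ (tail f *ₛ g)) *ₛ h) n
      ≈⟨ +-congˡ (*ₛ-distribʳ h (λ k → f 0 * tail g k) (tail f *ₛ g) n) ⟩
    f 0 * g 0 * h (suc n) + (((λ k → f 0 * tail g k) *ₛ h) n + ((tail f *ₛ g) *ₛ h) n)
      ≈⟨ +-congˡ (+-cong (*ₛ-scale (f 0) (tail g) h n) (*ₛ-assoc (tail f) g h n)) ⟩
    f 0 * g 0 * h (suc n) + (f 0 * (tail g *ₛ h) n + (tail f *ₛ (g *ₛ h)) n)
      ≈⟨ lemma _ _ _ _ _ ⟩
    f 0 * (g 0 * h (suc n) + (tail g *ₛ h) n) + (tail f *ₛ (g *ₛ h)) n ∎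
    where
    lemma : ∀ a b c u v → a * b * c + (a * u + v) ≈ a * (b * c + u) + v
    lemma = solve 5 (λ a b c u v → a :* b :* c :+ (a :* u :+ v) := a :* (b :* c :+ u) :+ v) refl

  *ₛ-zeroˡ : ∀ f g → (∀ n → f n ≈ 0#) → ∀ n → (f *ₛ g) n ≈ 0#
  *ₛ-zeroˡ f g f≈0 zero = trans (*-congʳ (f≈0 0)) (zeroˡ _)
  *ₛ-zeroˡ f g f≈0 (suc n) =
    trans (+-cong (trans (*-congʳ (f≈0 0)) (zeroˡ _)) (*ₛ-zeroˡ (tail f) g (f≈0 ∘ suc) n)) (+-identityˡ _)

  *ₛ-identityˡ : ∀ f → (1ₛ *ₛ f) ≋ f
  *ₛ-identityˡ f zero = *-identityˡ _
  *ₛ-identityˡ f (suc n) =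
    trans (+-cong (*-identityˡ _) (*ₛ-zeroˡ (tail 1ₛ) f (λ _ → refl) n)) (+-identityʳ _)

  constₛ : Carrier → PS
  constₛ c zero = c
  constₛ c (suc n) = 0#

  constₛ-* : ∀ c f n → (constₛ c *ₛ f) n ≈ c * f n
  constₛ-* c f zero = refl
  constₛ-* c f (suc n) = trans (+-congˡ (*ₛ-zeroˡ (tail (constₛ c)) f (λ _ → refl) n)) (+-identityʳ _)

  Xₛ : PS
  Xₛ zero = 0#
  Xₛ (suc n) = 1ₛ n

  Xₛ-*-zero : ∀ f → (Xₛ *ₛ f) 0 ≈ 0#
  Xₛ-*-zero f = zeroˡ _

  Xₛ-*-suc : ∀ f n → (Xₛ *ₛ f) (suc n) ≈ f n
  Xₛ-*-suc f n = trans (+-cong (zeroˡ _) (*ₛ-identityˡ f n)) (+-identityˡ _)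

  commutativeRing : CommutativeRing 0ℓ 0ℓ
  commutativeRing = record
    { Carrier = PS
    ; _≈_ = _≋_
    ; _+_ = _+ₛ_
    ; _*_ = _*ₛ_
    ; -_ = λ f n → - f n
    ; 0# = λ _ → 0#
    ; 1# = 1ₛ
    ; isCommutativeRing = record
      { isRing = record
        { +-isAbelianGroup = record
          { isGroup = record
            { isMonoid = record
              { isSemigroup = record
                { isMagma = record
                  { isEquivalence = record
                    { refl = λ _ → refl
                    ; sym = λ f≋g n → sym (f≋g n)
                    ; trans = λ f≋g g≋h n → trans (f≋g n) (g≋h n)
                    }
                  ; ∙-cong = λ f≋g h≋k n → +-cong (f≋g n) (h≋k n)
                  }
                ; assoc = λ f g h n → +-assoc _ _ _
                }
              ; identity = (λ f n → +-identityˡ _) , (λ f n → +-identityʳ _)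
              }
            ; inverse = (λ f n → -‿inverseˡ _) , (λ f n → -‿inverseʳ _)
            ; ⁻¹-cong = λ f≋g n → -‿cong (f≋g n)
            }
          ; comm = λ f g n → +-comm _ _
          }
        ; *-cong = *ₛ-cong
        ; *-assoc = *ₛ-assoc
        ; *-identity = *ₛ-identityˡ , λ f n → trans (*ₛ-comm f 1ₛ n) (*ₛ-identityˡ f n)
        ; distrib = (λ h f g n → trans (*ₛ-comm h (f +ₛ g) n) (trans (*ₛ-distribʳ h f g n) (+-cong (*ₛ-comm f h n) (*ₛ-comm g h n))))
                  , *ₛ-distribʳ
        }
      ; *-comm = *ₛ-comm
      }
    }

-- The quotient by a congruence, on the same carrier and with the same operations. Hence terms can
-- be moved between exact and truncated series without conversion.
module Coarsening (R : CommutativeRing 0ℓ 0ℓ)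
  (_~_ : CommutativeRing.Carrier R → CommutativeRing.Carrier R → Set)
  (~-isEquivalence : IsEquivalence _~_)
  (≈⇒~ : ∀ {x y} → CommutativeRing._≈_ R x y → x ~ y)
  (+-cong-~ : ∀ {x y u v} → x ~ y → u ~ v → CommutativeRing._+_ R x u ~ CommutativeRing._+_ R y v)
  (*-cong-~ : ∀ {x y u v} → x ~ y → u ~ v → CommutativeRing._*_ R x u ~ CommutativeRing._*_ R y v)
  (neg-cong-~ : ∀ {x y} → x ~ y → CommutativeRing.-_ R x ~ CommutativeRing.-_ R y)
  where

  open CommutativeRing R

  commutativeRing~ : CommutativeRing 0ℓ 0ℓ
  commutativeRing~ = record
    { Carrier = Carrier
    ; _≈_ = _~_
    ; _+_ = _+_
    ; _*_ = _*_
    ; -_ = -_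
    ; 0# = 0#
    ; 1# = 1#
    ; isCommutativeRing = record
      { isRing = record
        { +-isAbelianGroup = record
          { isGroup = record
            { isMonoid = record
              { isSemigroup = record
                { isMagma = record { isEquivalence = ~-isEquivalence ; ∙-cong = +-cong-~ }
                ; assoc = λ x y z → ≈⇒~ (+-assoc x y z)
                }
              ; identity = (λ x → ≈⇒~ (+-identityˡ x)) , (λ x → ≈⇒~ (+-identityʳ x))
              }
            ; inverse = (λ x → ≈⇒~ (-‿inverseˡ x)) , (λ x → ≈⇒~ (-‿inverseʳ x))
            ; ⁻¹-cong = neg-cong-~
            }
          ; comm = λ x y → ≈⇒~ (+-comm x y)
          }
        ; *-cong = *-cong-~
        ; *-assoc = λ x y z → ≈⇒~ (*-assoc x y z)
        ; *-identity = (λ x → ≈⇒~ (*-identityˡ x)) , (λ x → ≈⇒~ (*-identityʳ x))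
        ; distrib = (λ x y z → ≈⇒~ (distribˡ x y z)) , (λ x y z → ≈⇒~ (distribʳ x y z))
        }
      ; *-comm = λ x y → ≈⇒~ (*-comm x y)
      }
    }

module AntidiagonalSums (R : CommutativeRing 0ℓ 0ℓ) where

  open CommutativeRing R
  open IntegerCoefficients R using (solve; _:=_; _:+_)

  AD : ℕ → (ℕ → ℕ → Carrier) → Carrier
  AD = antidiagonalSum _+_

  AD-cong : ∀ n {Φ Ψ} → (∀ k l → k ℕ.+ l ≡ n → Φ k l ≈ Ψ k l) → AD n Φ ≈ AD n Ψ
  AD-cong zero Φ≈Ψ = Φ≈Ψ 0 0 ≡.refl
  AD-cong (suc n) Φ≈Ψ = +-cong (Φ≈Ψ 0 (suc n) ≡.refl) (AD-cong n (λ k l k+l≡n → Φ≈Ψ (suc k) l (≡.cong suc k+l≡n)))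

  AD-0 : ∀ n → AD n (λ _ _ → 0#) ≈ 0#
  AD-0 zero = refl
  AD-0 (suc n) = trans (+-identityˡ _) (AD-0 n)

  AD-+ : ∀ n Φ Ψ → AD n (λ k l → Φ k l + Ψ k l) ≈ AD n Φ + AD n Ψ
  AD-+ zero Φ Ψ = refl
  AD-+ (suc n) Φ Ψ = trans (+-congˡ (AD-+ n (Φ ∘ suc) (Ψ ∘ suc))) (lemma _ _ _ _)
    where
    lemma : ∀ a b c d → (a + b) + (c + d) ≈ (a + c) + (b + d)
    lemma = solve 4 (λ a b c d → (a :+ b) :+ (c :+ d) := (a :+ c) :+ (b :+ d)) refl

  AD-* : ∀ n r Φ → AD n (λ k l → r * Φ k l) ≈ r * AD n Φ
  AD-* zero r Φ = refl
  AD-* (suc n) r Φ = trans (+-congˡ (AD-* n r (Φ ∘ suc))) (sym (distribˡ r _ _))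

  AD-first : ∀ n Φ → (∀ k l → Φ (suc k) l ≈ 0#) → AD n Φ ≈ Φ 0 n
  AD-first zero Φ Φ≈0 = refl
  AD-first (suc n) Φ Φ≈0 =
    trans (+-congˡ (trans (AD-cong n (λ k l _ → Φ≈0 k l)) (AD-0 n))) (+-identityʳ _)

  Kernel : Set
  Kernel = ℕ → ℕ → ℕ → ℕ → ℕ → ℕ → ℕ → ℕ → Carrier

  AD⁴ : ℕ → ℕ → ℕ → ℕ → Kernel → Carrier
  AD⁴ i j a b Φ = AD i λ i₁ i₂ → AD j λ j₁ j₂ → AD a λ a₁ a₂ → AD b λ b₁ b₂ → Φ i₁ i₂ j₁ j₂ a₁ a₂ b₁ b₂

  module _ (i j a b : ℕ) where

    AD⁴-cong : ∀ {Φ Ψ : Kernel} →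
               (∀ i₁ i₂ j₁ j₂ a₁ a₂ b₁ b₂ → i₁ ℕ.+ i₂ ≡ i → j₁ ℕ.+ j₂ ≡ j → a₁ ℕ.+ a₂ ≡ a → b₁ ℕ.+ b₂ ≡ b →
                Φ i₁ i₂ j₁ j₂ a₁ a₂ b₁ b₂ ≈ Ψ i₁ i₂ j₁ j₂ a₁ a₂ b₁ b₂) →
               AD⁴ i j a b Φ ≈ AD⁴ i j a b Ψ
    AD⁴-cong Φ≈Ψ = AD-cong i λ i₁ i₂ p → AD-cong j λ j₁ j₂ q → AD-cong a λ a₁ a₂ r → AD-cong b λ b₁ b₂ s →
      Φ≈Ψ i₁ i₂ j₁ j₂ a₁ a₂ b₁ b₂ p q r s

    AD⁴-0 : AD⁴ i j a b (λ _ _ _ _ _ _ _ _ → 0#) ≈ 0#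
    AD⁴-0 =
      trans (AD-cong i λ _ _ _ → trans (AD-cong j λ _ _ _ → trans (AD-cong a λ _ _ _ → AD-0 b) (AD-0 a)) (AD-0 j)) (AD-0 i)

    AD⁴-+ : ∀ (Φ Ψ : Kernel) →
            AD⁴ i j a b (λ i₁ i₂ j₁ j₂ a₁ a₂ b₁ b₂ → Φ i₁ i₂ j₁ j₂ a₁ a₂ b₁ b₂ + Ψ i₁ i₂ j₁ j₂ a₁ a₂ b₁ b₂)
            ≈ AD⁴ i j a b Φ + AD⁴ i j a b Ψ
    AD⁴-+ Φ Ψ =
      trans (AD-cong i λ _ _ _ → trans (AD-cong j λ _ _ _ → trans (AD-cong a λ _ _ _ → AD-+ b _ _) (AD-+ a _ _)) (AD-+ j _ _)) (AD-+ i _ _)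

    AD⁴-* : ∀ r (Φ : Kernel) →
            AD⁴ i j a b (λ i₁ i₂ j₁ j₂ a₁ a₂ b₁ b₂ → r * Φ i₁ i₂ j₁ j₂ a₁ a₂ b₁ b₂) ≈ r * AD⁴ i j a b Φ
    AD⁴-* r Φ =
      trans (AD-cong i λ _ _ _ → trans (AD-cong j λ _ _ _ → trans (AD-cong a λ _ _ _ → AD-* b r _) (AD-* a r _)) (AD-* j r _)) (AD-* i r _)

-- Filtered differential rings

module FiniteSums (R : CommutativeRing 0ℓ 0ℓ) where

  open CommutativeRing R
  open IntegerCoefficients R using (solve; _:=_; _:+_; _:*_; _:-_; :-_; con)

  ∑ : ℕ → (ℕ → Carrier) → Carrier
  ∑ zero f = 0#
  ∑ (suc n) f = ∑ n f + f n

  ∑-cong : ∀ n {f g} → (∀ k → f k ≈ g k) → ∑ n f ≈ ∑ n g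
  ∑-cong zero f≈g = refl
  ∑-cong (suc n) f≈g = +-cong (∑-cong n f≈g) (f≈g n)

  ∑-0 : ∀ n → ∑ n (λ _ → 0#) ≈ 0#
  ∑-0 zero = refl
  ∑-0 (suc n) = trans (+-identityʳ _) (∑-0 n)

  ∑-+ : ∀ n f g → ∑ n (λ k → f k + g k) ≈ ∑ n f + ∑ n g
  ∑-+ zero f g = sym (+-identityʳ _)
  ∑-+ (suc n) f g = trans (+-congʳ (∑-+ n f g)) (lemma _ _ _ _)
    where
    lemma : ∀ a b c d → (a + b) + (c + d) ≈ (a + c) + (b + d)
    lemma = solve 4 (λ a b c d → (a :+ b) :+ (c :+ d) := (a :+ c) :+ (b :+ d)) refl

  ∑-*ˡ : ∀ n c f → ∑ n (λ k → c * f k) ≈ c * ∑ n f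
  ∑-*ˡ zero c f = sym (zeroʳ c)
  ∑-*ˡ (suc n) c f = trans (+-congʳ (∑-*ˡ n c f)) (sym (distribˡ c _ _))

  ∑-neg : ∀ n f → ∑ n (λ k → - f k) ≈ - ∑ n f
  ∑-neg zero f = solve 0 (con (+ 0) := :- con (+ 0)) refl
  ∑-neg (suc n) f = trans (+-congʳ (∑-neg n f)) (solve 2 (λ a b → :- a :+ :- b := :- (a :+ b)) refl _ _)

  ∑-- : ∀ n f g → ∑ n (λ k → f k - g k) ≈ ∑ n f - ∑ n g
  ∑-- n f g = trans (∑-+ n f (-_ ∘ g)) (+-congˡ (∑-neg n g))

  ∑-swap : ∀ m n (f : ℕ → ℕ → Carrier) → ∑ m (λ i → ∑ n (f i)) ≈ ∑ n (λ j → ∑ m (λ i → f i j))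
  ∑-swap zero n f = sym (∑-0 n)
  ∑-swap (suc m) n f = trans (+-congʳ (∑-swap m n f)) (sym (∑-+ n (λ j → ∑ m (λ i → f i j)) (f m)))

  ∑-suc : ∀ n f → ∑ (suc n) f ≈ f 0 + ∑ n (f ∘ suc)
  ∑-suc zero f = +-comm 0# (f 0)
  ∑-suc (suc n) f = trans (+-congʳ (∑-suc n f)) (+-assoc _ _ _)

-- The model is a ring of truncated series with F n the series of order at least n; as F (suc top) vanishes,
-- infinite sums and products become finite.
record FilteredDifferentialRing : Set₁ where
  field
    base : CommutativeRing 0ℓ 0ℓ
  open CommutativeRing base
  field
    D : Carrier → Carrier
    D-cong : ∀ {x y} → x ≈ y → D x ≈ D y
    D-+ : ∀ x y → D (x + y) ≈ D x + D y
    D-neg : ∀ x → D (- x) ≈ - D x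
    D-* : ∀ x y → D (x * y) ≈ D x * y + x * D y
    D-0 : D 0# ≈ 0#
    D-1 : D 1# ≈ 0#
    F : ℕ → Carrier → Set
    F-resp-≈ : ∀ {n x y} → x ≈ y → F n x → F n y
    F-0 : ∀ {n} → F n 0#
    F-+ : ∀ {n x y} → F n x → F n y → F n (x + y)
    F-neg : ∀ {n x} → F n x → F n (- x)
    F-* : ∀ {m n x y} → F m x → F n y → F (m ℕ.+ n) (x * y)
    F-all : ∀ {x} → F 0 x
    F-antitone : ∀ {m n x} → m ≤ n → F n x → F m x
    F-D : ∀ {n x} → F n x → F n (D x)
    -- Integration: in the model D multiplies degree k by k, which is invertible except for k = 0,
    -- and degree 0 is covered by `F 1 x`.
    F-D⁻¹ : ∀ {n x} → F 1 x → F n (D x) → F n x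
    top : ℕ
    F-vanish : ∀ {x} → F (suc top) x → x ≈ 0#

module FilteredDifferentialRingTheory (A : FilteredDifferentialRing) where

  open FilteredDifferentialRing A public
  open CommutativeRing base public
  open IntegerCoefficients base using (solve; _:=_; _:+_; _:*_; _:-_; :-_; con)
  open FiniteSums base public
  open Exponentiation semiring public using (_^_)
  open SetoidReasoning setoid

  F-*ˡ : ∀ {n} x {y} → F n y → F n (x * y)
  F-*ˡ x y∈F = F-* (F-all {x}) y∈F

  F-*ʳ : ∀ {n x} y → F n x → F n (x * y)
  F-*ʳ y x∈F = F-resp-≈ (*-comm y _) (F-*ˡ y x∈F)

  F-- : ∀ {n x y} → F n x → F n y → F n (x - y)
  F-- x∈F y∈F = F-+ x∈F (F-neg y∈F)

  F-^ : ∀ {x} → F 1 x → ∀ n → F n (x ^ n)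
  F-^ x∈F₁ zero = F-all
  F-^ x∈F₁ (suc n) = F-* x∈F₁ (F-^ x∈F₁ n)

  F-∑ : ∀ {n} m {f} → (∀ k → F n (f k)) → F n (∑ m f)
  F-∑ zero f∈F = F-0
  F-∑ (suc m) f∈F = F-+ (F-∑ m f∈F) (f∈F m)

  -- Each substitution of the equation into itself raises the order of x by one, until the
  -- filtration is exhausted. This stands in for the invertibility of 1 - v.
  x≈vx⇒x≈0 : ∀ {v x} → F 1 v → x ≈ v * x → x ≈ 0#
  x≈vx⇒x≈0 {v} {x} v∈F₁ x≈vx = F-vanish (x∈F (suc top))
    where
    x∈F : ∀ n → F n x
    x∈F zero = F-all
    x∈F (suc n) = F-resp-≈ (sym x≈vx) (F-* v∈F₁ (x∈F n))

  -- Uniqueness for a linear differential equation: the factor Y raises the order of D x by one, and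
  -- integration passes the gain back to x.
  Dx≈Yx⇒x≈0 : ∀ {Y x} → F 1 Y → F 1 x → D x ≈ Y * x → x ≈ 0#
  Dx≈Yx⇒x≈0 {Y} {x} Y∈F₁ x∈F₁ Dx≈Yx = F-vanish (x∈F (suc top))
    where
    x∈F : ∀ n → F n x
    x∈F zero = F-all
    x∈F (suc n) = F-D⁻¹ x∈F₁ (F-resp-≈ (sym Dx≈Yx) (F-* Y∈F₁ (x∈F n)))

  x-y≈0⇒x≈y : ∀ {x y} → x - y ≈ 0# → x ≈ y
  x-y≈0⇒x≈y {x} {y} x-y≈0 = begin
    x          ≈⟨ solve 2 (λ x y → x := (x :- y) :+ y) refl x y ⟩
    (x - y) + y ≈⟨ +-congʳ x-y≈0 ⟩
    0# + y     ≈⟨ +-identityˡ y ⟩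
    y          ∎

  D-- : ∀ x y → D (x - y) ≈ D x - D y
  D-- x y = trans (D-+ x (- y)) (+-congˡ (D-neg y))

  D-∑ : ∀ n f → D (∑ n f) ≈ ∑ n (D ∘ f)
  D-∑ zero f = D-0
  D-∑ (suc n) f = trans (D-+ _ _) (+-congʳ (D-∑ n f))

  Constant : Carrier → Set
  Constant x = D x ≈ 0#

  D-constˡ : ∀ {c} x → Constant c → D (c * x) ≈ c * D x
  D-constˡ {c} x Dc≈0 = begin
    D (c * x)        ≈⟨ D-* c x ⟩
    D c * x + c * D x ≈⟨ +-congʳ (*-congʳ Dc≈0) ⟩
    0# * x + c * D x ≈⟨ solve 2 (λ x y → con (+ 0) :* x :+ y := y) refl x _ ⟩
    c * D x          ∎

  D-constʳ : ∀ {c} x → Constant c → D (x * c) ≈ D x * c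
  D-constʳ {c} x Dc≈0 = trans (D-cong (*-comm x c)) (trans (D-constˡ x Dc≈0) (*-comm c _))

  constant-* : ∀ {x y} → Constant x → Constant y → Constant (x * y)
  constant-* {x} {y} Dx≈0 Dy≈0 = trans (D-constˡ y Dx≈0) (trans (*-congˡ Dy≈0) (zeroʳ x))

  constant-^ : ∀ {x} → Constant x → ∀ n → Constant (x ^ n)
  constant-^ Dx≈0 zero = D-1
  constant-^ Dx≈0 (suc n) = constant-* Dx≈0 (constant-^ Dx≈0 n)

  constant-+ : ∀ {x y} → Constant x → Constant y → Constant (x + y)
  constant-+ Dx≈0 Dy≈0 = trans (D-+ _ _) (trans (+-cong Dx≈0 Dy≈0) (+-identityˡ 0#))

  ν : ℕ → Carrier
  ν zero = 0#
  ν (suc n) = 1# + ν n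

  D-^ : ∀ x n → D (x ^ suc n) ≈ ν (suc n) * (D x * x ^ n)
  D-^ x zero = trans (D-* x 1#) (trans (+-congˡ (*-congˡ D-1))
    (solve 2 (λ a x → a :* con (+ 1) :+ x :* con (+ 0) := (con (+ 1) :+ con (+ 0)) :* (a :* con (+ 1))) refl (D x) x))
  D-^ x (suc n) = trans (D-* x (x ^ suc n)) (trans (+-congˡ (*-congˡ (D-^ x n)))
    (solve 4 (λ a x n p → a :* (x :* p) :+ x :* ((con (+ 1) :+ n) :* (a :* p)) := (con (+ 1) :+ (con (+ 1) :+ n)) :* (a :* (x :* p)))
      refl (D x) x (ν n) (x ^ n)))

  -- φ r stands for 1/r!, known here only through φ (r + 1) (r + 1) = φ r, so that the abstract ring
  -- needs neither rationals nor factorials.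
  module Exponential (X : Carrier) (X∈F₁ : F 1 X)
    (φ : ℕ → Carrier) (φ-constant : ∀ r → Constant (φ r)) (φ-suc : ∀ r → φ (suc r) * ν (suc r) ≈ φ r) where

    exp< : ℕ → Carrier
    exp< K = ∑ K (λ r → φ r * X ^ r)

    D-exp< : ∀ K → D (exp< (suc K)) ≈ D X * exp< K
    D-exp< zero = begin
      D (0# + φ 0 * 1#)   ≈⟨ D-cong (solve 1 (λ a → con (+ 0) :+ a :* con (+ 1) := a) refl (φ 0)) ⟩
      D (φ 0)             ≈⟨ φ-constant 0 ⟩
      0#                  ≈⟨ zeroʳ (D X) ⟨
      D X * 0#            ∎
    D-exp< (suc K) = begin
      D (exp< (suc K) + φ (suc K) * X ^ suc K)
        ≈⟨ D-+ _ _ ⟩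
      D (exp< (suc K)) + D (φ (suc K) * X ^ suc K)
        ≈⟨ +-cong (D-exp< K) (trans (D-constˡ _ (φ-constant (suc K))) (*-congˡ (D-^ X K))) ⟩
      D X * exp< K + φ (suc K) * (ν (suc K) * (D X * X ^ K))
        ≈⟨ solve 5 (λ a e f n p → a :* e :+ f :* (n :* (a :* p)) := a :* (e :+ (f :* n) :* p)) refl (D X) (exp< K) (φ (suc K)) (ν (suc K)) (X ^ K) ⟩
      D X * (exp< K + (φ (suc K) * ν (suc K)) * X ^ K)
        ≈⟨ *-congˡ (+-congˡ (*-congʳ (φ-suc K))) ⟩
      D X * exp< (suc K) ∎

    -- Differentiation loses the last summand. The missing term D X * X ^ top has order `suc top`
    -- and is therefore zero.
    D-exp : D (exp< (suc top)) ≈ D X * exp< (suc top)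
    D-exp = begin
      D (exp< (suc top))                         ≈⟨ D-exp< top ⟩
      D X * exp< top                             ≈⟨ +-identityʳ _ ⟨
      D X * exp< top + 0#                        ≈⟨ +-congˡ last≈0 ⟨
      D X * exp< top + D X * (φ top * X ^ top)   ≈⟨ distribˡ _ _ _ ⟨
      D X * exp< (suc top)                       ∎
      where
      last≈0 : D X * (φ top * X ^ top) ≈ 0#
      last≈0 = F-vanish (F-* (F-D X∈F₁) (F-*ˡ (φ top) (F-^ X∈F₁ top)))

  -- The Lucas sequence of X² - e₁ X + e₂: U (n + 1) is the complete symmetric function h_n of the two roots.
  module Lucas (e₁ e₂ : Carrier) (e₁∈F₁ : F 1 e₁) (e₂∈F₁ : F 1 e₂) where

    U : ℕ → Carrier
    U zero = 0#
    U (suc zero) = 1#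
    U (suc (suc n)) = e₁ * U (suc n) - e₂ * U n

    -- Going back by one or by two places costs a coefficient of order 1, so two places always gain
    -- at least one order.
    recurrence-order : (s : ℕ → Carrier) → (∀ n → s (suc (suc n)) ≈ e₁ * s (suc n) - e₂ * s n) →
                       ∀ k n → 2 ℕ.* k ≤ n → F k (s n)
    recurrence-order s s-suc zero n _ = F-all
    recurrence-order s s-suc (suc k) n 2k+2≤n with ≡.subst (_≤ n) (ℕ.*-suc 2 k) 2k+2≤n
    ... | s≤s (s≤s {n = m} 2k≤m) = F-resp-≈ (sym (s-suc m))
      (F-- (F-* e₁∈F₁ (recurrence-order s s-suc k (suc m) (ℕ.m≤n⇒m≤1+n 2k≤m)))
           (F-* e₂∈F₁ (recurrence-order s s-suc k m 2k≤m)))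

    module PowerSums (P : ℕ → Carrier) (P-0 : P 0 ≈ 1# + 1#) (P-1 : P 1 ≈ e₁)
      (P-suc : ∀ n → P (suc (suc n)) ≈ e₁ * P (suc n) - e₂ * P n)
      (ι : ℕ → Carrier) (ι-constant : ∀ n → Constant (ι n)) (ι-inverse : ∀ n → ι (suc n) * ν (suc n) ≈ 1#) where

      -- Sharper than `recurrence-order`, because P 1 = e₁ already has order 1. In odd degree 2 d +
      -- 1 this gives order d + 1, which the cut-off 2 (a + b) in `Xser` requires.
      P-order : ∀ k n → 2 ℕ.* k ≤ suc n → F k (P n)
      P-order zero n _ = F-all
      P-order (suc k) n 2k+2≤1+n with n | ≡.subst (_≤ suc n) (ℕ.*-suc 2 k) 2k+2≤1+n
      ... | zero | s≤s ()
      ... | suc zero | s≤s (s≤s 2k≤0) = F-antitone (s≤s (ℕ.≤-trans (ℕ.m≤n*m k 2) 2k≤0)) (F-resp-≈ (sym P-1) e₁∈F₁)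
      ... | suc (suc n) | s≤s (s≤s 2k≤1+n) = F-resp-≈ (sym (P-suc n))
        (F-- (F-* e₁∈F₁ (P-order k (suc n) (ℕ.m≤n⇒m≤1+n 2k≤1+n)))
             (F-* e₂∈F₁ (P-order k n 2k≤1+n)))

      -- In terms of complete symmetric functions this is p_N = h_N - e₂ h_(N-2). It makes the
      -- induction for `D-P` close up in U alone.
      P-U : ∀ n → P (suc n) ≈ U (suc (suc n)) - e₂ * U n
      P-U zero = trans P-1 (solve 2 (λ a b → a := a :* con (+ 1) :- b :* con (+ 0) :- b :* con (+ 0)) refl e₁ e₂)
      P-U (suc zero) = begin
        P 2                               ≈⟨ P-suc 0 ⟩
        e₁ * P 1 - e₂ * P 0               ≈⟨ +-cong (*-congˡ P-1) (-‿cong (*-congˡ P-0)) ⟩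
        e₁ * e₁ - e₂ * (1# + 1#)
          ≈⟨ solve 2 (λ a b → a :* a :- b :* (con (+ 1) :+ con (+ 1)) :=
                              a :* (a :* con (+ 1) :- b :* con (+ 0)) :- b :* con (+ 1) :- b :* con (+ 1)) refl e₁ e₂ ⟩
        U 3 - e₂ * U 1                    ∎
      P-U (suc (suc n)) = begin
        P (suc (suc (suc n)))             ≈⟨ P-suc (suc n) ⟩
        e₁ * P (suc (suc n)) - e₂ * P (suc n)
          ≈⟨ +-cong (*-congˡ (P-U (suc n))) (-‿cong (*-congˡ (P-U n))) ⟩
        e₁ * (U (3 ℕ.+ n) - e₂ * U (suc n)) - e₂ * (U (2 ℕ.+ n) - e₂ * U n)
          ≈⟨ solve 6 (λ a b u₃ u₂ u₁ u₀ → a :* (u₃ :- b :* u₁) :- b :* (u₂ :- b :* u₀) := a :* u₃ :- b :* u₂ :- b :* (a :* u₁ :- b :* u₀))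
               refl e₁ e₂ (U (3 ℕ.+ n)) (U (2 ℕ.+ n)) (U (suc n)) (U n) ⟩
        U (4 ℕ.+ n) - e₂ * U (2 ℕ.+ n)    ∎

      D-P-suc : ∀ n → D (P (suc (suc n))) ≈ (D e₁ * P (suc n) + e₁ * D (P (suc n))) - (D e₂ * P n + e₂ * D (P n))
      D-P-suc n = trans (D-cong (P-suc n)) (trans (D-- _ _) (+-cong (D-* _ _) (-‿cong (D-* _ _))))

      D-P : ∀ n → D (P (suc n)) ≈ ν (suc n) * (D e₁ * U (suc n) - D e₂ * U n)
      D-P zero = trans (D-cong P-1) (solve 2 (λ a b → a := (con (+ 1) :+ con (+ 0)) :* (a :* con (+ 1) :- b :* con (+ 0))) refl (D e₁) (D e₂))
      D-P (suc zero) = begin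
        D (P 2) ≈⟨ D-P-suc 0 ⟩
        (D e₁ * P 1 + e₁ * D (P 1)) - (D e₂ * P 0 + e₂ * D (P 0))
          ≈⟨ +-cong (+-cong (*-congˡ P-1) (*-congˡ (D-cong P-1)))
                    (-‿cong (+-cong (*-congˡ P-0) (*-congˡ (trans (D-cong P-0) (constant-+ D-1 D-1))))) ⟩
        (D e₁ * e₁ + e₁ * D e₁) - (D e₂ * (1# + 1#) + e₂ * 0#)
          ≈⟨ solve 4 (λ e₁ e₂ a b → (a :* e₁ :+ e₁ :* a) :- (b :* (con (+ 1) :+ con (+ 1)) :+ e₂ :* con (+ 0))
                := (con (+ 1) :+ (con (+ 1) :+ con (+ 0))) :* (a :* (e₁ :* con (+ 1) :- e₂ :* con (+ 0)) :- b :* con (+ 1)))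
               refl e₁ e₂ (D e₁) (D e₂) ⟩
        ν 2 * (D e₁ * U 2 - D e₂ * U 1) ∎
      D-P (suc (suc n)) = begin
        D (P (3 ℕ.+ n)) ≈⟨ D-P-suc (suc n) ⟩
        (D e₁ * P (2 ℕ.+ n) + e₁ * D (P (2 ℕ.+ n))) - (D e₂ * P (suc n) + e₂ * D (P (suc n)))
          ≈⟨ +-cong (+-cong (*-congˡ (P-U (suc n))) (*-congˡ (D-P (suc n))))
                    (-‿cong (+-cong (*-congˡ (P-U n)) (*-congˡ (D-P n)))) ⟩
        (D e₁ * (U (3 ℕ.+ n) - e₂ * U (suc n)) + e₁ * (ν (2 ℕ.+ n) * (D e₁ * U (2 ℕ.+ n) - D e₂ * U (suc n))))
        - (D e₂ * (U (2 ℕ.+ n) - e₂ * U n) + e₂ * (ν (suc n) * (D e₁ * U (suc n) - D e₂ * U n)))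
          ≈⟨ solve 7 (λ e₁ e₂ a b n u₁ u₀ →
                 let u₂ = e₁ :* u₁ :- e₂ :* u₀ ; u₃ = e₁ :* u₂ :- e₂ :* u₁
                     n₁ = con (+ 1) :+ n ; n₂ = con (+ 1) :+ n₁ ; n₃ = con (+ 1) :+ n₂ in
                 (a :* (u₃ :- e₂ :* u₁) :+ e₁ :* (n₂ :* (a :* u₂ :- b :* u₁))) :- (b :* (u₂ :- e₂ :* u₀) :+ e₂ :* (n₁ :* (a :* u₁ :- b :* u₀)))
                 := n₃ :* (a :* u₃ :- b :* u₂))
               refl e₁ e₂ (D e₁) (D e₂) (ν n) (U (suc n)) (U n) ⟩
        ν (3 ℕ.+ n) * (D e₁ * U (3 ℕ.+ n) - D e₂ * U (2 ℕ.+ n)) ∎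

      α : Carrier → Carrier
      α x = 1# - e₁ * x + e₂ * (x * x)

      -- -log (α x) up to the term of degree K
      L : ℕ → Carrier → Carrier
      L K x = ∑ K (λ n → ι (suc n) * (P (suc n) * x ^ suc n))

      D-α : ∀ {x} → Constant x → D (α x) ≈ - (D e₁ * x - D e₂ * (x * x))
      D-α {x} Dx≈0 = begin
        D (α x)
          ≈⟨ trans (D-+ _ _) (+-cong (D-- _ _) (D-constʳ e₂ (constant-* Dx≈0 Dx≈0))) ⟩
        D 1# - D (e₁ * x) + D e₂ * (x * x)
          ≈⟨ +-congʳ (+-cong D-1 (-‿cong (D-constʳ e₁ Dx≈0))) ⟩
        0# - D e₁ * x + D e₂ * (x * x)
          ≈⟨ solve 3 (λ a b x → con (+ 0) :- a :* x :+ b :* (x :* x) := :- (a :* x :- b :* (x :* x))) refl (D e₁) (D e₂) x ⟩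
        - (D e₁ * x - D e₂ * (x * x)) ∎

      D-L : ∀ K {x} → Constant x → D (L K x) ≈ ∑ K (λ n → (D e₁ * U (suc n) - D e₂ * U n) * x ^ suc n)
      D-L K {x} Dx≈0 = trans (D-∑ K _) (∑-cong K λ n → begin
        D (ι (suc n) * (P (suc n) * x ^ suc n))
          ≈⟨ D-constˡ _ (ι-constant (suc n)) ⟩
        ι (suc n) * D (P (suc n) * x ^ suc n)
          ≈⟨ *-congˡ (D-constʳ _ (constant-^ Dx≈0 (suc n))) ⟩
        ι (suc n) * (D (P (suc n)) * x ^ suc n)
          ≈⟨ *-congˡ (*-congʳ (D-P n)) ⟩
        ι (suc n) * ((ν (suc n) * (D e₁ * U (suc n) - D e₂ * U n)) * x ^ suc n)
          ≈⟨ solve 4 (λ i v w p → i :* ((v :* w) :* p) := (i :* v) :* (w :* p)) refl _ _ _ _ ⟩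
        (ι (suc n) * ν (suc n)) * ((D e₁ * U (suc n) - D e₂ * U n) * x ^ suc n)
          ≈⟨ trans (*-congʳ (ι-inverse n)) (*-identityˡ _) ⟩
        (D e₁ * U (suc n) - D e₂ * U n) * x ^ suc n ∎)

      -- A finite form of Σ h_n x^n = 1 / α x. The recurrence of U annihilates the interior terms;
      -- every boundary term at the far end contains U K or U (K + 1).
      telescope : ∀ a b x K →
        α x * ∑ K (λ n → (a * U (suc n) - b * U n) * x ^ suc n)
        ≈ a * (x - U (suc K) * x ^ suc K + (e₂ * x) * U K * x ^ suc K)
        - b * (x * x - U K * x ^ suc K + (e₁ * U K - U (suc K)) * x * x ^ suc K)
      telescope a b x zero =
        solve 5 (λ e₁ e₂ a b x → (con (+ 1) :- e₁ :* x :+ e₂ :* (x :* x)) :* con (+ 0) :=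
          a :* (x :- con (+ 1) :* (x :* con (+ 1)) :+ (e₂ :* x) :* con (+ 0) :* (x :* con (+ 1)))
          :- b :* (x :* x :- con (+ 0) :* (x :* con (+ 1)) :+ (e₁ :* con (+ 0) :- con (+ 1)) :* x :* (x :* con (+ 1)))) refl e₁ e₂ a b x
      telescope a b x (suc K) = trans (distribˡ _ _ _) (trans (+-congʳ (telescope a b x K))
        (solve 8 (λ e₁ e₂ a b x u₁ u₀ p →
           let u₂ = e₁ :* u₁ :- e₂ :* u₀ in
           (a :* (x :- u₁ :* p :+ (e₂ :* x) :* u₀ :* p) :- b :* (x :* x :- u₀ :* p :+ (e₁ :* u₀ :- u₁) :* x :* p))
           :+ (con (+ 1) :- e₁ :* x :+ e₂ :* (x :* x)) :* ((a :* u₁ :- b :* u₀) :* p)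
           := a :* (x :- u₂ :* (x :* p) :+ (e₂ :* x) :* u₁ :* (x :* p)) :- b :* (x :* x :- u₁ :* (x :* p) :+ (e₁ :* u₁ :- u₂) :* x :* (x :* p)))
          refl e₁ e₂ a b x (U (suc K)) (U K) (x ^ suc K)))

      -- No smallness of x is assumed. The boundary terms of `telescope` vanish because U K and U (K
      -- + 1) have order at least `suc top`; this fixes the bound on K.
      α-D-L : ∀ K → 2 ℕ.* suc top ≤ K → ∀ {x} → Constant x → α x * D (L K x) ≈ - D (α x)
      α-D-L K 2top+2≤K {x} Dx≈0 = begin
        α x * D (L K x)
          ≈⟨ *-congˡ (D-L K Dx≈0) ⟩
        α x * ∑ K (λ n → (a * U (suc n) - b * U n) * x ^ suc n)
          ≈⟨ telescope a b x K ⟩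
        a * (x - U (suc K) * x ^ suc K + (e₂ * x) * U K * x ^ suc K)
        - b * (x * x - U K * x ^ suc K + (e₁ * U K - U (suc K)) * x * x ^ suc K)
          ≈⟨ +-cong (*-congˡ (+-cong (+-congˡ (-‿cong (*-congʳ U₁≈0))) (*-congʳ (*-congˡ U₀≈0))))
                    (-‿cong (*-congˡ (+-cong (+-congˡ (-‿cong (*-congʳ U₀≈0))) (*-congʳ (*-congʳ (+-cong (*-congˡ U₀≈0) (-‿cong U₁≈0))))))) ⟩
        a * (x - 0# * x ^ suc K + (e₂ * x) * 0# * x ^ suc K)
        - b * (x * x - 0# * x ^ suc K + (e₁ * 0# - 0#) * x * x ^ suc K)
          ≈⟨ solve 6 (λ e₁ e₂ a b x p →
               a :* (x :- con (+ 0) :* p :+ (e₂ :* x) :* con (+ 0) :* p)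
               :- b :* (x :* x :- con (+ 0) :* p :+ (e₁ :* con (+ 0) :- con (+ 0)) :* x :* p)
               := :- (:- (a :* x :- b :* (x :* x)))) refl e₁ e₂ a b x (x ^ suc K) ⟩
        - (- (a * x - b * (x * x)))
          ≈⟨ -‿cong (D-α Dx≈0) ⟨
        - D (α x) ∎
        where
        a b : Carrier
        a = D e₁
        b = D e₂
        U₀≈0 : U K ≈ 0#
        U₀≈0 = F-vanish (recurrence-order U (λ _ → refl) (suc top) K 2top+2≤K)
        U₁≈0 : U (suc K) ≈ 0#
        U₁≈0 = F-vanish (recurrence-order U (λ _ → refl) (suc top) (suc K) (ℕ.m≤n⇒m≤1+n 2top+2≤K))

      -- α x is 1 - v with v of order 1, so y = v * y.
      α-cancel : ∀ {x y} → α x * y ≈ 0# → y ≈ 0#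
      α-cancel {x} {y} αy≈0 = x≈vx⇒x≈0 v∈F₁ (begin
        y                 ≈⟨ solve 4 (λ e₁ e₂ x y → y := (con (+ 1) :- e₁ :* x :+ e₂ :* (x :* x)) :* y :+ (e₁ :* x :- e₂ :* (x :* x)) :* y) refl e₁ e₂ x y ⟩
        α x * y + v * y   ≈⟨ +-congʳ αy≈0 ⟩
        0# + v * y        ≈⟨ +-identityˡ _ ⟩
        v * y             ∎)
        where
        v : Carrier
        v = e₁ * x - e₂ * (x * x)
        v∈F₁ : F 1 v
        v∈F₁ = F-- (F-*ʳ x e₁∈F₁) (F-*ʳ (x * x) e₂∈F₁)

-- The exponential formula for products of quotients of quadratics

module ExponentialFormula (A : FilteredDifferentialRing) where

  open FilteredDifferentialRingTheory A
  open IntegerCoefficients base using (solve; _:=_; _:+_; _:*_; _:-_; :-_; con)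
  open SetoidReasoning setoid

  module PowerSumSequences
    (ι : ℕ → Carrier) (ι-constant : ∀ n → Constant (ι n)) (ι-inverse : ∀ n → ι (suc n) * ν (suc n) ≈ 1#)
    (w₁ w₂ z₁ z₂ : Carrier) (w₁∈F₁ : F 1 w₁) (w₂∈F₁ : F 1 w₂) (z₁∈F₁ : F 1 z₁) (z₂∈F₁ : F 1 z₂)
    (P Q : ℕ → Carrier)
    (P-0 : P 0 ≈ 1# + 1#) (P-1 : P 1 ≈ w₁) (P-suc : ∀ n → P (suc (suc n)) ≈ w₁ * P (suc n) - w₂ * P n)
    (Q-0 : Q 0 ≈ 1# + 1#) (Q-1 : Q 1 ≈ z₁) (Q-suc : ∀ n → Q (suc (suc n)) ≈ z₁ * Q (suc n) - z₂ * Q n)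
    where

    private
      module W = Lucas.PowerSums w₁ w₂ w₁∈F₁ w₂∈F₁ P P-0 P-1 P-suc ι ι-constant ι-inverse
      module Z = Lucas.PowerSums z₁ z₂ z₁∈F₁ z₂∈F₁ Q Q-0 Q-1 Q-suc ι ι-constant ι-inverse

    -- log (Z.α x / W.α x) up to the term of degree K
    Λ : ℕ → Carrier → Carrier
    Λ K x = W.L K x - Z.L K x

    module _ (K : ℕ) (2top+2≤K : 2 ℕ.* suc top ≤ K) where

      -- The logarithmic derivative of Z.α x / W.α x with denominators cleared, so that no inverse
      -- series has to be formed.
      D-Λ : ∀ {x} → Constant x → (W.α x * Z.α x) * D (Λ K x) ≈ W.α x * D (Z.α x) - Z.α x * D (W.α x)
      D-Λ {x} Dx≈0 = begin
        (W.α x * Z.α x) * D (Λ K x)                     ≈⟨ *-congˡ (D-- _ _) ⟩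
        (W.α x * Z.α x) * (D (W.L K x) - D (Z.L K x))
          ≈⟨ solve 4 (λ a b l m → (a :* b) :* (l :- m) := b :* (a :* l) :- a :* (b :* m)) refl _ _ _ _ ⟩
        Z.α x * (W.α x * D (W.L K x)) - W.α x * (Z.α x * D (Z.L K x))
          ≈⟨ +-cong (*-congˡ (W.α-D-L K 2top+2≤K Dx≈0)) (-‿cong (*-congˡ (Z.α-D-L K 2top+2≤K Dx≈0))) ⟩
        Z.α x * - D (W.α x) - W.α x * - D (Z.α x)
          ≈⟨ solve 4 (λ a b u v → b :* :- u :- a :* :- v := a :* v :- b :* u) refl _ _ _ _ ⟩
        W.α x * D (Z.α x) - Z.α x * D (W.α x)           ∎

      -- The quotient whose logarithm Λ represents is 1 at such an x. It is applied at x = c, where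
      -- it removes the correction terms of the exponent.
      D-Λ-≈0 : ∀ {x} → Constant x → W.α x ≈ Z.α x → D (Λ K x) ≈ 0#
      D-Λ-≈0 {x} Dx≈0 α≈ = Z.α-cancel (W.α-cancel (begin
        W.α x * (Z.α x * D (Λ K x))             ≈⟨ *-assoc _ _ _ ⟨
        (W.α x * Z.α x) * D (Λ K x)             ≈⟨ D-Λ Dx≈0 ⟩
        W.α x * D (Z.α x) - Z.α x * D (W.α x)   ≈⟨ +-congʳ (*-cong α≈ (D-cong (sym α≈))) ⟩
        Z.α x * D (W.α x) - Z.α x * D (W.α x)   ≈⟨ -‿inverseʳ _ ⟩
        0#                                      ∎))

      module PartialProducts (y : ℕ → Carrier) (y-constant : ∀ m → Constant (y m))
        (G : ℕ → Carrier) (G-0 : G 0 ≈ 1#) (G-suc : ∀ m → G (suc m) * W.α (y m) ≈ G m * Z.α (y m)) where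

        -- The logarithmic derivative of a product is the sum of those of its factors. Since G is
        -- given only by cross-multiplied relations, the defect is multiplied by both quadratics,
        -- shown to vanish, and the quadratics are cancelled.
        D-G : ∀ M → D (G M) ≈ ∑ M (λ m → D (Λ K (y m))) * G M
        D-G zero = trans (D-cong G-0) (trans D-1 (sym (zeroˡ _)))
        D-G (suc M) = x-y≈0⇒x≈y (Z.α-cancel (W.α-cancel (begin
          w * (z * (D g' - (Y + λ') * g'))
            ≈⟨ solve 6 (λ w z dg' y l g' → w :* (z :* (dg' :- (y :+ l) :* g')) :=
                 z :* (w :* dg' :- y :* (g' :* w)) :- (w :* z :* l) :* g') refl w z (D g') Y λ' g' ⟩
          z * (w * D g' - Y * (g' * w)) - (w * z * λ') * g'
            ≈⟨ +-cong (*-congˡ (+-congˡ (-‿cong (*-congˡ (G-suc M))))) (-‿cong (*-congʳ (D-Λ (y-constant M)))) ⟩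
          z * (w * D g' - Y * (g * z)) - (w * D z - z * D w) * g'
            ≈⟨ solve 8 (λ w z dg' y g dz dw g' → z :* (w :* dg' :- y :* (g :* z)) :- (w :* dz :- z :* dw) :* g' :=
                 z :* ((dg' :* w :+ g' :* dw) :- (y :* g) :* z) :- (g' :* w) :* dz) refl w z (D g') Y g (D z) (D w) g' ⟩
          z * ((D g' * w + g' * D w) - (Y * g) * z) - (g' * w) * D z
            ≈⟨ +-cong (*-congˡ (+-cong (trans (sym (D-* g' w)) (trans (D-cong (G-suc M)) (D-* g z))) (-‿cong (*-congʳ (sym (D-G M))))))
                      (-‿cong (*-congʳ (G-suc M))) ⟩
          z * ((D g * z + g * D z) - D g * z) - (g * z) * D z
            ≈⟨ solve 4 (λ z dg g dz → z :* ((dg :* z :+ g :* dz) :- dg :* z) :- (g :* z) :* dz := con (+ 0)) refl z (D g) g (D z) ⟩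
          0# ∎)))
          where
          w z Y λ' g g' : Carrier
          w = W.α (y M)
          z = Z.α (y M)
          Y = ∑ M (λ m → D (Λ K (y m)))
          λ' = D (Λ K (y M))
          g = G M
          g' = G (suc M)

        -- Both quadratics are 1 up to order 1, so each step changes G only in order 1. This is the
        -- initial condition for the uniqueness argument.
        G-1∈F₁ : ∀ M → F 1 (G M - 1#)
        G-1∈F₁ zero = F-resp-≈ (sym (trans (+-congʳ G-0) (-‿inverseʳ 1#))) F-0
        G-1∈F₁ (suc M) = F-resp-≈ (begin
          (G M - 1#) + (G (suc M) * (w₁ * x - w₂ * (x * x)) - G M * (z₁ * x - z₂ * (x * x)))
            ≈⟨ solve 7 (λ g g' w₁ w₂ z₁ z₂ x →
                 (g :- con (+ 1)) :+ (g' :* (w₁ :* x :- w₂ :* (x :* x)) :- g :* (z₁ :* x :- z₂ :* (x :* x))) :=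
                 (g' :- con (+ 1)) :+ (g :* (con (+ 1) :- z₁ :* x :+ z₂ :* (x :* x)) :- g' :* (con (+ 1) :- w₁ :* x :+ w₂ :* (x :* x))))
               refl (G M) (G (suc M)) w₁ w₂ z₁ z₂ x ⟩
          (G (suc M) - 1#) + (G M * Z.α x - G (suc M) * W.α x)
            ≈⟨ +-congˡ (trans (+-congˡ (-‿cong (G-suc M))) (-‿inverseʳ _)) ⟩
          (G (suc M) - 1#) + 0#
            ≈⟨ +-identityʳ _ ⟩
          G (suc M) - 1# ∎)
          (F-+ (G-1∈F₁ M) (F-- (F-*ˡ _ (F-- (F-*ʳ x w₁∈F₁) (F-*ʳ (x * x) w₂∈F₁)))
                               (F-*ˡ _ (F-- (F-*ʳ x z₁∈F₁) (F-*ʳ (x * x) z₂∈F₁)))))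
          where
          x : Carrier
          x = y M

    module Exponent (c : Carrier) (c-constant : Constant c)
      (M : ℕ) (y r : ℕ → Carrier) (y-constant : ∀ m → Constant (y m)) (r-constant : ∀ m → Constant (r m)) (y≈rc : ∀ m → y m ≈ r m * c)
      (α-c : W.α c ≈ Z.α c)
      (ζ : ℕ → Carrier) (ζ-sum : ∀ n → ζ (suc (suc n)) ≈ ∑ M (λ m → y m ^ suc n * (y m - c))) where

      -- ζ (n + 2) = S (n + 2) - c S (n + 1), so the sum of ζ n c^(N-n) over n ≤ N telescopes to S N.
      S : ℕ → Carrier
      S N = ∑ M (λ m → y m ^ N - r m * c ^ N)

      -- The correction r m * c ^ N in S is chosen for this: the telescoping ends at N = 1, where y
      -- m = r m * c leaves nothing over.
      S-1 : S 1 ≈ 0#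
      S-1 = trans (∑-cong M (λ m → trans (+-congʳ (*-congʳ (y≈rc m)))
        (solve 2 (λ r c → (r :* c) :* con (+ 1) :- r :* (c :* con (+ 1)) := con (+ 0)) refl (r m) c))) (∑-0 M)

      S-suc : ∀ n → S (suc (suc n)) ≈ c * S (suc n) + ζ (suc (suc n))
      S-suc n = begin
        ∑ M (λ m → y m ^ suc (suc n) - r m * c ^ suc (suc n))
          ≈⟨ ∑-cong M (λ m → solve 5 (λ y r c p q → y :* p :- r :* (c :* q) := c :* (p :- r :* q) :+ p :* (y :- c)) refl
               (y m) (r m) c (y m ^ suc n) (c ^ suc n)) ⟩
        ∑ M (λ m → c * (y m ^ suc n - r m * c ^ suc n) + y m ^ suc n * (y m - c))
          ≈⟨ ∑-+ M _ _ ⟩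
        ∑ M (λ m → c * (y m ^ suc n - r m * c ^ suc n)) + ∑ M (λ m → y m ^ suc n * (y m - c))
          ≈⟨ +-cong (∑-*ˡ M c _) (sym (ζ-sum n)) ⟩
        c * S (suc n) + ζ (suc (suc n)) ∎

      -- The exponent N - n refers to a fixed total N while the range of n grows. The slack e = N -
      -- (k + 1) makes the partial sums an induction on k.
      partial-S : ∀ k e → ∑ (suc (suc k)) (λ n → if 2 ≤ᵇ n then ζ n * c ^ ((suc k ℕ.+ e) ∸ n) else 0#) ≈ c ^ e * S (suc k)
      partial-S zero e = trans (trans (+-identityʳ _) (+-identityʳ _)) (sym (trans (*-congˡ S-1) (zeroʳ _)))
      partial-S (suc k) e = begin
        ∑ (suc (suc k)) (λ n → if 2 ≤ᵇ n then ζ n * c ^ ((suc (suc k) ℕ.+ e) ∸ n) else 0#) + ζ (suc (suc k)) * c ^ ((suc (suc k) ℕ.+ e) ∸ suc (suc k))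
          ≡⟨ ≡.cong₂ (λ s t → ∑ (suc (suc k)) (λ n → if 2 ≤ᵇ n then ζ n * c ^ (s ∸ n) else 0#) + ζ (suc (suc k)) * c ^ t)
               (≡.sym (ℕ.+-suc (suc k) e)) (ℕ.m+n∸m≡n (suc (suc k)) e) ⟩
        ∑ (suc (suc k)) (λ n → if 2 ≤ᵇ n then ζ n * c ^ ((suc k ℕ.+ suc e) ∸ n) else 0#) + ζ (suc (suc k)) * c ^ e
          ≈⟨ +-congʳ (partial-S k (suc e)) ⟩
        c ^ suc e * S (suc k) + ζ (suc (suc k)) * c ^ e
          ≈⟨ solve 4 (λ c p s z → (c :* p) :* s :+ z :* p := p :* (c :* s :+ z)) refl c (c ^ e) (S (suc k)) (ζ (suc (suc k))) ⟩
        c ^ e * (c * S (suc k) + ζ (suc (suc k)))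
          ≈⟨ *-congˡ (S-suc k) ⟨
        c ^ e * S (suc (suc k)) ∎

      X-term : ℕ → ℕ → Carrier
      X-term n m = ζ n * ι (m ℕ.+ n) * c ^ m * (P (m ℕ.+ n) - Q (m ℕ.+ n))

      X-degree : ℕ → Carrier
      X-degree N = ∑ (suc N) (λ n → if 2 ≤ᵇ n then X-term n (N ∸ n) else 0#)

      -- The bound on k is essential below: (N ∸ n) + n equals N only for n ≤ N.
      ∑-cong-< : ∀ n {f g} → (∀ k → k < n → f k ≈ g k) → ∑ n f ≈ ∑ n g
      ∑-cong-< zero f≈g = refl
      ∑-cong-< (suc n) f≈g = +-cong (∑-cong-< n (λ k k<n → f≈g k (ℕ.m<n⇒m<1+n k<n))) (f≈g n ℕ.≤-refl)

      X-degree-suc : ∀ N → X-degree (suc N) ≈ (ι (suc N) * (P (suc N) - Q (suc N))) * S (suc N)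
      X-degree-suc N = begin
        X-degree (suc N)
          ≈⟨ ∑-cong-< (suc (suc N)) step ⟩
        ∑ (suc (suc N)) (λ n → f * (if 2 ≤ᵇ n then ζ n * c ^ (suc N ∸ n) else 0#))
          ≈⟨ ∑-*ˡ (suc (suc N)) f _ ⟩
        f * ∑ (suc (suc N)) (λ n → if 2 ≤ᵇ n then ζ n * c ^ (suc N ∸ n) else 0#)
          ≡⟨ ≡.cong (λ s → f * ∑ (suc (suc N)) (λ n → if 2 ≤ᵇ n then ζ n * c ^ (s ∸ n) else 0#)) (≡.sym (ℕ.+-identityʳ (suc N))) ⟩
        f * ∑ (suc (suc N)) (λ n → if 2 ≤ᵇ n then ζ n * c ^ ((suc N ℕ.+ 0) ∸ n) else 0#)
          ≈⟨ *-congˡ (trans (partial-S N 0) (*-identityˡ _)) ⟩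
        f * S (suc N) ∎
        where
        f : Carrier
        f = ι (suc N) * (P (suc N) - Q (suc N))
        step : ∀ n → n < suc (suc N) →
               (if 2 ≤ᵇ n then X-term n (suc N ∸ n) else 0#) ≈ f * (if 2 ≤ᵇ n then ζ n * c ^ (suc N ∸ n) else 0#)
        step n (s≤s n≤1+N) with 2 ≤ᵇ n
        ... | false = sym (zeroʳ f)
        ... | true rewrite ℕ.m∸n+n≡m n≤1+N =
          solve 4 (λ z i p d → z :* i :* p :* d := (i :* d) :* (z :* p)) refl (ζ n) (ι (suc N)) (c ^ (suc N ∸ n)) (P (suc N) - Q (suc N))

      X-degree-0 : X-degree 0 ≈ 0#
      X-degree-0 = +-identityˡ 0#

      X-degree-order : ∀ k N → 2 ℕ.* k ≤ suc N → 1 ≤ N → F k (X-degree N)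
      X-degree-order k (suc N) 2k≤2+N _ = F-resp-≈ (sym (X-degree-suc N))
        (F-*ʳ _ (F-*ˡ _ (F-- (W.P-order k (suc N) 2k≤2+N) (Z.P-order k (suc N) 2k≤2+N))))

      X-degree∈F₁ : ∀ N → F 1 (X-degree N)
      X-degree∈F₁ zero = F-resp-≈ (sym X-degree-0) F-0
      X-degree∈F₁ (suc N) = X-degree-order 1 (suc N) (s≤s (s≤s z≤n)) (s≤s z≤n)

      -- For fixed m the sum over N is a logarithmic series, once at y m and once, weighted by - r
      -- m, at c. Interchanging the two finite sums separates them.
      ∑-X-degree : ∀ K → ∑ (suc K) X-degree ≈ ∑ M (λ m → Λ K (y m) - r m * Λ K c)
      ∑-X-degree K = begin
        ∑ (suc K) X-degree
          ≈⟨ trans (∑-suc K X-degree) (trans (+-congʳ X-degree-0) (+-identityˡ _)) ⟩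
        ∑ K (X-degree ∘ suc)
          ≈⟨ ∑-cong K (λ N → trans (X-degree-suc N) (sym (∑-*ˡ M _ _))) ⟩
        ∑ K (λ N → ∑ M (λ m → (ι (suc N) * (P (suc N) - Q (suc N))) * (y m ^ suc N - r m * c ^ suc N)))
          ≈⟨ ∑-swap K M _ ⟩
        ∑ M (λ m → ∑ K (λ N → (ι (suc N) * (P (suc N) - Q (suc N))) * (y m ^ suc N - r m * c ^ suc N)))
          ≈⟨ ∑-cong M inner ⟩
        ∑ M (λ m → Λ K (y m) - r m * Λ K c) ∎
        where
        termP termQ : Carrier → ℕ → Carrier
        termP x N = ι (suc N) * (P (suc N) * x ^ suc N)
        termQ x N = ι (suc N) * (Q (suc N) * x ^ suc N)
        Λ-∑ : ∀ x → ∑ K (λ N → termP x N - termQ x N) ≈ Λ K x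
        Λ-∑ x = ∑-- K (termP x) (termQ x)
        inner : ∀ m → ∑ K (λ N → (ι (suc N) * (P (suc N) - Q (suc N))) * (y m ^ suc N - r m * c ^ suc N)) ≈ Λ K (y m) - r m * Λ K c
        inner m = begin
          ∑ K (λ N → (ι (suc N) * (P (suc N) - Q (suc N))) * (y m ^ suc N - r m * c ^ suc N))
            ≈⟨ ∑-cong K (λ N → solve 6 (λ i p q a r b → (i :* (p :- q)) :* (a :- r :* b) :=
                 (i :* (p :* a) :- i :* (q :* a)) :- r :* (i :* (p :* b) :- i :* (q :* b))) refl
                 (ι (suc N)) (P (suc N)) (Q (suc N)) (y m ^ suc N) (r m) (c ^ suc N)) ⟩
          ∑ K (λ N → (termP (y m) N - termQ (y m) N) - r m * (termP c N - termQ c N))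
            ≈⟨ ∑-- K _ _ ⟩
          ∑ K (λ N → termP (y m) N - termQ (y m) N) - ∑ K (λ N → r m * (termP c N - termQ c N))
            ≈⟨ +-cong (Λ-∑ (y m)) (-‿cong (trans (∑-*ˡ K (r m) _) (*-congˡ (Λ-∑ c)))) ⟩
          Λ K (y m) - r m * Λ K c ∎

      D-X : ∀ K → 2 ℕ.* suc top ≤ K → D (∑ (suc K) X-degree) ≈ ∑ M (λ m → D (Λ K (y m)))
      D-X K 2top+2≤K = begin
        D (∑ (suc K) X-degree)                               ≈⟨ D-cong (∑-X-degree K) ⟩
        D (∑ M (λ m → Λ K (y m) - r m * Λ K c))              ≈⟨ D-∑ M _ ⟩
        ∑ M (λ m → D (Λ K (y m) - r m * Λ K c))              ≈⟨ ∑-cong M step ⟩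
        ∑ M (λ m → D (Λ K (y m)))                            ∎
        where
        step : ∀ m → D (Λ K (y m) - r m * Λ K c) ≈ D (Λ K (y m))
        step m = begin
          D (Λ K (y m) - r m * Λ K c)
            ≈⟨ D-- _ _ ⟩
          D (Λ K (y m)) - D (r m * Λ K c)
            ≈⟨ +-congˡ (-‿cong (trans (D-constˡ _ (r-constant m)) (*-congˡ (D-Λ-≈0 K 2top+2≤K c-constant α-c)))) ⟩
          D (Λ K (y m)) - r m * 0#
            ≈⟨ solve 2 (λ d r → d :- r :* con (+ 0) := d) refl _ (r m) ⟩
          D (Λ K (y m)) ∎

      module _ (K : ℕ) (2top+2≤K : 2 ℕ.* suc top ≤ K)
        (G : ℕ → Carrier) (G-0 : G 0 ≈ 1#) (G-suc : ∀ m → G (suc m) * W.α (y m) ≈ G m * Z.α (y m))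
        (X : Carrier) (X≈ : X ≈ ∑ (suc K) X-degree)
        (φ : ℕ → Carrier) (φ-constant : ∀ r → Constant (φ r)) (φ-0 : φ 0 ≈ 1#) (φ-suc : ∀ r → φ (suc r) * ν (suc r) ≈ φ r) where

        open PartialProducts K 2top+2≤K y y-constant G G-0 G-suc

        X∈F₁ : F 1 X
        X∈F₁ = F-resp-≈ (sym X≈) (F-∑ (suc K) X-degree∈F₁)

        open Exponential X X∈F₁ φ φ-constant φ-suc

        exp-1∈F₁ : F 1 (exp< (suc top) - 1#)
        exp-1∈F₁ = F-resp-≈ (begin
          ∑ top (λ r → φ (suc r) * X ^ suc r)
            ≈⟨ solve 1 (λ s → s := (con (+ 1) :* con (+ 1) :+ s) :- con (+ 1)) refl _ ⟩
          (1# * 1# + ∑ top (λ r → φ (suc r) * X ^ suc r)) - 1#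
            ≈⟨ +-congʳ (+-congʳ (*-congʳ φ-0)) ⟨
          (φ 0 * 1# + ∑ top (λ r → φ (suc r) * X ^ suc r)) - 1#
            ≈⟨ +-congʳ (∑-suc top _) ⟨
          exp< (suc top) - 1# ∎)
          (F-∑ top (λ r → F-*ˡ (φ (suc r)) (F-*ʳ (X ^ r) X∈F₁)))

        G≈exp : G M ≈ exp< (suc top)
        G≈exp = x-y≈0⇒x≈y (Dx≈Yx⇒x≈0 (F-D X∈F₁)
          (F-resp-≈ (solve 2 (λ a b → (a :- con (+ 1)) :- (b :- con (+ 1)) := a :- b) refl (G M) (exp< (suc top)))
            (F-- (G-1∈F₁ M) exp-1∈F₁))
          (begin
            D (G M - exp< (suc top))            ≈⟨ D-- _ _ ⟩
            D (G M) - D (exp< (suc top))        ≈⟨ +-cong DG (-‿cong D-exp) ⟩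
            D X * G M - D X * exp< (suc top)    ≈⟨ solve 3 (λ x a b → x :* a :- x :* b := x :* (a :- b)) refl (D X) (G M) _ ⟩
            D X * (G M - exp< (suc top))        ∎))
          where
          DG : D (G M) ≈ D X * G M
          DG = trans (D-G M) (*-congʳ (sym (trans (D-cong X≈) (D-X K 2top+2≤K))))

-- Indices and their fillings

Admissible : Index → Set
Admissible ks = admissibleᵇ ks ≡ true

large : ℕ → Index → Bool
large zero [] = true
large zero (_ ∷ _) = false
large (suc l) [] = false
large (suc l) (k ∷ ks) = (2 ≤ᵇ k) ∧ large l ks

-- Agrees with `I₀ n l l` except that `J 0 0` contains the empty index, which supplies the 1 missing
-- from the left-hand side.
J : ℕ → ℕ → List Index
J n l = filterᵇ (large l) (compositions n)

module _ {A : Set} where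

  filterᵇ-cong : ∀ {p q : A → Bool} → (∀ x → p x ≡ q x) → ∀ xs → filterᵇ p xs ≡ filterᵇ q xs
  filterᵇ-cong p≡q [] = ≡.refl
  filterᵇ-cong {p} {q} p≡q (x ∷ xs) with p x | q x | p≡q x
  ... | true | .true | ≡.refl = cong (x ∷_) (filterᵇ-cong p≡q xs)
  ... | false | .false | ≡.refl = filterᵇ-cong p≡q xs

  filterᵇ-++ : ∀ (p : A → Bool) xs ys → filterᵇ p (xs ++ ys) ≡ filterᵇ p xs ++ filterᵇ p ys
  filterᵇ-++ p [] ys = ≡.refl
  filterᵇ-++ p (x ∷ xs) ys with p x
  ... | true = cong (x ∷_) (filterᵇ-++ p xs ys)
  ... | false = filterᵇ-++ p xs ys

  filterᵇ-map : ∀ {B : Set} (p : B → Bool) (f : A → B) xs → filterᵇ p (map f xs) ≡ map f (filterᵇ (p ∘ f) xs)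
  filterᵇ-map p f [] = ≡.refl
  filterᵇ-map p f (x ∷ xs) with p (f x)
  ... | true = cong (f x ∷_) (filterᵇ-map p f xs)
  ... | false = filterᵇ-map p f xs

  filterᵇ-none : ∀ {p : A → Bool} {xs} → All (λ x → p x ≡ false) xs → filterᵇ p xs ≡ []
  filterᵇ-none [] = ≡.refl
  filterᵇ-none {p} {x ∷ xs} (px ∷ pxs) rewrite px = filterᵇ-none pxs

height≤depth : ∀ ks → height ks ≤ depth ks
height≤depth [] = z≤n
height≤depth (k ∷ ks) with 2 ≤ᵇ k
... | true = s≤s (height≤depth ks)
... | false = ℕ.m≤n⇒m≤1+n (height≤depth ks)

<⇒≡ᵇ-false : ∀ {m n} → m < n → (m ≡ᵇ n) ≡ false
<⇒≡ᵇ-false {zero} {suc n} _ = ≡.refl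
<⇒≡ᵇ-false {suc m} {suc n} (s≤s m<n) = <⇒≡ᵇ-false m<n

-- A single entry below 2 leaves the height strictly smaller than the depth, since the remaining
-- entries contribute at most one each.
large-correct : ∀ l ks → ((depth ks ≡ᵇ l) ∧ (height ks ≡ᵇ l)) ≡ large l ks
large-correct zero [] = ≡.refl
large-correct zero (k ∷ ks) = ≡.refl
large-correct (suc l) [] = ≡.refl
large-correct (suc l) (k ∷ ks) with 2 ≤ᵇ k
... | true = large-correct l ks
... | false with depth ks ≡ᵇ l in eq
...   | false = ≡.refl
...   | true = <⇒≡ᵇ-false (s≤s (≡.subst (height ks ≤_) (ℕ.≡ᵇ⇒≡ (depth ks) l (≡.subst T (≡.sym eq) tt)) (height≤depth ks)))

large-admissible : ∀ l ks → (large (suc l) ks ∧ admissibleᵇ ks) ≡ large (suc l) ks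
large-admissible l [] = ≡.refl
large-admissible l (k ∷ ks) with 2 ≤ᵇ k
... | false = ≡.refl
... | true with large l ks
...   | true = ≡.refl
...   | false = ≡.refl

I₀-zero : ∀ n → I₀ n 0 0 ≡ []
I₀-zero n = filterᵇ-none (All.universal none (compositions n))
  where
  none : ∀ ks → ((depth ks ≡ᵇ 0) ∧ (height ks ≡ᵇ 0) ∧ admissibleᵇ ks) ≡ false
  none [] = ≡.refl
  none (_ ∷ _) = ≡.refl

I₀-suc : ∀ n l → I₀ n (suc l) (suc l) ≡ J n (suc l)
I₀-suc n l = filterᵇ-cong agree (compositions n)
  where
  agree : ∀ ks → ((depth ks ≡ᵇ suc l) ∧ (height ks ≡ᵇ suc l) ∧ admissibleᵇ ks) ≡ large (suc l) ks
  agree ks = ≡.trans (≡.sym (∧-assoc (depth ks ≡ᵇ suc l) _ _))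
    (≡.trans (cong (_∧ admissibleᵇ ks) (large-correct (suc l) ks)) (large-admissible l ks))

inc : Index → Index
inc [] = []
inc (k ∷ ks) = suc k ∷ ks

data LargeHead : Index → Set where
  largeHead : ∀ k ks → LargeHead (suc (suc k) ∷ ks)

incHeads : ℕ → List Index
incHeads n = concatMap incHead (compositions n)

incHead-1∷ : ∀ xs → concatMap incHead (map (1 ∷_) xs) ≡ map (2 ∷_) xs
incHead-1∷ [] = ≡.refl
incHead-1∷ (x ∷ xs) = cong ((2 ∷ x) ∷_) (incHead-1∷ xs)

incHeads-suc : ∀ n → incHeads (suc n) ≡ map (2 ∷_) (compositions n) ++ concatMap incHead (incHeads n)
incHeads-suc n = ≡.trans (List.concatMap-++ incHead (map (1 ∷_) (compositions n)) (incHeads n))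
  (cong (_++ concatMap incHead (incHeads n)) (incHead-1∷ (compositions n)))

incHead-largeHead : ∀ {xs} → All LargeHead xs → All LargeHead (concatMap incHead xs)
incHead-largeHead [] = []
incHead-largeHead (largeHead k ks ∷ ps) = largeHead (suc k) ks ∷ incHead-largeHead ps

incHeads-largeHead : ∀ n → All LargeHead (incHeads n)
incHeads-largeHead zero = []
incHeads-largeHead (suc n) rewrite incHeads-suc n =
  All.++⁺ (All.map⁺ (All.universal (largeHead 0) (compositions n))) (incHead-largeHead (incHeads-largeHead n))

filterᵇ-incHead : ∀ l {xs} → All LargeHead xs →
                  filterᵇ (large (suc l)) (concatMap incHead xs) ≡ map inc (filterᵇ (large (suc l)) xs)
filterᵇ-incHead l [] = ≡.refl
filterᵇ-incHead l (largeHead k ks ∷ ps) with large l ks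
... | true = cong ((suc (suc (suc k)) ∷ ks) ∷_) (filterᵇ-incHead l ps)
... | false = filterᵇ-incHead l ps

J-suc : ∀ n l → J (suc n) (suc l) ≡ filterᵇ (large (suc l)) (incHeads n)
J-suc n l = ≡.trans (filterᵇ-++ (large (suc l)) (map (1 ∷_) (compositions n)) (incHeads n))
  (cong (_++ filterᵇ (large (suc l)) (incHeads n))
    (filterᵇ-none (All.map⁺ (All.universal (λ _ → ≡.refl) (compositions n)))))

-- Either the first entry is 2 and the tail is arbitrary, or it is at least 3 and can be lowered by
-- one within the family. Summed over indices, this dichotomy becomes the equation for the growth of
-- the generating function.
J-recursion : ∀ n l → J (suc (suc n)) (suc l) ≡ map (2 ∷_) (J n l) ++ map inc (J (suc n) (suc l))
J-recursion n l = begin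
  J (suc (suc n)) (suc l)
    ≡⟨ J-suc (suc n) l ⟩
  filterᵇ (large (suc l)) (incHeads (suc n))
    ≡⟨ cong (filterᵇ (large (suc l))) (incHeads-suc n) ⟩
  filterᵇ (large (suc l)) (map (2 ∷_) (compositions n) ++ concatMap incHead (incHeads n))
    ≡⟨ filterᵇ-++ (large (suc l)) (map (2 ∷_) (compositions n)) _ ⟩
  filterᵇ (large (suc l)) (map (2 ∷_) (compositions n)) ++ filterᵇ (large (suc l)) (concatMap incHead (incHeads n))
    ≡⟨ cong₂ _++_ (filterᵇ-map (large (suc l)) (2 ∷_) (compositions n))
         (≡.trans (filterᵇ-incHead l (incHeads-largeHead n)) (cong (map inc) (≡.sym (J-suc n l)))) ⟩
  map (2 ∷_) (J n l) ++ map inc (J (suc n) (suc l)) ∎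
  where open ≡-Reasoning

J-suc-0 : ∀ n → J (suc n) 0 ≡ []
J-suc-0 n = filterᵇ-none (All.++⁺ (All.map⁺ (All.universal (λ _ → ≡.refl) (compositions n))) (All.map nonempty (incHeads-largeHead n)))
  where
  nonempty : ∀ {ks} → LargeHead ks → large 0 ks ≡ false
  nonempty (largeHead _ _) = ≡.refl

J-empty : ∀ n l → n < 2 ℕ.* l → J n l ≡ []
J-empty zero (suc l) _ = ≡.refl
J-empty (suc zero) (suc l) _ = ≡.refl
J-empty (suc (suc n)) (suc l) n+2<2l+2 =
  ≡.trans (J-recursion n l) (cong₂ (λ xs ys → map (2 ∷_) xs ++ map inc ys)
    (J-empty n l (ℕ.+-cancelˡ-< 2 n (2 ℕ.* l) (≡.subst (suc (suc n) <_) (ℕ.*-suc 2 l) n+2<2l+2)))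
    (J-empty (suc n) (suc l) (ℕ.<-trans (ℕ.n<1+n (suc n)) n+2<2l+2)))

large⇒All : ∀ l ks → T (large l ks) → All (2 ≤_) ks
large⇒All zero [] _ = []
large⇒All (suc l) (suc (suc k) ∷ ks) p = s≤s (s≤s z≤n) ∷ large⇒All l ks p

J-large : ∀ n l → All (All (2 ≤_)) (J n l)
J-large n l = All.map (λ {ks} → large⇒All l ks) (go (compositions n))
  where
  go : ∀ xs → All (T ∘ large l) (filterᵇ (large l) xs)
  go [] = []
  go (x ∷ xs) with large l x in eq
  ... | true = ≡.subst T (≡.sym eq) tt ∷ go xs
  ... | false = go xs

J-suc-nonempty : ∀ n l → All Admissible (J n (suc l))
J-suc-nonempty n l = go (compositions n)
  where
  go : ∀ xs → All Admissible (filterᵇ (large (suc l)) xs)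
  go [] = []
  go ([] ∷ xs) = go xs
  go ((k ∷ ks) ∷ xs) with 2 ≤ᵇ k in eq
  ... | false = go xs
  ... | true with large l ks
  ...   | true = eq ∷ go xs
  ...   | false = go xs

Filling : Set
Filling = Index Product.× ℕ Product.× ℕ

fillComma : ℕ → Filling → Filling
fillComma k (p , i , j) = k ∷ p , i , j

fillPlus fillMinusOnePlus : Filling → Filling
fillPlus (p , i , j) = p , suc i , j
fillMinusOnePlus (p , i , j) = p , suc i , suc j

-- Merging entries a, b ≥ 2 gives at least a + b - 1 ≥ 3. Admissibility is what justifies the
-- cut-off in `ζq` for every filling.
fillGo-admissible : ∀ {k} ks → 2 ≤ k → All (2 ≤_) ks → All (Admissible ∘ proj₁) (fillGo k ks)
fillGo-admissible {k} [] (s≤s (s≤s _)) _ = ≡.refl ∷ []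
fillGo-admissible {suc (suc k)} (suc (suc l) ∷ ks) (s≤s (s≤s _)) (s≤s (s≤s _) ∷ 2≤ks) =
  All.++⁺ {xs = map (fillComma (suc (suc k))) A} (All.map⁺ (All.universal (λ _ → ≡.refl) A))
  (All.++⁺ {xs = map fillPlus B} (All.map⁺ {f = fillPlus} (fillGo-admissible ks (s≤s (s≤s z≤n)) 2≤ks))
    (All.map⁺ {f = fillMinusOnePlus} (fillGo-admissible ks (ℕ.≤-trans (s≤s (s≤s z≤n)) (ℕ.m≤n+m (suc (suc l)) (suc k))) 2≤ks)))
  where
  A B : List Filling
  A = fillGo (suc (suc l)) ks
  B = fillGo (suc (suc k) ℕ.+ suc (suc l)) ks

-- Interpolated values under one more summation index, and the zeta summands

module ListSums (R : CommutativeRing 0ℓ 0ℓ) where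

  open CommutativeRing R

  sum : List Carrier → Carrier
  sum = foldr _+_ 0#

  sum-++ : ∀ xs ys → sum (xs ++ ys) ≈ sum xs + sum ys
  sum-++ [] ys = sym (+-identityˡ _)
  sum-++ (x ∷ xs) ys = trans (+-congˡ (sum-++ xs ys)) (sym (+-assoc _ _ _))

  module _ {A : Set} where

    sum-cong : ∀ {f g : A → Carrier} {xs} → All (λ x → f x ≈ g x) xs → sum (map f xs) ≈ sum (map g xs)
    sum-cong [] = refl
    sum-cong (p ∷ ps) = +-cong p (sum-cong ps)

    sum-+ : ∀ (f g : A → Carrier) xs → sum (map (λ x → f x + g x) xs) ≈ sum (map f xs) + sum (map g xs)
    sum-+ f g [] = sym (+-identityˡ _)
    sum-+ f g (x ∷ xs) = trans (+-congˡ (sum-+ f g xs)) (lemma _ _ _ _)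
      where
      open IntegerCoefficients R
      lemma : ∀ a b c d → (a + b) + (c + d) ≈ (a + c) + (b + d)
      lemma = solve 4 (λ a b c d → (a :+ b) :+ (c :+ d) := (a :+ c) :+ (b :+ d)) refl

    sum-* : ∀ c (f : A → Carrier) xs → sum (map (λ x → c * f x) xs) ≈ c * sum (map f xs)
    sum-* c f [] = sym (zeroʳ c)
    sum-* c f (x ∷ xs) = trans (+-congˡ (sum-* c f xs)) (sym (distribˡ _ _ _))

    sum-0 : ∀ {f : A → Carrier} {xs} → All (λ x → f x ≈ 0#) xs → sum (map f xs) ≈ 0#
    sum-0 [] = refl
    sum-0 (p ∷ ps) = trans (+-cong p (sum-0 ps)) (+-identityˡ _)

    sum-map : ∀ {B : Set} {f : B → Carrier} {h : A → B} {g : A → Carrier} {xs} → All (λ x → f (h x) ≈ g x) xs →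
              sum (map f (map h xs)) ≈ sum (map g xs)
    sum-map [] = refl
    sum-map (p ∷ ps) = +-cong p (sum-map ps)

module Interpolation (R : CommutativeRing 0ℓ 0ℓ) where

  open CommutativeRing R
  open IntegerCoefficients R using (solve; _:=_; _:+_; _:*_; _:-_; :-_; con)
  open ListSums R
  open Exponentiation semiring using (_^_)
  open SetoidReasoning setoid

  -- ζ and ζ′ stand for two consecutive truncations of ζ_q, and τ k for the summand of q^((k-1)m)/[m]^k that separates them.
  module Truncations
    (t s : Carrier) (ζ ζ′ : Index → Carrier) (τ : ℕ → Carrier)
    (ζ′-[] : ζ′ [] ≈ ζ [])
    (ζ′-∷ : ∀ k ks → ζ′ (k ∷ ks) ≈ ζ (k ∷ ks) + τ k * ζ ks)
    (τ-merge : ∀ k l → τ (2 ℕ.+ k ℕ.+ (2 ℕ.+ l)) + s * τ (2 ℕ.+ k ℕ.+ (2 ℕ.+ l) ∸ 1) ≈ τ (2 ℕ.+ k) * τ (2 ℕ.+ l))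
    (ζ-[] : ζ [] ≈ 1#)
    where

    value : (Index → Carrier) → Filling → Carrier
    value z (p , i , j) = t ^ i * s ^ j * z p

    Δvalue : Filling → Carrier
    Δvalue x = value ζ′ x - value ζ x

    Z ΔZ : Index → Carrier
    Z ks = sum (map (value ζ) (fillings ks))
    ΔZ ks = sum (map Δvalue (fillings ks))

    ΔZ-[] : ΔZ [] ≈ 0#
    ΔZ-[] = trans (+-identityʳ _) (trans (+-congʳ (*-congˡ ζ′-[])) (-‿inverseʳ _))

    Z-[] : Z [] ≈ 1#
    Z-[] = trans (+-identityʳ _) (trans (*-cong (*-identityˡ 1#) ζ-[]) (*-identityˡ 1#))

    Z+ΔZ : ∀ ks → Z ks + ΔZ ks ≈ sum (map (value ζ′) (fillings ks))
    Z+ΔZ ks = trans (sym (sum-+ (value ζ) Δvalue (fillings ks)))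
      (sum-cong (All.universal (λ x → solve 2 (λ a b → a :+ (b :- a) := b) refl (value ζ x) (value ζ′ x)) (fillings ks)))

    Δvalue-comma : ∀ k x → Δvalue (fillComma k x) ≈ τ k * value ζ x
    Δvalue-comma k (p , i , j) = trans (+-congʳ (*-congˡ (ζ′-∷ k p)))
      (solve 4 (λ x z y w → x :* (z :+ y :* w) :- x :* z := y :* (x :* w)) refl (t ^ i * s ^ j) (ζ (k ∷ p)) (τ k) (ζ p))

    Δvalue-plus : ∀ x → Δvalue (fillPlus x) ≈ t * Δvalue x
    Δvalue-plus (p , i , j) =
      solve 5 (λ t x y z w → (t :* x) :* y :* z :- (t :* x) :* y :* w := t :* (x :* y :* z :- x :* y :* w)) refl t (t ^ i) (s ^ j) (ζ′ p) (ζ p)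

    Δvalue-minusOnePlus : ∀ x → Δvalue (fillMinusOnePlus x) ≈ (t * s) * Δvalue x
    Δvalue-minusOnePlus (p , i , j) =
      solve 6 (λ t s x y z w → (t :* x) :* (s :* y) :* z :- (t :* x) :* (s :* y) :* w := (t :* s) :* (x :* y :* z :- x :* y :* w))
        refl t s (t ^ i) (s ^ j) (ζ′ p) (ζ p)

    -- The newly gained terms have m₁ = M in the picture m₁ ≥ m₂ ≥ .... The remaining indices either
    -- stay below M, which gives Z ks, or m₂ = M as well, which gives ΔZ ks at the price of t. A
    -- comma produces the first case; the two mergings together produce the second.
    ΔZ-∷ : ∀ {k} ks → 2 ≤ k → All (2 ≤_) ks → ΔZ (k ∷ ks) ≈ τ k * (Z ks + t * ΔZ ks)
    ΔZ-∷ {k} [] _ _ = begin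
      Δvalue (k ∷ [] , 0 , 0) + 0#                 ≈⟨ trans (+-identityʳ _) (Δvalue-comma k ([] , 0 , 0)) ⟩
      τ k * value ζ ([] , 0 , 0)                   ≈⟨ *-congˡ (+-identityʳ _) ⟨
      τ k * Z []                                   ≈⟨ *-congˡ (trans (+-congˡ (trans (*-congˡ ΔZ-[]) (zeroʳ t))) (+-identityʳ _)) ⟨
      τ k * (Z [] + t * ΔZ [])                     ∎
    ΔZ-∷ {suc (suc k)} (suc (suc l) ∷ ks) 2≤k@(s≤s (s≤s _)) (2≤l@(s≤s (s≤s _)) ∷ 2≤ks) = begin
      ΔZ (k₂ ∷ l₂ ∷ ks)
        ≡⟨ cong sum (≡.trans (List.map-++ Δvalue (map (fillComma k₂) A) (map fillPlus B ++ map fillMinusOnePlus C))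
             (cong (map Δvalue (map (fillComma k₂) A) ++_) (List.map-++ Δvalue (map fillPlus B) (map fillMinusOnePlus C)))) ⟩
      sum (map Δvalue (map (fillComma k₂) A) ++ (map Δvalue (map fillPlus B) ++ map Δvalue (map fillMinusOnePlus C)))
        ≈⟨ trans (sum-++ (map Δvalue (map (fillComma k₂) A)) _) (+-congˡ (sum-++ (map Δvalue (map fillPlus B)) _)) ⟩
      sum (map Δvalue (map (fillComma k₂) A)) + (sum (map Δvalue (map fillPlus B)) + sum (map Δvalue (map fillMinusOnePlus C)))
        ≈⟨ +-cong (sum-map (All.universal (Δvalue-comma k₂) A))
             (+-cong (sum-map (All.universal Δvalue-plus B)) (sum-map (All.universal Δvalue-minusOnePlus C))) ⟩
      sum (map (λ x → τ k₂ * value ζ x) A) + (sum (map (λ x → t * Δvalue x) B) + sum (map (λ x → (t * s) * Δvalue x) C))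
        ≈⟨ +-cong (sum-* (τ k₂) (value ζ) A) (+-cong (sum-* t Δvalue B) (sum-* (t * s) Δvalue C)) ⟩
      τ k₂ * Z (l₂ ∷ ks) + (t * ΔZ ((k₂ ℕ.+ l₂) ∷ ks) + (t * s) * ΔZ ((k₂ ℕ.+ l₂ ∸ 1) ∷ ks))
        -- The two merged heads share the factor `W`, which depends on `ks` alone; so `τ-merge` can
        -- combine them.
        ≈⟨ +-congˡ (+-cong (*-congˡ (ΔZ-∷ ks (s≤s (s≤s z≤n)) 2≤ks))
             (*-congˡ (ΔZ-∷ ks (ℕ.≤-trans (s≤s (s≤s z≤n)) (ℕ.m≤n+m l₂ (suc k))) 2≤ks))) ⟩
      τ k₂ * Z (l₂ ∷ ks) + (t * (τ (k₂ ℕ.+ l₂) * W) + (t * s) * (τ (k₂ ℕ.+ l₂ ∸ 1) * W))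
        ≈⟨ solve 7 (λ a z t s b c w → a :* z :+ (t :* (b :* w) :+ (t :* s) :* (c :* w)) := a :* z :+ t :* ((b :+ s :* c) :* w))
             refl (τ k₂) (Z (l₂ ∷ ks)) t s (τ (k₂ ℕ.+ l₂)) (τ (k₂ ℕ.+ l₂ ∸ 1)) W ⟩
      τ k₂ * Z (l₂ ∷ ks) + t * ((τ (k₂ ℕ.+ l₂) + s * τ (k₂ ℕ.+ l₂ ∸ 1)) * W)
        ≈⟨ +-congˡ (*-congˡ (*-congʳ (τ-merge k l))) ⟩
      τ k₂ * Z (l₂ ∷ ks) + t * ((τ k₂ * τ l₂) * W)
        ≈⟨ solve 5 (λ a z t b w → a :* z :+ t :* ((a :* b) :* w) := a :* (z :+ t :* (b :* w))) refl (τ k₂) (Z (l₂ ∷ ks)) t (τ l₂) W ⟩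
      τ k₂ * (Z (l₂ ∷ ks) + t * (τ l₂ * W))
        ≈⟨ *-congˡ (+-congˡ (*-congˡ (ΔZ-∷ ks 2≤l 2≤ks))) ⟨
      τ k₂ * (Z (l₂ ∷ ks) + t * ΔZ (l₂ ∷ ks)) ∎
      where
      k₂ l₂ : ℕ
      k₂ = suc (suc k)
      l₂ = suc (suc l)
      W : Carrier
      W = Z ks + t * ΔZ ks
      A B C : List (Filling)
      A = fillGo l₂ ks
      B = fillGo (k₂ ℕ.+ l₂) ks
      C = fillGo (k₂ ℕ.+ l₂ ∸ 1) ks

    module _ (y : Carrier) (τ-suc : ∀ k → τ (3 ℕ.+ k) ≈ y * τ (2 ℕ.+ k)) where

      ΔZ-inc : ∀ {ks} → All (2 ≤_) ks → Admissible ks → ΔZ (inc ks) ≈ y * ΔZ ks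
      ΔZ-inc {suc (suc k) ∷ ks} (2≤k ∷ 2≤ks) _ = begin
        ΔZ (3 ℕ.+ k ∷ ks)                       ≈⟨ ΔZ-∷ ks (s≤s (s≤s z≤n)) 2≤ks ⟩
        τ (3 ℕ.+ k) * (Z ks + t * ΔZ ks)        ≈⟨ *-congʳ (τ-suc k) ⟩
        y * τ (2 ℕ.+ k) * (Z ks + t * ΔZ ks)    ≈⟨ *-assoc _ _ _ ⟩
        y * (τ (2 ℕ.+ k) * (Z ks + t * ΔZ ks))  ≈⟨ *-congˡ (ΔZ-∷ ks 2≤k 2≤ks) ⟨
        y * ΔZ (2 ℕ.+ k ∷ ks)                   ∎

      ∑Z ∑ΔZ : ℕ → ℕ → Carrier
      ∑Z n l = sum (map Z (J n l))
      ∑ΔZ n l = sum (map ΔZ (J n l))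

      ∑ΔZ-recursion : ∀ n l → ∑ΔZ (suc (suc n)) (suc l) ≈ τ 2 * (∑Z n l + t * ∑ΔZ n l) + y * ∑ΔZ (suc n) (suc l)
      ∑ΔZ-recursion n l = begin
        ∑ΔZ (suc (suc n)) (suc l)
          ≡⟨ cong sum (≡.trans (cong (map ΔZ) (J-recursion n l)) (List.map-++ ΔZ (map (2 ∷_) (J n l)) _)) ⟩
        sum (map ΔZ (map (2 ∷_) (J n l)) ++ map ΔZ (map inc (J (suc n) (suc l))))
          ≈⟨ sum-++ (map ΔZ (map (2 ∷_) (J n l))) _ ⟩
        sum (map ΔZ (map (2 ∷_) (J n l))) + sum (map ΔZ (map inc (J (suc n) (suc l))))
          ≈⟨ +-cong (sum-map (All.map (λ {ks} → ΔZ-∷ ks (s≤s (s≤s z≤n))) (J-large n l)))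
                    (sum-map (All.zipWith (λ (p , q) → ΔZ-inc p q) (J-large (suc n) (suc l) , J-suc-nonempty (suc n) l))) ⟩
        sum (map (λ ks → τ 2 * (Z ks + t * ΔZ ks)) (J n l)) + sum (map (λ ks → y * ΔZ ks) (J (suc n) (suc l)))
          ≈⟨ +-cong (trans (sum-* (τ 2) _ (J n l)) (*-congˡ (trans (sum-+ Z _ (J n l)) (+-congˡ (sum-* t ΔZ (J n l))))))
                    (sum-* y ΔZ (J (suc n) (suc l))) ⟩
        τ 2 * (∑Z n l + t * ∑ΔZ n l) + y * ∑ΔZ (suc n) (suc l) ∎

module ZetaSummands (R : CommutativeRing 0ℓ 0ℓ) where

  open CommutativeRing R
  open IntegerCoefficients R using (solve; _:=_; _:+_; _:*_; _:-_; :-_; con)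
  open Exponentiation semiring using (_^_; ^-homo-*; ^-assocʳ; ^-congˡ)
  open SetoidReasoning setoid

  module _ (q Q g c y : Carrier) (g≈ : g ≈ 1# + Q * g) (c≈ : c ≈ q - 1#) (y≈ : y ≈ (- (Q * g)) * c) where

    y≈q : y ≈ (- (Q * g)) * (q - 1#)
    y≈q = trans y≈ (*-congˡ c≈)

    -- With Q = q^m and g = 1/(1 - q^m), y is q^m/[m], and g = 1 + Q g turns y - c into (1 - q) g =
    -- 1/[m].
    power-form : ∀ k → (Q ^ k * (1# - q) ^ suc k) * g ^ suc k ≈ y ^ k * (y - c)
    power-form zero = begin
      (1# * ((1# - q) * 1#)) * (g * 1#)
        ≈⟨ *-congˡ (*-congʳ g≈) ⟩
      (1# * ((1# - q) * 1#)) * ((1# + Q * g) * 1#)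
        ≈⟨ solve 3 (λ q Q g → (con (+ 1) :* ((con (+ 1) :- q) :* con (+ 1))) :* ((con (+ 1) :+ Q :* g) :* con (+ 1)) :=
             con (+ 1) :* ((:- (Q :* g)) :* (q :- con (+ 1)) :- (q :- con (+ 1)))) refl q Q g ⟩
      1# * ((- (Q * g)) * (q - 1#) - (q - 1#))
        ≈⟨ *-congˡ (+-cong y≈q (-‿cong c≈)) ⟨
      1# * (y - c) ∎
    power-form (suc k) = begin
      (Q ^ suc k * (1# - q) ^ suc (suc k)) * g ^ suc (suc k)
        ≈⟨ solve 6 (λ q Q g a b c → ((Q :* a) :* ((con (+ 1) :- q) :* b)) :* (g :* c) := ((:- (Q :* g)) :* (q :- con (+ 1))) :* ((a :* b) :* c)) refl
             q Q g (Q ^ k) ((1# - q) ^ suc k) (g ^ suc k) ⟩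
      ((- (Q * g)) * (q - 1#)) * ((Q ^ k * (1# - q) ^ suc k) * g ^ suc k)
        ≈⟨ *-cong (sym y≈q) (power-form k) ⟩
      y * (y ^ k * (y - c))
        ≈⟨ solve 3 (λ y a b → y :* (a :* b) := (y :* a) :* b) refl y (y ^ k) (y - c) ⟩
      y ^ suc k * (y - c) ∎

    summand : ∀ k m {A B C} → Q ≈ q ^ m → A ≈ q ^ (k ℕ.* m) → B ≈ (1# - q) ^ suc k → C ≈ g ^ suc k → (A * B) * C ≈ y ^ k * (y - c)
    summand k m Q≈ A≈ B≈ C≈ = trans (*-cong (*-cong A≈Q^k B≈) C≈) (power-form k)
      where
      A≈Q^k : _ ≈ Q ^ k
      A≈Q^k = trans A≈ (trans (reflexive (cong (q ^_) (ℕ.*-comm k m))) (trans (sym (^-assocʳ q m k)) (sym (^-congˡ k Q≈))))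

  zero-summand : ∀ c p → 0# ≈ ((0# * c) * p) * ((0# * c) - c)
  zero-summand c p = sym (trans (*-congʳ (trans (*-congʳ (zeroˡ c)) (zeroˡ p))) (zeroˡ _))

  module _ (q y : Carrier) (τ : ℕ → Carrier) (τ≈ : ∀ k → τ (2 ℕ.+ k) ≈ y ^ suc k * (y - (q - 1#))) where

    τ-suc : ∀ k → τ (3 ℕ.+ k) ≈ y * τ (2 ℕ.+ k)
    τ-suc k = trans (τ≈ (suc k)) (trans (solve 3 (λ y a b → (y :* a) :* b := y :* (a :* b)) refl y (y ^ suc k) _) (*-congˡ (sym (τ≈ k))))

    -- Both sides are y^(k+l+2) (y - c)², because 1 - q = - c.
    τ-merge : ∀ k l → τ (2 ℕ.+ k ℕ.+ (2 ℕ.+ l)) + (1# - q) * τ (2 ℕ.+ k ℕ.+ (2 ℕ.+ l) ∸ 1) ≈ τ (2 ℕ.+ k) * τ (2 ℕ.+ l)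
    τ-merge k l = begin
      τ (2 ℕ.+ k ℕ.+ (2 ℕ.+ l)) + (1# - q) * τ (2 ℕ.+ k ℕ.+ (2 ℕ.+ l) ∸ 1)
        ≈⟨ +-cong (τ≈ (k ℕ.+ (2 ℕ.+ l))) (*-congˡ (trans (reflexive (cong (τ ∘ suc) (ℕ.+-suc k (suc l)))) (τ≈ (k ℕ.+ suc l)))) ⟩
      (y * y ^ (k ℕ.+ (2 ℕ.+ l))) * (y - (q - 1#)) + (1# - q) * ((y * y ^ (k ℕ.+ suc l)) * (y - (q - 1#)))
        ≈⟨ +-cong (*-congʳ (*-congˡ (^-homo-* y k (2 ℕ.+ l)))) (*-congˡ (*-congʳ (*-congˡ (^-homo-* y k (suc l))))) ⟩
      (y * (y ^ k * (y * (y * y ^ l)))) * (y - (q - 1#)) + (1# - q) * ((y * (y ^ k * (y * y ^ l))) * (y - (q - 1#)))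
        ≈⟨ solve 4 (λ q y a b → (y :* (a :* (y :* (y :* b)))) :* (y :- (q :- con (+ 1))) :+ (con (+ 1) :- q) :* ((y :* (a :* (y :* b))) :* (y :- (q :- con (+ 1))))
             := ((y :* a) :* (y :- (q :- con (+ 1)))) :* ((y :* b) :* (y :- (q :- con (+ 1))))) refl q y (y ^ k) (y ^ l) ⟩
      (y ^ suc k * (y - (q - 1#))) * (y ^ suc l * (y - (q - 1#)))
        ≈⟨ *-cong (τ≈ k) (τ≈ l) ⟨
      τ (2 ℕ.+ k) * τ (2 ℕ.+ l) ∎

  module Factors (q t u₁ u₃ c w₁ w₂ z₁ z₂ : Carrier) (c≈ : c ≈ q - 1#)
    (w₁≈ : w₁ ≈ u₁ + t * (1# - q) * u₃) (w₂≈ : w₂ ≈ - (t * u₃))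
    (z₁≈ : z₁ ≈ u₁ - (1# - t) * (1# - q) * u₃) (z₂≈ : z₂ ≈ (1# - t) * u₃) where

    α-w α-z : Carrier → Carrier
    α-w y = (1# - w₁ * y) + w₂ * (y * y)
    α-z y = (1# - z₁ * y) + z₂ * (y * y)

    α-w≈ : ∀ y → α-w y ≈ (1# - (u₁ + t * (1# - q) * u₃) * y) + (- (t * u₃)) * (y * y)
    α-w≈ y = +-cong (+-congˡ (-‿cong (*-congʳ w₁≈))) (*-congʳ w₂≈)

    α-z≈ : ∀ y → α-z y ≈ (1# - (u₁ - (1# - t) * (1# - q) * u₃) * y) + ((1# - t) * u₃) * (y * y)
    α-z≈ y = +-cong (+-congˡ (-‿cong (*-congʳ z₁≈))) (*-congʳ z₂≈)

    -- Both quadratics specialise to 1 - (q - 1) u₁ at q - 1.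
    α-q-1 : α-w c ≈ α-z c
    α-q-1 = trans (α-w≈ c) (trans
      (+-cong (+-congˡ (-‿cong (*-congˡ c≈))) (*-congˡ (*-cong c≈ c≈)))
      (trans (solve 4 (λ q t u₁ u₃ → let 1:- = λ x → con (+ 1) :- x ; c = q :- con (+ 1) in
        (con (+ 1) :- (u₁ :+ t :* 1:- q :* u₃) :* c) :+ (:- (t :* u₃)) :* (c :* c) :=
        (con (+ 1) :- (u₁ :- 1:- t :* 1:- q :* u₃) :* c) :+ (1:- t :* u₃) :* (c :* c)) refl q t u₁ u₃)
      (sym (trans (α-z≈ c) (+-cong (+-congˡ (-‿cong (*-congˡ c≈))) (*-congˡ (*-cong c≈ c≈)))))))

    -- For G′ = G + Δ the difference of the two sides is identically the residual of the linear
    -- equation for Δ. Thus α-w is the coefficient 1 - t u₃ τ₂ - u₁ y of Δ, and α-z is α-w + u₃ τ₂.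
    product-step : ∀ y τ₂ G G′ Δ → τ₂ ≈ y * (y - c) → G′ ≈ G + Δ →
                   Δ ≈ u₃ * (τ₂ * (G + t * Δ)) + u₁ * (y * Δ) → G′ * α-w y ≈ G * α-z y
    product-step y τ₂ G G′ Δ τ₂≈ G′≈ Δ≈ = begin
      G′ * α-w y
        ≈⟨ *-cong G′≈ (α-w≈ y) ⟩
      (G + Δ) * ((1# - (u₁ + t * (1# - q) * u₃) * y) + (- (t * u₃)) * (y * y))
        ≈⟨ solve 7 (λ q t u₁ u₃ y G Δ → let 1:- = λ x → con (+ 1) :- x ; τ = y :* (y :- (q :- con (+ 1))) in
             (G :+ Δ) :* ((con (+ 1) :- (u₁ :+ t :* 1:- q :* u₃) :* y) :+ (:- (t :* u₃)) :* (y :* y)) :=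
             G :* ((con (+ 1) :- (u₁ :- 1:- t :* 1:- q :* u₃) :* y) :+ (1:- t :* u₃) :* (y :* y))
             :+ (Δ :- (u₃ :* (τ :* (G :+ t :* Δ)) :+ u₁ :* (y :* Δ)))) refl q t u₁ u₃ y G Δ ⟩
      G * ((1# - (u₁ - (1# - t) * (1# - q) * u₃) * y) + ((1# - t) * u₃) * (y * y))
      + (Δ - (u₃ * ((y * (y - (q - 1#))) * (G + t * Δ)) + u₁ * (y * Δ)))
        ≈⟨ +-cong (*-congˡ (sym (α-z≈ y)))
             (+-congˡ (-‿cong (trans (+-congʳ (*-congˡ (*-congʳ (sym (trans τ₂≈ (*-congˡ (+-congˡ (-‿cong c≈)))))))) (sym Δ≈)))) ⟩
      G * α-z y + (Δ - Δ)
        ≈⟨ solve 2 (λ r d → r :+ (d :- d) := r) refl (G * α-z y) Δ ⟩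
      G * α-z y ∎

-- Series in q, t, u₁, u₃

open import Data.Rational using (ℚ; 0ℚ; 1ℚ; _+_; _*_; -_; _/_; toℚᵘ)

open AntidiagonalSums ℚ.+-*-commutativeRing public

Σ<-suc : ∀ n f → Σ< (suc n) f ≡ f 0 + Σ< n (f ∘ suc)
Σ<-suc zero f = ℚ.+-comm 0ℚ (f 0)
Σ<-suc (suc n) f = ≡.trans (cong (_+ f (suc n)) (Σ<-suc n f)) (ℚ.+-assoc (f 0) (Σ< n (f ∘ suc)) (f (suc n)))

Σ<-antidiagonal : ∀ n Φ → Σ< (suc n) (λ k → Φ k (n ∸ k)) ≡ AD n Φ
Σ<-antidiagonal zero Φ = ℚ.+-identityˡ (Φ 0 0)
Σ<-antidiagonal (suc n) Φ =
  ≡.trans (Σ<-suc (suc n) (λ k → Φ k (suc n ∸ k))) (cong (_+_ (Φ 0 (suc n))) (Σ<-antidiagonal n (Φ ∘ suc)))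

module _ (i j a b : ℕ) where

  ⊗-AD⁴ : ∀ f g → (f ⊗ g) i j a b ≡ AD⁴ i j a b (λ i₁ i₂ j₁ j₂ a₁ a₂ b₁ b₂ → f i₁ j₁ a₁ b₁ * g i₂ j₂ a₂ b₂)
  ⊗-AD⁴ f g =
    ≡.trans (Σ<-antidiagonal i λ i₁ i₂ → Σ< (suc j) λ j₁ → Σ< (suc a) λ a₁ → Σ< (suc b) λ b₁ → f i₁ j₁ a₁ b₁ * g i₂ (j ∸ j₁) (a ∸ a₁) (b ∸ b₁))
    (AD-cong i λ i₁ i₂ _ →
    ≡.trans (Σ<-antidiagonal j λ j₁ j₂ → Σ< (suc a) λ a₁ → Σ< (suc b) λ b₁ → f i₁ j₁ a₁ b₁ * g i₂ j₂ (a ∸ a₁) (b ∸ b₁))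
    (AD-cong j λ j₁ j₂ _ →
    ≡.trans (Σ<-antidiagonal a λ a₁ a₂ → Σ< (suc b) λ b₁ → f i₁ j₁ a₁ b₁ * g i₂ j₂ a₂ (b ∸ b₁))
    (AD-cong a λ a₁ a₂ _ → Σ<-antidiagonal b λ b₁ b₂ → f i₁ j₁ a₁ b₁ * g i₂ j₂ a₂ b₂)))

antidiagonalSum-apply : ∀ {A : Set} (_∙_ : A → A → A) n Φ (x : ℕ) →
                        antidiagonalSum {ℕ → A} (λ f g y → f y ∙ g y) n Φ x ≡ antidiagonalSum _∙_ n (λ k l → Φ k l x)
antidiagonalSum-apply _∙_ zero Φ x = ≡.refl
antidiagonalSum-apply _∙_ (suc n) Φ x = cong (Φ 0 (suc n) x ∙_) (antidiagonalSum-apply _∙_ n (Φ ∘ suc) x)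

-- One variable per layer, q outermost and u₃ innermost, in the order of the arguments of a
-- `Series`. The laws of ⊗ are inherited from here along `⊗≐*`.
ringB ringAB ringTAB ringQTAB : CommutativeRing 0ℓ 0ℓ
ringB = PowerSeries.commutativeRing ℚ.+-*-commutativeRing
ringAB = PowerSeries.commutativeRing ringB
ringTAB = PowerSeries.commutativeRing ringAB
ringQTAB = PowerSeries.commutativeRing ringTAB

private
  module B = CommutativeRing ringB
  module AB = CommutativeRing ringAB
  module TAB = CommutativeRing ringTAB
  module QTAB = CommutativeRing ringQTAB

infix 4 _≐_
_≐_ : Series → Series → Set
f ≐ g = ∀ i j a b → f i j a b ≡ g i j a b

≐-sym : ∀ {f g} → f ≐ g → g ≐ f
≐-sym f≐g i j a b = ≡.sym (f≐g i j a b)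

≐-trans : ∀ {f g h} → f ≐ g → g ≐ h → f ≐ h
≐-trans f≐g g≐h i j a b = ≡.trans (f≐g i j a b) (g≐h i j a b)

⊗≐* : ∀ f g → (f ⊗ g) ≐ (f QTAB.* g)
⊗≐* f g i j a b = ≡.trans (⊗-AD⁴ i j a b f g) (≡.sym
  (≡.trans (cong (λ h → h a b) (antidiagonalSum-apply _ i (λ i₁ i₂ → f i₁ TAB.* g i₂) j))
  (≡.trans (cong (λ h → h b) (antidiagonalSum-apply _ i (λ i₁ i₂ → (f i₁ TAB.* g i₂) j) a))
  (≡.trans (antidiagonalSum-apply _ i (λ i₁ i₂ → (f i₁ TAB.* g i₂) j a) b)
  (AD-cong i λ i₁ i₂ _ →
   ≡.trans (cong (λ h → h b) (antidiagonalSum-apply _ j (λ j₁ j₂ → f i₁ j₁ AB.* g i₂ j₂) a))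
  (≡.trans (antidiagonalSum-apply _ j (λ j₁ j₂ → (f i₁ j₁ AB.* g i₂ j₂) a) b)
  (AD-cong j λ j₁ j₂ _ → antidiagonalSum-apply _ a (λ a₁ a₂ → f i₁ j₁ a₁ B.* g i₂ j₂ a₂) b)))))))

oneS≐1 : oneS ≐ QTAB.1#
oneS≐1 (suc i) j a b = ≡.trans (ℚ.*-identityˡ _) (ℚ.*-zeroˡ (δ j 0 * (δ a 0 * δ b 0)))
oneS≐1 zero (suc j) a b = ≡.trans (ℚ.*-identityˡ _) (≡.trans (ℚ.*-identityˡ _) (ℚ.*-zeroˡ (δ a 0 * δ b 0)))
oneS≐1 zero zero (suc a) b = ≡.trans (ℚ.*-identityˡ _) (≡.trans (ℚ.*-identityˡ _) (≡.trans (ℚ.*-identityˡ _) (ℚ.*-zeroˡ (δ b 0))))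
oneS≐1 zero zero zero (suc b) = ≡.refl
oneS≐1 zero zero zero zero = ≡.refl

⊗-cong : ∀ {f g h k} → f ≐ g → h ≐ k → f ⊗ h ≐ g ⊗ k
⊗-cong {f} {g} {h} {k} f≐g h≐k = ≐-trans (⊗≐* f h) (≐-trans (QTAB.*-cong f≐g h≐k) (≐-sym (⊗≐* g k)))

⊗-comm : ∀ f g → f ⊗ g ≐ g ⊗ f
⊗-comm f g = ≐-trans (⊗≐* f g) (≐-trans (QTAB.*-comm f g) (≐-sym (⊗≐* g f)))

⊗-assoc : ∀ f g h → (f ⊗ g) ⊗ h ≐ f ⊗ (g ⊗ h)
⊗-assoc f g h =
  ≐-trans (⊗≐* (f ⊗ g) h) (≐-trans (QTAB.*-cong {x = f ⊗ g} {u = h} (⊗≐* f g) QTAB.refl)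
  (≐-trans (QTAB.*-assoc f g h)
  (≐-sym (≐-trans (⊗≐* f (g ⊗ h)) (QTAB.*-cong {x = f} {u = g ⊗ h} QTAB.refl (⊗≐* g h))))))

⊗-identityˡ : ∀ f → oneS ⊗ f ≐ f
⊗-identityˡ f = ≐-trans (⊗≐* oneS f) (≐-trans (QTAB.*-cong {x = oneS} {u = f} oneS≐1 QTAB.refl) (QTAB.*-identityˡ f))

⊗-distribˡ : ∀ f g h → f ⊗ (g ⊕ h) ≐ (f ⊗ g) ⊕ (f ⊗ h)
⊗-distribˡ f g h =
  ≐-trans (⊗≐* f (g ⊕ h)) (≐-trans (QTAB.distribˡ f g h) (≐-sym (QTAB.+-cong (⊗≐* f g) (⊗≐* f h))))

pointwiseSeriesRing : CommutativeRing 0ℓ 0ℓ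
pointwiseSeriesRing = record
  { Carrier = Series
  ; _≈_ = _≐_
  ; _+_ = _⊕_
  ; _*_ = _⊗_
  ; -_ = ⊝_
  ; 0# = zeroS
  ; 1# = oneS
  ; isCommutativeRing = record
    { isRing = record
      { +-isAbelianGroup = QTAB.+-isAbelianGroup
      ; *-cong = ⊗-cong
      ; *-assoc = ⊗-assoc
      ; *-identity = ⊗-identityˡ , λ f → ≐-trans (⊗-comm f oneS) (⊗-identityˡ f)
      ; distrib = ⊗-distribˡ
                , λ h f g → ≐-trans (⊗-comm (f ⊕ g) h) (≐-trans (⊗-distribˡ h f g) (QTAB.+-cong (⊗-comm h f) (⊗-comm h g)))
      }
    ; *-comm = ⊗-comm
    }
  }

-- A record, so that Agda compares the two series as they stand and does not unfold their coefficients.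
infix 4 _≋_
record _≋_ (f g : Series) : Set where
  constructor coefficientwise
  field at : f ≐ g
open _≋_ public

seriesRing : CommutativeRing 0ℓ 0ℓ
seriesRing = Coarsening.commutativeRing~ pointwiseSeriesRing _≋_
  (record
    { refl = coefficientwise λ _ _ _ _ → ≡.refl
    ; sym = λ f≋g → coefficientwise (≐-sym (at f≋g))
    ; trans = λ f≋g g≋h → coefficientwise (≐-trans (at f≋g) (at g≋h))
    })
  coefficientwise
  (λ f≋g h≋k → coefficientwise λ i j a b → cong₂ _+_ (at f≋g i j a b) (at h≋k i j a b))
  (λ f≋g h≋k → coefficientwise (⊗-cong (at f≋g) (at h≋k)))
  (λ f≋g → coefficientwise λ i j a b → cong -_ (at f≋g i j a b))

fromℕ : ℕ → ℚ
fromℕ zero = 0ℚ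
fromℕ (suc n) = 1ℚ + fromℕ n

fromℕ-+ : ∀ m n → fromℕ (m ℕ.+ n) ≡ fromℕ m + fromℕ n
fromℕ-+ zero n = ≡.sym (ℚ.+-identityˡ (fromℕ n))
fromℕ-+ (suc m) n = ≡.trans (cong (_+_ 1ℚ) (fromℕ-+ m n)) (≡.sym (ℚ.+-assoc 1ℚ (fromℕ m) (fromℕ n)))

toℚᵘ-fromℕ : ∀ n → toℚᵘ (fromℕ n) ℚᵘ.≃ mkℚᵘ (+ n) 0
toℚᵘ-fromℕ zero = *≡* ≡.refl
toℚᵘ-fromℕ (suc n) = ℚᵘ.≃-trans (ℚ.toℚᵘ-homo-+ 1ℚ (fromℕ n))
  (ℚᵘ.≃-trans (ℚᵘ.+-congʳ (toℚᵘ 1ℚ) (toℚᵘ-fromℕ n))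
  (*≡* (cong (λ k → (+ 1 ℤ.+ k) ℤ.* + 1) (ℤ.*-identityʳ (+ n)))))

inv-fromℕ : ∀ n → inv (suc n) * fromℕ (suc n) ≡ 1ℚ
inv-fromℕ n = ℚ.toℚᵘ-injective
  (ℚᵘ.≃-trans (ℚ.toℚᵘ-homo-* (inv (suc n)) (fromℕ (suc n)))
  (ℚᵘ.≃-trans (ℚᵘ.*-cong (ℚ.toℚᵘ-fromℚᵘ (mkℚᵘ (+ 1) n)) (toℚᵘ-fromℕ (suc n)))
  (*≡* (≡.trans (ℤ.*-identityʳ _) (≡.trans (ℤ.*-identityˡ (+ suc n)) (≡.sym (≡.trans (ℤ.*-identityˡ _) (cong +_ (ℕ.*-identityʳ (suc n))))))))))

fromℕ-cancel : ∀ n {x} → fromℕ (suc n) * x ≡ 0ℚ → x ≡ 0ℚ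
fromℕ-cancel n {x} nx≡0 = begin
  x                                     ≡⟨ ℚ.*-identityˡ x ⟨
  1ℚ * x                                ≡⟨ cong (_* x) (inv-fromℕ n) ⟨
  inv (suc n) * fromℕ (suc n) * x       ≡⟨ ℚ.*-assoc (inv (suc n)) (fromℕ (suc n)) x ⟩
  inv (suc n) * (fromℕ (suc n) * x)     ≡⟨ cong (inv (suc n) *_) nx≡0 ⟩
  inv (suc n) * 0ℚ                      ≡⟨ ℚ.*-zeroʳ (inv (suc n)) ⟩
  0ℚ                                    ∎
  where open ≡-Reasoning

-- The Euler derivation u₁ ∂/∂u₁ + u₃ ∂/∂u₃.
euler : Series → Series
euler f i j a b = fromℕ (a ℕ.+ b) * f i j a b

euler-⊗ : ∀ f g → euler (f ⊗ g) ≐ euler f ⊗ g ⊕ f ⊗ euler g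
euler-⊗ f g i j a b = begin
  fromℕ (a ℕ.+ b) * (f ⊗ g) i j a b
    ≡⟨ cong (fromℕ (a ℕ.+ b) *_) (⊗-AD⁴ i j a b f g) ⟩
  fromℕ (a ℕ.+ b) * AD⁴ i j a b Φ
    ≡⟨ AD⁴-* i j a b (fromℕ (a ℕ.+ b)) Φ ⟨
  AD⁴ i j a b (λ i₁ i₂ j₁ j₂ a₁ a₂ b₁ b₂ → fromℕ (a ℕ.+ b) * (f i₁ j₁ a₁ b₁ * g i₂ j₂ a₂ b₂))
    ≡⟨ AD⁴-cong i j a b (λ i₁ i₂ j₁ j₂ a₁ a₂ b₁ b₂ p q r s → ≡.trans (cong (_* (f i₁ j₁ a₁ b₁ * g i₂ j₂ a₂ b₂)) (degree a₁ a₂ b₁ b₂ r s))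
         (leibniz (fromℕ (a₁ ℕ.+ b₁)) (fromℕ (a₂ ℕ.+ b₂)) (f i₁ j₁ a₁ b₁) (g i₂ j₂ a₂ b₂))) ⟩
  AD⁴ i j a b (λ i₁ i₂ j₁ j₂ a₁ a₂ b₁ b₂ → euler f i₁ j₁ a₁ b₁ * g i₂ j₂ a₂ b₂ + f i₁ j₁ a₁ b₁ * euler g i₂ j₂ a₂ b₂)
    ≡⟨ AD⁴-+ i j a b _ _ ⟩
  AD⁴ i j a b (λ i₁ i₂ j₁ j₂ a₁ a₂ b₁ b₂ → euler f i₁ j₁ a₁ b₁ * g i₂ j₂ a₂ b₂)
  + AD⁴ i j a b (λ i₁ i₂ j₁ j₂ a₁ a₂ b₁ b₂ → f i₁ j₁ a₁ b₁ * euler g i₂ j₂ a₂ b₂)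
    ≡⟨ cong₂ _+_ (⊗-AD⁴ i j a b (euler f) g) (⊗-AD⁴ i j a b f (euler g)) ⟨
  (euler f ⊗ g ⊕ f ⊗ euler g) i j a b ∎
  where
  open ≡-Reasoning
  open IntegerCoefficients ℚ.+-*-commutativeRing
  Φ : Kernel
  Φ i₁ i₂ j₁ j₂ a₁ a₂ b₁ b₂ = f i₁ j₁ a₁ b₁ * g i₂ j₂ a₂ b₂
  degree : ∀ a₁ a₂ b₁ b₂ → a₁ ℕ.+ a₂ ≡ a → b₁ ℕ.+ b₂ ≡ b → fromℕ (a ℕ.+ b) ≡ fromℕ (a₁ ℕ.+ b₁) + fromℕ (a₂ ℕ.+ b₂)
  degree a₁ a₂ b₁ b₂ ≡.refl ≡.refl = ≡.trans (cong fromℕ (interchange a₁ a₂ b₁ b₂)) (fromℕ-+ (a₁ ℕ.+ b₁) (a₂ ℕ.+ b₂))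
    where
    open CommutativeSemigroupProperties ℕ.+-commutativeSemigroup using (interchange)
  leibniz : ∀ m n x y → (m + n) * (x * y) ≡ (m * x) * y + x * (n * y)
  leibniz = solve 4 (λ m n x y → (m :+ n) :* (x :* y) := (m :* x) :* y :+ x :* (n :* y)) ≡.refl

euler-one : euler oneS ≐ zeroS
euler-one i j zero zero = ℚ.*-zeroˡ (oneS i j 0 0)
euler-one i j (suc a) b = ≡.trans (cong (fromℕ (suc a ℕ.+ b) *_) (oneS-u₁ i j a b)) (ℚ.*-zeroʳ (fromℕ (suc a ℕ.+ b)))
  where
  oneS-u₁ : ∀ i j a b → oneS i j (suc a) b ≡ 0ℚ
  oneS-u₁ zero zero a b = oneS≐1 0 0 (suc a) b
  oneS-u₁ zero (suc j) a b = oneS≐1 0 (suc j) (suc a) b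
  oneS-u₁ (suc i) j a b = oneS≐1 (suc i) j (suc a) b
euler-one i j zero (suc b) = ≡.trans (cong (fromℕ (suc b) *_) (oneS-u₃ i j b)) (ℚ.*-zeroʳ (fromℕ (suc b)))
  where
  oneS-u₃ : ∀ i j b → oneS i j 0 (suc b) ≡ 0ℚ
  oneS-u₃ zero zero b = oneS≐1 0 0 0 (suc b)
  oneS-u₃ zero (suc j) b = oneS≐1 0 (suc j) 0 (suc b)
  oneS-u₃ (suc i) j b = oneS≐1 (suc i) j 0 (suc b)

≤-summandˡ : ∀ m {n s t} → m ℕ.+ n ≡ s → s ≤ t → m ≤ t
≤-summandˡ m {n} ≡.refl = ℕ.≤-trans (ℕ.m≤m+n m n)

≤-summandʳ : ∀ m {n s t} → m ℕ.+ n ≡ s → s ≤ t → n ≤ t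
≤-summandʳ m {n} ≡.refl = ℕ.≤-trans (ℕ.m≤n+m n m)

<-split : ∀ x y {m n} → x ℕ.+ y < m ℕ.+ n → (x < m) ⊎ (y < n)
<-split x y {m} {n} x+y<m+n with ℕ.<-≤-connex x m
... | inj₁ x<m = inj₁ x<m
... | inj₂ m≤x = inj₂ (ℕ.+-cancelˡ-< m y n (ℕ.≤-<-trans (ℕ.+-monoˡ-≤ y m≤x) x+y<m+n))

interchange-≡ : ∀ a₁ {a₂} b₁ {b₂ a b} → a₁ ℕ.+ a₂ ≡ a → b₁ ℕ.+ b₂ ≡ b → (a₁ ℕ.+ b₁) ℕ.+ (a₂ ℕ.+ b₂) ≡ a ℕ.+ b
interchange-≡ a₁ {a₂} b₁ {b₂} ≡.refl ≡.refl = interchange a₁ b₁ a₂ b₂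
  where open CommutativeSemigroupProperties ℕ.+-commutativeSemigroup using (interchange)

-- Series modulo q^(I+1) and modulo terms of total degree > d in u₁, u₃.
module Truncation (I d : ℕ) where

  infix 4 _~_
  record _~_ (f g : Series) : Set where
    constructor truncated
    field at~ : ∀ i j a b → i ≤ I → a ℕ.+ b ≤ d → f i j a b ≡ g i j a b
  open _~_ public

  ⊗-cong-~ : ∀ {f g h k} → f ~ g → h ~ k → f ⊗ h ~ g ⊗ k
  at~ (⊗-cong-~ {f} {g} {h} {k} f~g h~k) i j a b i≤I a+b≤d = begin
    (f ⊗ h) i j a b
      ≡⟨ ⊗-AD⁴ i j a b f h ⟩
    AD⁴ i j a b (λ i₁ i₂ j₁ j₂ a₁ a₂ b₁ b₂ → f i₁ j₁ a₁ b₁ * h i₂ j₂ a₂ b₂)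
      ≡⟨ AD⁴-cong i j a b (λ i₁ i₂ j₁ j₂ a₁ a₂ b₁ b₂ p q r s → cong₂ _*_
           (at~ f~g i₁ j₁ a₁ b₁ (≤-summandˡ i₁ p i≤I) (≤-summandˡ (a₁ ℕ.+ b₁) (interchange-≡ a₁ b₁ r s) a+b≤d))
           (at~ h~k i₂ j₂ a₂ b₂ (≤-summandʳ i₁ p i≤I) (≤-summandʳ (a₁ ℕ.+ b₁) (interchange-≡ a₁ b₁ r s) a+b≤d))) ⟩
    AD⁴ i j a b (λ i₁ i₂ j₁ j₂ a₁ a₂ b₁ b₂ → g i₁ j₁ a₁ b₁ * k i₂ j₂ a₂ b₂)
      ≡⟨ ⊗-AD⁴ i j a b g k ⟨
    (g ⊗ k) i j a b ∎
    where open ≡-Reasoning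

  ≋⇒~ : ∀ {f g} → f ≋ g → f ~ g
  ≋⇒~ f≋g = truncated λ i j a b _ _ → at f≋g i j a b

  truncatedRing : CommutativeRing 0ℓ 0ℓ
  truncatedRing = Coarsening.commutativeRing~ seriesRing _~_
    (record
      { refl = truncated λ _ _ _ _ _ _ → ≡.refl
      ; sym = λ f~g → truncated λ i j a b p q → ≡.sym (at~ f~g i j a b p q)
      ; trans = λ f~g g~h → truncated λ i j a b p q → ≡.trans (at~ f~g i j a b p q) (at~ g~h i j a b p q)
      })
    ≋⇒~
    (λ f~g h~k → truncated λ i j a b p q → cong₂ _+_ (at~ f~g i j a b p q) (at~ h~k i j a b p q))
    ⊗-cong-~
    (λ f~g → truncated λ i j a b p q → cong -_ (at~ f~g i j a b p q))

  -- Only u₁ and u₃ are graded; q and t have degree 0. Coefficients are tested within the truncation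
  -- only, so order d + 1 means zero.
  record VanishesBelow (n : ℕ) (f : Series) : Set where
    constructor vanishing
    field vanishes : ∀ i j a b → i ≤ I → a ℕ.+ b ≤ d → a ℕ.+ b < n → f i j a b ≡ 0ℚ
  open VanishesBelow public

  VanishesBelow-⊗ : ∀ {m n f g} → VanishesBelow m f → VanishesBelow n g → VanishesBelow (m ℕ.+ n) (f ⊗ g)
  vanishes (VanishesBelow-⊗ {m} {n} {f} {g} f∈F g∈F) i j a b i≤I a+b≤d a+b<m+n =
    ≡.trans (⊗-AD⁴ i j a b f g) (≡.trans (AD⁴-cong i j a b vanish) (AD⁴-0 i j a b))
    where
    vanish : ∀ i₁ i₂ j₁ j₂ a₁ a₂ b₁ b₂ → i₁ ℕ.+ i₂ ≡ i → j₁ ℕ.+ j₂ ≡ j → a₁ ℕ.+ a₂ ≡ a → b₁ ℕ.+ b₂ ≡ b →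
             f i₁ j₁ a₁ b₁ * g i₂ j₂ a₂ b₂ ≡ 0ℚ
    vanish i₁ i₂ j₁ j₂ a₁ a₂ b₁ b₂ p _ r s
      with <-split (a₁ ℕ.+ b₁) (a₂ ℕ.+ b₂) {m} {n} (≡.subst (_< m ℕ.+ n) (≡.sym (interchange-≡ a₁ b₁ r s)) a+b<m+n)
    ... | inj₁ <m = ≡.trans (cong (_* g i₂ j₂ a₂ b₂)
      (vanishes f∈F i₁ j₁ a₁ b₁ (≤-summandˡ i₁ p i≤I) (≤-summandˡ (a₁ ℕ.+ b₁) (interchange-≡ a₁ b₁ r s) a+b≤d) <m)) (ℚ.*-zeroˡ (g i₂ j₂ a₂ b₂))
    ... | inj₂ <n = ≡.trans (cong (f i₁ j₁ a₁ b₁ *_)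
      (vanishes g∈F i₂ j₂ a₂ b₂ (≤-summandʳ i₁ p i≤I) (≤-summandʳ (a₁ ℕ.+ b₁) (interchange-≡ a₁ b₁ r s) a+b≤d) <n)) (ℚ.*-zeroʳ (f i₁ j₁ a₁ b₁))

  VanishesBelow-euler⁻¹ : ∀ {n f} → VanishesBelow 1 f → VanishesBelow n (euler f) → VanishesBelow n f
  vanishes (VanishesBelow-euler⁻¹ f∈F₁ Df∈F) i j zero zero p q r = vanishes f∈F₁ i j 0 0 p q (s≤s z≤n)
  vanishes (VanishesBelow-euler⁻¹ f∈F₁ Df∈F) i j zero (suc b) p q r = fromℕ-cancel b (vanishes Df∈F i j 0 (suc b) p q r)
  vanishes (VanishesBelow-euler⁻¹ f∈F₁ Df∈F) i j (suc a) b p q r = fromℕ-cancel (a ℕ.+ b) (vanishes Df∈F i j (suc a) b p q r)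

  truncatedDifferentialRing : FilteredDifferentialRing
  truncatedDifferentialRing = record
    { base = truncatedRing
    ; D = euler
    ; D-cong = λ f~g → truncated λ i j a b p q → cong (fromℕ (a ℕ.+ b) *_) (at~ f~g i j a b p q)
    ; D-+ = λ f g → truncated λ i j a b _ _ → ℚ.*-distribˡ-+ (fromℕ (a ℕ.+ b)) (f i j a b) (g i j a b)
    ; D-neg = λ f → truncated λ i j a b _ _ → ≡.sym (ℚ.neg-distribʳ-* (fromℕ (a ℕ.+ b)) (f i j a b))
    ; D-* = λ f g → truncated λ i j a b _ _ → euler-⊗ f g i j a b
    ; D-0 = truncated λ i j a b _ _ → ℚ.*-zeroʳ (fromℕ (a ℕ.+ b))
    ; D-1 = truncated λ i j a b _ _ → euler-one i j a b
    ; F = VanishesBelow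
    ; F-resp-≈ = λ f~g f∈F → vanishing λ i j a b p q r → ≡.trans (≡.sym (at~ f~g i j a b p q)) (vanishes f∈F i j a b p q r)
    ; F-0 = vanishing λ _ _ _ _ _ _ _ → ≡.refl
    ; F-+ = λ f∈F g∈F → vanishing λ i j a b p q r → cong₂ _+_ (vanishes f∈F i j a b p q r) (vanishes g∈F i j a b p q r)
    ; F-neg = λ f∈F → vanishing λ i j a b p q r → cong -_ (vanishes f∈F i j a b p q r)
    ; F-* = VanishesBelow-⊗
    ; F-all = vanishing λ _ _ _ _ _ _ ()
    ; F-antitone = λ m≤n f∈F → vanishing λ i j a b p q r → vanishes f∈F i j a b p q (ℕ.≤-trans r m≤n)
    ; F-D = λ f∈F → vanishing λ i j a b p q r → ≡.trans (cong (fromℕ (a ℕ.+ b) *_) (vanishes f∈F i j a b p q r)) (ℚ.*-zeroʳ (fromℕ (a ℕ.+ b)))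
    ; F-D⁻¹ = VanishesBelow-euler⁻¹
    ; top = d
    ; F-vanish = λ f∈F → truncated λ i j a b p q → vanishes f∈F i j a b p q (s≤s q)
    }

-- Multiplication by q, u₁, u₃, series free of u₁ and u₃, and q-adic order

private
  module Sℚ = PowerSeries ℚ.+-*-commutativeRing
  module SB = PowerSeries ringB
  module SAB = PowerSeries ringAB
  module STAB = PowerSeries ringTAB

δ-B : ∀ b → δ b 0 ≡ Sℚ.1ₛ b
δ-B zero = ≡.refl
δ-B (suc b) = ≡.refl

δ-AB : ∀ a b → δ a 0 * δ b 0 ≡ SB.1ₛ a b
δ-AB zero b = ≡.trans (ℚ.*-identityˡ (δ b 0)) (δ-B b)
δ-AB (suc a) b = ℚ.*-zeroˡ (δ b 0)

δ-TAB : ∀ j a b → δ j 0 * (δ a 0 * δ b 0) ≡ SAB.1ₛ j a b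
δ-TAB zero a b = ≡.trans (ℚ.*-identityˡ (δ a 0 * δ b 0)) (δ-AB a b)
δ-TAB (suc j) a b = ℚ.*-zeroˡ (δ a 0 * δ b 0)

qS≐X : qS ≐ STAB.Xₛ
qS≐X zero j a b = ℚ.*-zeroˡ (δ j 0 * (δ a 0 * δ b 0))
qS≐X (suc zero) j a b = ≡.trans (ℚ.*-identityˡ (δ j 0 * (δ a 0 * δ b 0))) (δ-TAB j a b)
qS≐X (suc (suc i)) j a b = ℚ.*-zeroˡ (δ j 0 * (δ a 0 * δ b 0))

u₁S≐X : u₁S ≐ STAB.constₛ (SAB.constₛ SB.Xₛ)
u₁S≐X (suc i) j a b = ℚ.*-zeroˡ (δ j 0 * (δ a 1 * δ b 0))
u₁S≐X zero (suc j) a b = ≡.trans (ℚ.*-identityˡ _) (ℚ.*-zeroˡ (δ a 1 * δ b 0))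
u₁S≐X zero zero a b = ≡.trans (ℚ.*-identityˡ _) (≡.trans (ℚ.*-identityˡ (δ a 1 * δ b 0)) (go a))
  where
  go : ∀ a → δ a 1 * δ b 0 ≡ SB.Xₛ a b
  go zero = ℚ.*-zeroˡ (δ b 0)
  go (suc zero) = ≡.trans (ℚ.*-identityˡ (δ b 0)) (δ-B b)
  go (suc (suc a)) = ℚ.*-zeroˡ (δ b 0)

u₃S≐X : u₃S ≐ STAB.constₛ (SAB.constₛ (SB.constₛ Sℚ.Xₛ))
u₃S≐X (suc i) j a b = ℚ.*-zeroˡ (δ j 0 * (δ a 0 * δ b 1))
u₃S≐X zero (suc j) a b = ≡.trans (ℚ.*-identityˡ _) (ℚ.*-zeroˡ (δ a 0 * δ b 1))
u₃S≐X zero zero (suc a) b = ≡.trans (ℚ.*-identityˡ _) (≡.trans (ℚ.*-identityˡ _) (ℚ.*-zeroˡ (δ b 1)))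
u₃S≐X zero zero zero b = ≡.trans (ℚ.*-identityˡ _) (≡.trans (ℚ.*-identityˡ _) (≡.trans (ℚ.*-identityˡ (δ b 1)) (go b)))
  where
  go : ∀ b → δ b 1 ≡ Sℚ.Xₛ b
  go zero = ≡.refl
  go (suc zero) = ≡.refl
  go (suc (suc b)) = ≡.refl

≐-refl : ∀ {f} → f ≐ f
≐-refl i j a b = ≡.refl

qS-⊗-zero : ∀ f j a b → (qS ⊗ f) 0 j a b ≡ 0ℚ
qS-⊗-zero f j a b = ≡.trans (⊗≐* qS f 0 j a b)
  (≡.trans (STAB.*ₛ-cong {h = f} qS≐X ≐-refl 0 j a b) (STAB.Xₛ-*-zero f j a b))

qS-⊗-suc : ∀ f i j a b → (qS ⊗ f) (suc i) j a b ≡ f i j a b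
qS-⊗-suc f i j a b = ≡.trans (⊗≐* qS f (suc i) j a b)
  (≡.trans (STAB.*ₛ-cong {h = f} qS≐X ≐-refl (suc i) j a b) (STAB.Xₛ-*-suc f i j a b))

u₁S-⊗ : ∀ f i j a b → (u₁S ⊗ f) i j a b ≡ (SB.Xₛ SB.*ₛ f i j) a b
u₁S-⊗ f i j a b = ≡.trans (⊗≐* u₁S f i j a b)
  (≡.trans (STAB.*ₛ-cong {h = f} u₁S≐X ≐-refl i j a b)
  (≡.trans (STAB.constₛ-* (SAB.constₛ SB.Xₛ) f i j a b) (SAB.constₛ-* SB.Xₛ (f i) j a b)))

u₁S-⊗-zero : ∀ f i j b → (u₁S ⊗ f) i j 0 b ≡ 0ℚ
u₁S-⊗-zero f i j b = ≡.trans (u₁S-⊗ f i j 0 b) (SB.Xₛ-*-zero (f i j) b)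

u₁S-⊗-suc : ∀ f i j a b → (u₁S ⊗ f) i j (suc a) b ≡ f i j a b
u₁S-⊗-suc f i j a b = ≡.trans (u₁S-⊗ f i j (suc a) b) (SB.Xₛ-*-suc (f i j) a b)

u₃S-⊗ : ∀ f i j a b → (u₃S ⊗ f) i j a b ≡ (Sℚ.Xₛ Sℚ.*ₛ f i j a) b
u₃S-⊗ f i j a b = ≡.trans (⊗≐* u₃S f i j a b)
  (≡.trans (STAB.*ₛ-cong {h = f} u₃S≐X ≐-refl i j a b)
  (≡.trans (STAB.constₛ-* (SAB.constₛ (SB.constₛ Sℚ.Xₛ)) f i j a b)
  (≡.trans (SAB.constₛ-* (SB.constₛ Sℚ.Xₛ) (f i) j a b) (SB.constₛ-* Sℚ.Xₛ (f i j) a b))))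

u₃S-⊗-zero : ∀ f i j a → (u₃S ⊗ f) i j a 0 ≡ 0ℚ
u₃S-⊗-zero f i j a = ≡.trans (u₃S-⊗ f i j a 0) (Sℚ.Xₛ-*-zero (f i j a))

u₃S-⊗-suc : ∀ f i j a b → (u₃S ⊗ f) i j a (suc b) ≡ f i j a b
u₃S-⊗-suc f i j a b = ≡.trans (u₃S-⊗ f i j a (suc b)) (Sℚ.Xₛ-*-suc (f i j a) b)

-- Freedom from u₁ and u₃, expressed through the derivation: this is the form the differential ring
-- asks for, and Leibniz handles products.
Const : Series → Set
Const f = euler f ≐ zeroS

const-u₁ : ∀ {f} → Const f → ∀ i j a b → f i j (suc a) b ≡ 0ℚ
const-u₁ f-const i j a b = fromℕ-cancel (a ℕ.+ b) (f-const i j (suc a) b)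

const-u₃ : ∀ {f} → Const f → ∀ i j b → f i j 0 (suc b) ≡ 0ℚ
const-u₃ f-const i j b = fromℕ-cancel b (f-const i j 0 (suc b))

-- Only the part of `C a b` free of u₁, u₃ is read, as in the definition of `LHS`.
assemble : (ℕ → ℕ → Series) → Series
assemble C i j a b = C a b i j 0 0

const-⊗-assemble : ∀ {f} → Const f → ∀ C → f ⊗ assemble C ≋ assemble (λ a b → f ⊗ C a b)
at (const-⊗-assemble {f} f-const C) i j a b = begin
  (f ⊗ assemble C) i j a b
    ≡⟨ ⊗-AD⁴ i j a b f (assemble C) ⟩
  AD⁴ i j a b (λ i₁ i₂ j₁ j₂ a₁ a₂ b₁ b₂ → f i₁ j₁ a₁ b₁ * C a₂ b₂ i₂ j₂ 0 0)
    ≡⟨ AD-cong i (λ i₁ i₂ _ → AD-cong j λ j₁ j₂ _ → inner i₁ i₂ j₁ j₂) ⟩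
  AD i (λ i₁ i₂ → AD j λ j₁ j₂ → f i₁ j₁ 0 0 * C a b i₂ j₂ 0 0)
    ≡⟨ ⊗-AD⁴ i j 0 0 f (C a b) ⟨
  (f ⊗ C a b) i j 0 0 ∎
  where
  open ≡-Reasoning
  vanish : ∀ {x} → x ≡ 0ℚ → ∀ y → x * y ≡ 0ℚ
  vanish ≡.refl y = ℚ.*-zeroˡ y
  inner : ∀ i₁ i₂ j₁ j₂ → AD a (λ a₁ a₂ → AD b λ b₁ b₂ → f i₁ j₁ a₁ b₁ * C a₂ b₂ i₂ j₂ 0 0) ≡ f i₁ j₁ 0 0 * C a b i₂ j₂ 0 0
  inner i₁ i₂ j₁ j₂ = ≡.trans
    (AD-first a (λ a₁ a₂ → AD b λ b₁ b₂ → f i₁ j₁ a₁ b₁ * C a₂ b₂ i₂ j₂ 0 0)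
      (λ a₁ a₂ → ≡.trans (AD-cong b (λ b₁ b₂ _ → vanish (const-u₁ f-const i₁ j₁ a₁ b₁) (C a₂ b₂ i₂ j₂ 0 0))) (AD-0 b)))
    (AD-first b (λ b₁ b₂ → f i₁ j₁ 0 b₁ * C a b₂ i₂ j₂ 0 0)
      (λ b₁ b₂ → vanish (const-u₃ f-const i₁ j₁ b₁) (C a b₂ i₂ j₂ 0 0)))

δ-Const : ∀ (x : ℕ → ℚ) k → Const (λ i j a b → x i * (δ j k * (δ a 0 * δ b 0)))
δ-Const x k i j zero zero = ℚ.*-zeroˡ (x i * (δ j k * 1ℚ))
δ-Const x k i j zero (suc b) = vanish (x i) (δ j k) (fromℕ (suc b))
  where
  vanish : ∀ x y n → n * (x * (y * 0ℚ)) ≡ 0ℚ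
  vanish = solve 3 (λ x y n → n :* (x :* (y :* con (+ 0))) := con (+ 0)) ≡.refl
    where open IntegerCoefficients ℚ.+-*-commutativeRing
δ-Const x k i j (suc a) b = vanish (x i) (δ j k) (δ b 0) (fromℕ (suc a ℕ.+ b))
  where
  vanish : ∀ x y z n → n * (x * (y * (0ℚ * z))) ≡ 0ℚ
  vanish = solve 4 (λ x y z n → n :* (x :* (y :* (con (+ 0) :* z))) := con (+ 0)) ≡.refl
    where open IntegerCoefficients ℚ.+-*-commutativeRing

qS-Const : Const qS
qS-Const = δ-Const (λ i → δ i 1) 0

tS-Const : Const tS
tS-Const = δ-Const (λ i → δ i 0) 1

geom-Const : ∀ m → Const (geom (suc m))
geom-Const m = δ-Const (λ i → if i % suc m ≡ᵇ 0 then 1ℚ else 0ℚ) 0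

QOrder : ℕ → Series → Set
QOrder n f = ∀ i j a b → i < n → f i j a b ≡ 0ℚ

QOrder-⊗ : ∀ n f g → QOrder n f → QOrder n (f ⊗ g)
QOrder-⊗ n f g f-order i j a b i<n = ≡.trans (⊗-AD⁴ i j a b f g) (≡.trans (AD⁴-cong i j a b vanish) (AD⁴-0 i j a b))
  where
  vanish : ∀ i₁ i₂ j₁ j₂ a₁ a₂ b₁ b₂ → i₁ ℕ.+ i₂ ≡ i → j₁ ℕ.+ j₂ ≡ j → a₁ ℕ.+ a₂ ≡ a → b₁ ℕ.+ b₂ ≡ b → f i₁ j₁ a₁ b₁ * g i₂ j₂ a₂ b₂ ≡ 0ℚ
  vanish i₁ i₂ j₁ j₂ a₁ a₂ b₁ b₂ p _ _ _ =
    ≡.trans (cong (_* g i₂ j₂ a₂ b₂) (f-order i₁ j₁ a₁ b₁ (≤-summandˡ (suc i₁) (cong suc p) i<n))) (ℚ.*-zeroˡ (g i₂ j₂ a₂ b₂))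

pow-qS-order : ∀ n → QOrder n (pow qS n)
pow-qS-order (suc n) zero j a b _ = qS-⊗-zero (pow qS n) j a b
pow-qS-order (suc n) (suc i) j a b (s≤s i<n) = ≡.trans (qS-⊗-suc (pow qS n) i j a b) (pow-qS-order n i j a b i<n)

pow-qS-shift : ∀ n f i j a b → (pow qS n ⊗ f) (n ℕ.+ i) j a b ≡ f i j a b
pow-qS-shift zero f i j a b = ⊗-identityˡ f i j a b
pow-qS-shift (suc n) f i j a b =
  ≡.trans (⊗-assoc qS (pow qS n) f (suc (n ℕ.+ i)) j a b)
  (≡.trans (qS-⊗-suc (pow qS n ⊗ f) (n ℕ.+ i) j a b) (pow-qS-shift n f i j a b))

geom-< : ∀ m i j a b → i < suc m → geom (suc m) i j a b ≡ oneS i j a b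
geom-< m i j a b i<1+m = ≡.trans
  (cong (λ k → (if k ≡ᵇ 0 then 1ℚ else 0ℚ) * (δ j 0 * (δ a 0 * δ b 0))) (m<n⇒m%n≡m i<1+m))
  (≡.sym (ℚ.*-identityˡ (δ i 0 * (δ j 0 * (δ a 0 * δ b 0)))))

geom-+ : ∀ m i j a b → geom (suc m) (suc m ℕ.+ i) j a b ≡ geom (suc m) i j a b
geom-+ m i j a b = cong (λ k → (if k ≡ᵇ 0 then 1ℚ else 0ℚ) * (δ j 0 * (δ a 0 * δ b 0)))
  (≡.trans (cong (_% suc m) (ℕ.+-comm (suc m) i)) ([m+n]%n≡m%n i (suc m)))

pow⊗geom : ℕ → Series
pow⊗geom m = pow qS (suc m) ⊗ geom (suc m)

pow⊗geom-< : ∀ m i j a b → i < suc m → pow⊗geom m i j a b ≡ 0ℚ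
pow⊗geom-< m = QOrder-⊗ (suc m) (pow qS (suc m)) (geom (suc m)) (pow-qS-order (suc m))

geom-suc-≥ : ∀ m i j a b → geom (suc m) (suc m ℕ.+ i) j a b ≡ oneS (suc m ℕ.+ i) j a b + pow⊗geom m (suc m ℕ.+ i) j a b
geom-suc-≥ m i j a b = ≡.trans (geom-+ m i j a b) (≡.trans (≡.sym (pow-qS-shift (suc m) (geom (suc m)) i j a b))
  (≡.trans (≡.sym (ℚ.+-identityˡ (pow⊗geom m (suc m ℕ.+ i) j a b)))
    (cong (_+ pow⊗geom m (suc m ℕ.+ i) j a b) (≡.sym (oneS≐1 (suc m ℕ.+ i) j a b)))))

geom-suc-< : ∀ m i j a b → i < suc m → geom (suc m) i j a b ≡ oneS i j a b + pow⊗geom m i j a b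
geom-suc-< m i j a b i<1+m = ≡.trans (geom-< m i j a b i<1+m)
  (≡.trans (≡.sym (ℚ.+-identityʳ (oneS i j a b))) (cong (_+_ (oneS i j a b)) (≡.sym (pow⊗geom-< m i j a b i<1+m))))

-- This equation replaces division by 1 - q^m. Below q^m only the 1 is visible; from there on the
-- coefficients are periodic.
geom-suc : ∀ m → geom (suc m) ≋ oneS ⊕ pow qS (suc m) ⊗ geom (suc m)
at (geom-suc m) i j a b = [_,_]′ (geom-suc-< m i j a b)
  (λ 1+m≤i → ≡.subst (λ k → geom (suc m) k j a b ≡ oneS k j a b + pow⊗geom m k j a b) (ℕ.m+[n∸m]≡n 1+m≤i) (geom-suc-≥ m (i ∸ suc m) j a b))
  (ℕ.<-≤-connex i (suc m))

ζterm-order : ∀ k m → QOrder ((k ∸ 1) ℕ.* m) (ζterm k m)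
ζterm-order k m =
  QOrder-⊗ n (pow qS n ⊗ pow (oneS ⊖ qS) k) (pow (geom m) k) (QOrder-⊗ n (pow qS n) (pow (oneS ⊖ qS) k) (pow-qS-order n))
  where
  n : ℕ
  n = (k ∸ 1) ℕ.* m

ζtr-summand : ℕ → Index → ℕ → Series
ζtr-summand k ks m = ζterm k m ⊗ ζtr ks m

ζtr-summand-≡0 : ∀ k ks m → 2 ≤ k → QOrder m (ζtr-summand k ks m)
ζtr-summand-≡0 k ks m 2≤k i j a b i<m =
  QOrder-⊗ ((k ∸ 1) ℕ.* m) (ζterm k m) (ζtr ks m) (ζterm-order k m) i j a b
    (ℕ.<-≤-trans i<m (≡.subst (_≤ (k ∸ 1) ℕ.* m) (ℕ.*-identityˡ m) (ℕ.*-monoˡ-≤ m (ℕ.∸-monoˡ-≤ 1 2≤k))))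

-- The summand for m₁ = m has q-order at least (k - 1) m ≥ m, so indices beyond i do not reach q^i.
ζtr-stable : ∀ k ks → 2 ≤ k → ∀ i e j a b → ζtr (k ∷ ks) (suc (i ℕ.+ e)) i j a b ≡ ζtr (k ∷ ks) (suc i) i j a b
ζtr-stable k ks 2≤k i zero j a b = cong (λ n → ζtr (k ∷ ks) (suc n) i j a b) (ℕ.+-identityʳ i)
ζtr-stable k ks 2≤k i (suc e) j a b = ≡.subst (λ n → ζtr (k ∷ ks) (suc n) i j a b ≡ ζtr (k ∷ ks) (suc i) i j a b) (≡.sym (ℕ.+-suc i e))
  (≡.trans (cong₂ _+_ (ζtr-stable k ks 2≤k i e j a b) (ζtr-summand-≡0 k ks (suc (i ℕ.+ e)) 2≤k i j a b (s≤s (ℕ.m≤m+n i e))))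
    (ℚ.+-identityʳ (ζtr (k ∷ ks) (suc i) i j a b)))

-- The truncated generating function and its product formula

private
  module S = CommutativeRing seriesRing
  module Sum = ListSums seriesRing
  module Zeta = ZetaSummands seriesRing

open Exponentiation S.semiring using () renaming (_^_ to _^ₛ_)

pow≡^ : ∀ f n → pow f n ≡ f ^ₛ n
pow≡^ f zero = ≡.refl
pow≡^ f (suc n) = cong (f ⊗_) (pow≡^ f n)

-- y m is q^m/[m] (and 0 for m = 0), so that q^((k-1)m)/[m]^k = y^(k-1) (y - c).
c : Series
c = qS ⊖ oneS

r y : ℕ → Series
r zero = zeroS
r (suc m) = ⊝ (pow qS (suc m) ⊗ geom (suc m))
y m = r m ⊗ c

-- Zero at m = 0, in accordance with y 0 = 0: the factor of the product at m = 0 is 1, so sums and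
-- products may start there.
τ : ℕ → ℕ → Series
τ m k = if 1 ≤ᵇ m then ζterm k m else zeroS

τ≈ : ∀ m k → τ m (2 ℕ.+ k) ≋ y m ^ₛ suc k ⊗ (y m ⊖ c)
τ≈ zero k = Zeta.zero-summand c (y 0 ^ₛ k)
τ≈ (suc m) k = Zeta.summand qS (pow qS (suc m)) (geom (suc m)) c (y (suc m)) (geom-suc m) S.refl S.refl (suc k) (suc m)
  (S.reflexive (pow≡^ qS (suc m))) (S.reflexive (pow≡^ qS (suc k ℕ.* suc m)))
  (S.reflexive (pow≡^ (oneS ⊖ qS) (suc (suc k)))) (S.reflexive (pow≡^ (geom (suc m)) (suc (suc k))))

ζtr-suc : ∀ M k ks → ζtr (k ∷ ks) (suc M) ≋ ζtr (k ∷ ks) M ⊕ τ M k ⊗ ζtr ks M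
ζtr-suc zero k ks = S.sym (S.trans (S.+-identityˡ _) (S.zeroˡ (ζtr ks 0)))
ζtr-suc (suc M) k ks = S.refl

module Truncated (M : ℕ) = Interpolation.Truncations seriesRing tS (oneS ⊖ qS) (λ ks → ζtr ks M) (λ ks → ζtr ks (suc M)) (τ M)
  S.refl (ζtr-suc M) (Zeta.τ-merge qS (y M) (τ M) (τ≈ M)) S.refl

∑Z ∑ΔZ : ℕ → ℕ → ℕ → Series
∑Z M n l = Sum.sum (map (Truncated.Z M) (J n l))
∑ΔZ M n l = Sum.sum (map (Truncated.ΔZ M) (J n l))

G ΔG : ℕ → Series
G M = assemble (λ a b → ∑Z M (a ℕ.+ 2 ℕ.* b) b)
ΔG M = assemble (λ a b → ∑ΔZ M (a ℕ.+ 2 ℕ.* b) b)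

∑Z-suc : ∀ M n l → ∑Z (suc M) n l ≋ ∑Z M n l ⊕ ∑ΔZ M n l
∑Z-suc M n l = S.sym (S.trans (S.sym (Sum.sum-+ (Truncated.Z M) (Truncated.ΔZ M) (J n l)))
  (Sum.sum-cong (All.universal (Truncated.Z+ΔZ M) (J n l))))

G-suc : ∀ M → G (suc M) ≋ G M ⊕ ΔG M
at (G-suc M) i j a b = at (∑Z-suc M (a ℕ.+ 2 ℕ.* b) b) i j 0 0

∑ΔZ-0 : ∀ M n → ∑ΔZ M n 0 ≋ zeroS
∑ΔZ-0 M zero = S.trans (S.+-identityʳ (Truncated.ΔZ M [])) (Truncated.ΔZ-[] M)
∑ΔZ-0 M (suc n) = S.reflexive (cong (λ xs → Sum.sum (map (Truncated.ΔZ M) xs)) (J-suc-0 n))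

∑ΔZ-recursion : ∀ M n l → ∑ΔZ M (suc (suc n)) (suc l) ≋ τ M 2 ⊗ (∑Z M n l ⊕ tS ⊗ ∑ΔZ M n l) ⊕ y M ⊗ ∑ΔZ M (suc n) (suc l)
∑ΔZ-recursion M = Truncated.∑ΔZ-recursion M (y M) (Zeta.τ-suc qS (y M) (τ M) (τ≈ M))

const-⊗ : ∀ {f g} → Const f → Const g → Const (f ⊗ g)
const-⊗ {f} {g} f-const g-const i j a b = ≡.trans (euler-⊗ f g i j a b) (at
  (S.trans (S.+-cong (S.trans (S.*-congʳ {g} {euler f} {zeroS} (coefficientwise f-const)) (S.zeroˡ g))
                     (S.trans (S.*-congˡ {f} {euler g} {zeroS} (coefficientwise g-const)) (S.zeroʳ f)))
           (S.+-identityˡ zeroS)) i j a b)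

const-⊕ : ∀ {f g} → Const f → Const g → Const (f ⊕ g)
const-⊕ {f} {g} f-const g-const i j a b =
  ≡.trans (ℚ.*-distribˡ-+ (fromℕ (a ℕ.+ b)) (f i j a b) (g i j a b)) (cong₂ _+_ (f-const i j a b) (g-const i j a b))

const-⊝ : ∀ {f} → Const f → Const (⊝ f)
const-⊝ {f} f-const i j a b =
  ≡.trans (≡.sym (ℚ.neg-distribʳ-* (fromℕ (a ℕ.+ b)) (f i j a b))) (cong -_ (f-const i j a b))

const-pow : ∀ {f} → Const f → ∀ n → Const (pow f n)
const-pow f-const zero = euler-one
const-pow {f} f-const (suc n) = const-⊗ {f} {pow f n} f-const (const-pow f-const n)

c-Const : Const c
c-Const = const-⊕ {qS} {⊝ oneS} qS-Const (const-⊝ {oneS} euler-one)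

r-Const : ∀ m → Const (r m)
r-Const zero i j a b = ℚ.*-zeroʳ (fromℕ (a ℕ.+ b))
r-Const (suc m) = const-⊝ {pow qS (suc m) ⊗ geom (suc m)}
  (const-⊗ {pow qS (suc m)} {geom (suc m)} (const-pow {qS} qS-Const (suc m)) (geom-Const m))

y-Const : ∀ m → Const (y m)
y-Const m = const-⊗ {r m} {c} (r-Const m) c-Const

τ₂ : ℕ → Series
τ₂ m = y m ⊗ (y m ⊖ c)

τ₂-Const : ∀ m → Const (τ₂ m)
τ₂-Const m = const-⊗ {y m} {y m ⊖ c} (y-Const m) (const-⊕ {y m} {⊝ c} (y-Const m) (const-⊝ {c} c-Const))

τ-2 : ∀ m → τ m 2 ≋ τ₂ m
τ-2 m = S.trans (τ≈ m 0) (S.*-congʳ {y m ⊖ c} {y m ⊗ oneS} {y m} (S.*-identityʳ (y m)))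

module _ (M : ℕ) where

  first second : Series
  first = τ₂ M ⊗ (G M ⊕ tS ⊗ ΔG M)
  second = y M ⊗ ΔG M

  firstCoefficient secondCoefficient : ℕ → ℕ → Series
  firstCoefficient n b = τ₂ M ⊗ (∑Z M n b ⊕ tS ⊗ ∑ΔZ M n b)
  secondCoefficient n b = y M ⊗ ∑ΔZ M n b

  first≋ : first ≋ assemble (λ a b → firstCoefficient (a ℕ.+ 2 ℕ.* b) b)
  first≋ = S.trans (S.*-congˡ {τ₂ M} (S.+-congˡ {G M} (const-⊗-assemble tS-Const (λ a b → ∑ΔZ M (a ℕ.+ 2 ℕ.* b) b))))
    (const-⊗-assemble (τ₂-Const M) (λ a b → ∑Z M (a ℕ.+ 2 ℕ.* b) b ⊕ tS ⊗ ∑ΔZ M (a ℕ.+ 2 ℕ.* b) b))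

  second≋ : second ≋ assemble (λ a b → secondCoefficient (a ℕ.+ 2 ℕ.* b) b)
  second≋ = const-⊗-assemble (y-Const M) (λ a b → ∑ΔZ M (a ℕ.+ 2 ℕ.* b) b)

  secondCoefficient-≈0 : ∀ n b → ∑ΔZ M n b ≋ zeroS → secondCoefficient n b ≋ zeroS
  secondCoefficient-≈0 n b ∑ΔZ≈0 = S.trans (S.*-congˡ {y M} {∑ΔZ M n b} {zeroS} ∑ΔZ≈0) (S.zeroʳ (y M))

  ∑ΔZ-step : ∀ n l → ∑ΔZ M (suc (suc n)) (suc l) ≋ firstCoefficient n l ⊕ secondCoefficient (suc n) (suc l)
  ∑ΔZ-step n l = S.trans (∑ΔZ-recursion M n l)
    (S.+-congʳ {secondCoefficient (suc n) (suc l)} {τ M 2 ⊗ (∑Z M n l ⊕ tS ⊗ ∑ΔZ M n l)} {firstCoefficient n l}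
      (S.*-congʳ {∑Z M n l ⊕ tS ⊗ ∑ΔZ M n l} {τ M 2} {τ₂ M} (τ-2 M)))

  +2*suc : ∀ a b → a ℕ.+ 2 ℕ.* suc b ≡ suc (suc (a ℕ.+ 2 ℕ.* b))
  +2*suc a b = ≡.trans (cong (a ℕ.+_) (ℕ.*-suc 2 b)) (≡.trans (ℕ.+-suc a _) (cong suc (ℕ.+-suc a _)))

  u₃-first : ∀ i j a b → (u₃S ⊗ first) i j a (suc b) ≡ firstCoefficient (a ℕ.+ 2 ℕ.* b) b i j 0 0
  u₃-first i j a b = ≡.trans (u₃S-⊗-suc first i j a b) (at first≋ i j a b)

  u₁-second : ∀ i j a b → (u₁S ⊗ second) i j (suc a) b ≡ secondCoefficient (a ℕ.+ 2 ℕ.* b) b i j 0 0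
  u₁-second i j a b = ≡.trans (u₁S-⊗-suc second i j a b) (at second≋ i j a b)

  -- At a = 0 the shift by u₁ gives 0. The right side agrees because no index with b + 1 entries ≥ 2
  -- has weight 2 b + 1.
  u₁-second-suc : ∀ i j a b → (u₁S ⊗ second) i j a (suc b) ≡ secondCoefficient (suc (a ℕ.+ 2 ℕ.* b)) (suc b) i j 0 0
  u₁-second-suc i j zero b = ≡.trans (u₁S-⊗-zero second i j (suc b))
    (≡.sym (at (secondCoefficient-≈0 (suc (2 ℕ.* b)) (suc b)
      (S.reflexive (cong (λ xs → Sum.sum (map (Truncated.ΔZ M) xs))
        (J-empty (suc (2 ℕ.* b)) (suc b) (ℕ.≤-reflexive (≡.sym (ℕ.*-suc 2 b))))))) i j 0 0))
  u₁-second-suc i j (suc a) b = ≡.trans (u₁-second i j a (suc b))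
    (cong (λ n → secondCoefficient n (suc b) i j 0 0) (+2*suc a b))

  u₁-second-zero : ∀ i j a → (u₁S ⊗ second) i j a 0 ≡ 0ℚ
  u₁-second-zero i j zero = u₁S-⊗-zero second i j 0
  u₁-second-zero i j (suc a) = ≡.trans (u₁-second i j a 0)
    (at (secondCoefficient-≈0 (a ℕ.+ 2 ℕ.* 0) 0 (∑ΔZ-0 M (a ℕ.+ 2 ℕ.* 0))) i j 0 0)

  -- At u₁^a u₃^b the weight is a + 2 b and the depth b. Hence u₃ prepends an entry 2, and u₁ raises
  -- the first entry by one. At b = 0 only the empty index could contribute, and its value does not
  -- depend on M.
  ΔG-equation : ΔG M ≋ u₃S ⊗ first ⊕ u₁S ⊗ second
  at ΔG-equation i j a zero = ≡.trans (at (∑ΔZ-0 M (a ℕ.+ 2 ℕ.* 0)) i j 0 0)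
    (≡.sym (cong₂ _+_ (u₃S-⊗-zero first i j a) (u₁-second-zero i j a)))
  at ΔG-equation i j a (suc b) =
    ≡.trans (cong (λ n → ∑ΔZ M n (suc b) i j 0 0) (+2*suc a b))
    (≡.trans (at (∑ΔZ-step (a ℕ.+ 2 ℕ.* b) b) i j 0 0)
    (≡.sym (cong₂ _+_ (u₃-first i j a b) (u₁-second-suc i j a b))))

αw αz : Series → Series
αw x = (oneS ⊖ ew₁ ⊗ x) ⊕ ew₂ ⊗ (x ⊗ x)
αz x = (oneS ⊖ ez₁ ⊗ x) ⊕ ez₂ ⊗ (x ⊗ x)

private
  module Factor = Zeta.Factors qS tS u₁S u₃S c ew₁ ew₂ ez₁ ez₂ (S.refl {c}) (S.refl {ew₁}) (S.refl {ew₂}) (S.refl {ez₁}) (S.refl {ez₂})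

G-product : ∀ M → G (suc M) ⊗ αw (y M) ≋ G M ⊗ αz (y M)
G-product M = Factor.product-step (y M) (τ₂ M) (G M) (G (suc M)) (ΔG M) S.refl (G-suc M) (ΔG-equation M)

αw-c≋αz-c : αw c ≋ αz c
αw-c≋αz-c = Factor.α-q-1

admissible-nonempty : ∀ p → Admissible p → ζtr p 0 ≡ zeroS
admissible-nonempty (k ∷ p) _ = ≡.refl

Z-0-∷ : ∀ {ks} → All (2 ≤_) ks → Admissible ks → Truncated.Z 0 ks ≋ zeroS
Z-0-∷ {k ∷ ks} (2≤k ∷ 2≤ks) _ = Sum.sum-0 (All.map (λ { {p , s , r} ok →
  S.trans (S.*-congˡ {tS ^ₛ s ⊗ (oneS ⊖ qS) ^ₛ r} {ζtr p 0} {zeroS} (S.reflexive (admissible-nonempty p ok))) (S.zeroʳ (tS ^ₛ s ⊗ (oneS ⊖ qS) ^ₛ r)) }) (fillGo-admissible ks 2≤k 2≤ks))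

All-Z-0 : ∀ {xs} → All (All (2 ≤_)) xs → All Admissible xs → All (λ ks → Truncated.Z 0 ks ≋ zeroS) xs
All-Z-0 [] [] = []
All-Z-0 (p ∷ ps) (q ∷ qs) = Z-0-∷ p q ∷ All-Z-0 ps qs

∑Z-0-suc : ∀ n l → ∑Z 0 n (suc l) ≋ zeroS
∑Z-0-suc n l = Sum.sum-0 {f = Truncated.Z 0} {xs = J n (suc l)} (All-Z-0 (J-large n (suc l)) (J-suc-nonempty n l))

∑Z-zero : ∀ M → ∑Z M 0 0 ≋ oneS
∑Z-zero M = S.trans (S.+-identityʳ (Truncated.Z M [])) (Truncated.Z-[] M)

∑Z-suc-zero : ∀ M n → ∑Z M (suc n) 0 ≋ zeroS
∑Z-suc-zero M n = S.reflexive (cong (λ xs → Sum.sum (map (Truncated.Z M) xs)) (J-suc-0 n))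

oneS-u₁ : ∀ i j a b → oneS i j (suc a) b ≡ 0ℚ
oneS-u₁ i j a b = const-u₁ {oneS} euler-one i j a b

G-b-0 : ∀ M i j a → G M i j a 0 ≡ oneS i j a 0
G-b-0 M i j zero = at (∑Z-zero M) i j 0 0
G-b-0 M i j (suc a) = ≡.trans (at (∑Z-suc-zero M (a ℕ.+ 0)) i j 0 0) (≡.sym (oneS-u₁ i j a 0))

oneS-u₃ : ∀ i j a b → oneS i j a (suc b) ≡ 0ℚ
oneS-u₃ i j zero b = const-u₃ {oneS} euler-one i j b
oneS-u₃ i j (suc a) b = oneS-u₁ i j a (suc b)

-- With no admissible m₁ every non-empty filling contributes zero; the empty index remains.
G-0 : G 0 ≋ oneS
at G-0 i j a zero = G-b-0 0 i j a
at G-0 i j a (suc b) = ≡.trans (at (∑Z-0-suc (a ℕ.+ 2 ℕ.* suc b) b) i j 0 0) (≡.sym (oneS-u₃ i j a b))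

-- The left-hand side as a truncation of the generating function

module Convergence (I d : ℕ) where

  open Truncation I d
  private
    module TR = CommutativeRing truncatedRing
    module SumT = ListSums truncatedRing

  ζq~ζtr : ∀ p → Admissible p → ζq p ~ ζtr p (suc I)
  at~ (ζq~ζtr (k ∷ ks) 2≤ᵇk) i j a b i≤I _ = ≡.subst (λ n → ζtr (k ∷ ks) (suc i) i j a b ≡ ζtr (k ∷ ks) (suc n) i j a b) (ℕ.m+[n∸m]≡n i≤I)
    (≡.sym (ζtr-stable k ks (ℕ.≤ᵇ⇒≤ 2 k (≡.subst T (≡.sym 2≤ᵇk) tt)) i (I ∸ i) j a b))

  ζtqTerm : Filling → Series
  ζtqTerm (p , s , r) = pow tS s ⊗ pow (oneS ⊖ qS) r ⊗ ζq p

  ζtqTerm~ : ∀ x → Admissible (proj₁ x) → ζtqTerm x ~ Truncated.value (suc I) (λ ks → ζtr ks (suc I)) x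
  ζtqTerm~ (p , s , r) ok = ⊗-cong-~ {pow tS s ⊗ pow (oneS ⊖ qS) r} {tS ^ₛ s ⊗ (oneS ⊖ qS) ^ₛ r} {ζq p} {ζtr p (suc I)}
    (TR.reflexive (cong₂ _⊗_ (pow≡^ tS s) (pow≡^ (oneS ⊖ qS) r))) (ζq~ζtr p ok)

  ζtq~Z : ∀ {ks} → All (2 ≤_) ks → Admissible ks → ζtq ks ~ Truncated.Z (suc I) ks
  ζtq~Z {k ∷ ks} (2≤k ∷ 2≤ks) _ = SumT.sum-cong {f = ζtqTerm} {g = Truncated.value (suc I) (λ ks → ζtr ks (suc I))} {xs = fillGo k ks}
    (All.map (λ {x} → ζtqTerm~ x) (fillGo-admissible ks 2≤k 2≤ks))

  All-ζtq~Z : ∀ {xs} → All (All (2 ≤_)) xs → All Admissible xs → All (λ ks → ζtq ks ~ Truncated.Z (suc I) ks) xs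
  All-ζtq~Z [] [] = []
  All-ζtq~Z (p ∷ ps) (q ∷ qs) = ζtq~Z p q ∷ All-ζtq~Z ps qs

  ∑ζtq~∑Z : ∀ n l → sumS (map ζtq (J n (suc l))) ~ ∑Z (suc I) n (suc l)
  ∑ζtq~∑Z n l = SumT.sum-cong {f = ζtq} {g = Truncated.Z (suc I)} {xs = J n (suc l)} (All-ζtq~Z (J-large n (suc l)) (J-suc-nonempty n l))

1+LHS≡G : ∀ i j a b → oneS i j a b + LHS i j a b ≡ G (suc i) i j a b
1+LHS≡G i j a zero = ≡.trans (cong (λ xs → oneS i j a 0 + sumS (map ζtq xs) i j 0 0) (I₀-zero (a ℕ.+ 2 ℕ.* 0)))
  (≡.trans (ℚ.+-identityʳ (oneS i j a 0)) (≡.sym (G-b-0 (suc i) i j a)))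
1+LHS≡G i j a (suc b) = ≡.trans (cong₂ _+_ (oneS-u₃ i j a b) (cong (λ xs → sumS (map ζtq xs) i j 0 0) (I₀-suc (a ℕ.+ 2 ℕ.* suc b) b)))
  (≡.trans (ℚ.+-identityˡ (sumS (map ζtq (J (a ℕ.+ 2 ℕ.* suc b) (suc b))) i j 0 0))
    -- Degree bound 0 is enough, as the inner sum is read at u₁^0 u₃^0.
    (Truncation.at~ (Convergence.∑ζtq~∑Z i 0 (a ℕ.+ 2 ℕ.* suc b) b) i j 0 0 ℕ.≤-refl z≤n))

unit : ℕ → ℕ → ℕ → ℕ → ℚ
unit i j a b = δ i 0 * (δ j 0 * (δ a 0 * δ b 0))

scal-⊗ : ∀ x f → scal x ⊗ f ≐ λ i j a b → x * f i j a b
scal-⊗ x f i j a b = begin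
  (scal x ⊗ f) i j a b
    ≡⟨ ⊗-AD⁴ i j a b (scal x) f ⟩
  AD⁴ i j a b (λ i₁ i₂ j₁ j₂ a₁ a₂ b₁ b₂ → scal x i₁ j₁ a₁ b₁ * f i₂ j₂ a₂ b₂)
    ≡⟨ AD⁴-cong i j a b (λ i₁ i₂ j₁ j₂ a₁ a₂ b₁ b₂ _ _ _ _ → lemma x (unit i₁ j₁ a₁ b₁) (f i₂ j₂ a₂ b₂)) ⟩
  AD⁴ i j a b (λ i₁ i₂ j₁ j₂ a₁ a₂ b₁ b₂ → x * (oneS i₁ j₁ a₁ b₁ * f i₂ j₂ a₂ b₂))
    ≡⟨ AD⁴-* i j a b x (λ i₁ i₂ j₁ j₂ a₁ a₂ b₁ b₂ → oneS i₁ j₁ a₁ b₁ * f i₂ j₂ a₂ b₂) ⟩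
  x * AD⁴ i j a b (λ i₁ i₂ j₁ j₂ a₁ a₂ b₁ b₂ → oneS i₁ j₁ a₁ b₁ * f i₂ j₂ a₂ b₂)
    ≡⟨ cong (x *_) (⊗-AD⁴ i j a b oneS f) ⟨
  x * (oneS ⊗ f) i j a b
    ≡⟨ cong (x *_) (⊗-identityˡ f i j a b) ⟩
  x * f i j a b ∎
  where
  open ≡-Reasoning
  lemma : ∀ x u y → (x * u) * y ≡ x * ((1ℚ * u) * y)
  lemma x u y = ≡.trans (ℚ.*-assoc x u y) (cong (λ v → x * (v * y)) (≡.sym (ℚ.*-identityˡ u)))

scal-Const : ∀ x → Const (scal x)
scal-Const x i j a b = begin
  n * (x * unit i j a b)         ≡⟨ lemma n x (unit i j a b) ⟩
  x * (n * (1ℚ * unit i j a b))  ≡⟨ cong (x *_) (euler-one i j a b) ⟩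
  x * 0ℚ                         ≡⟨ ℚ.*-zeroʳ x ⟩
  0ℚ                             ∎
  where
  open ≡-Reasoning
  n : ℚ
  n = fromℕ (a ℕ.+ b)
  open IntegerCoefficients ℚ.+-*-commutativeRing
  lemma : ∀ n x u → n * (x * u) ≡ x * (n * (1ℚ * u))
  lemma n x u = ≡.trans (swap n x u) (cong (λ v → x * (n * v)) (≡.sym (ℚ.*-identityˡ u)))
    where
    swap : ∀ n x u → n * (x * u) ≡ x * (n * u)
    swap = solve 3 (λ n x u → n :* (x :* u) := x :* (n :* u)) ≡.refl

fromℕ-* : ∀ m n → fromℕ (m ℕ.* n) ≡ fromℕ m * fromℕ n
fromℕ-* zero n = ≡.sym (ℚ.*-zeroˡ (fromℕ n))
fromℕ-* (suc m) n = begin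
  fromℕ (n ℕ.+ m ℕ.* n)                  ≡⟨ fromℕ-+ n (m ℕ.* n) ⟩
  fromℕ n + fromℕ (m ℕ.* n)              ≡⟨ cong₂ _+_ (≡.sym (ℚ.*-identityˡ (fromℕ n))) (fromℕ-* m n) ⟩
  1ℚ * fromℕ n + fromℕ m * fromℕ n       ≡⟨ ℚ.*-distribʳ-+ (fromℕ n) 1ℚ (fromℕ m) ⟨
  fromℕ (suc m) * fromℕ n                ∎
  where open ≡-Reasoning

inv-* : ∀ m n → inv (suc m ℕ.* suc n) * fromℕ (suc m) ≡ inv (suc n)
inv-* m n = begin
  x * a              ≡⟨ ℚ.*-identityʳ (x * a) ⟨
  (x * a) * 1ℚ       ≡⟨ cong ((x * a) *_) (inv-fromℕ n) ⟨
  (x * a) * (z * b)  ≡⟨ lemma x a z b ⟩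
  (x * (a * b)) * z  ≡⟨ cong (λ v → (x * v) * z) (fromℕ-* (suc m) (suc n)) ⟨
  (x * fromℕ (suc m ℕ.* suc n)) * z  ≡⟨ cong (_* z) (inv-fromℕ (n ℕ.+ m ℕ.* suc n)) ⟩
  1ℚ * z             ≡⟨ ℚ.*-identityˡ z ⟩
  z                  ∎
  where
  open ≡-Reasoning
  open IntegerCoefficients ℚ.+-*-commutativeRing
  x a z b : ℚ
  x = inv (suc m ℕ.* suc n)
  a = fromℕ (suc m)
  z = inv (suc n)
  b = fromℕ (suc n)
  lemma : ∀ x a z b → (x * a) * (z * b) ≡ (x * (a * b)) * z
  lemma = solve 4 (λ x a z b → (x :* a) :* (z :* b) := (x :* (a :* b)) :* z) ≡.refl

-- `inv-*` is stated for successors, so r! is written as the successor of its predecessor.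
inv-fact : ∀ r → inv (fact (suc r)) * fromℕ (suc r) ≡ inv (fact r)
inv-fact r = ≡.subst (λ n → inv (suc r ℕ.* n) * fromℕ (suc r) ≡ inv n) (ℕ.suc-pred (fact r)) (inv-* r (ℕ.pred (fact r)))
  where
  instance
    fact≢0 : ℕ.NonZero (fact r)
    fact≢0 = ℕ._!≢0 r

u₁S-0 : ∀ i j → u₁S i j 0 0 ≡ 0ℚ
u₁S-0 i j = ≡.trans (cong (δ i 0 *_) (ℚ.*-zeroʳ (δ j 0))) (ℚ.*-zeroʳ (δ i 0))

u₃S-0 : ∀ i j → u₃S i j 0 0 ≡ 0ℚ
u₃S-0 i j = ≡.trans (cong (δ i 0 *_) (ℚ.*-zeroʳ (δ j 0))) (ℚ.*-zeroʳ (δ i 0))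

ι φ : ℕ → Series
ι n = scal (inv n)
φ n = scal (inv (fact n))

-- The exponential formula applied to truncated series

module Instance (I d : ℕ) where

  open Truncation I d
  open FilteredDifferentialRingTheory truncatedDifferentialRing
    using (ν; ∑; _^_; F-resp-≈; F-+; F-neg; F-*ˡ; F-*ʳ; F-∑; module Exponential)
  private
    module R = CommutativeRing truncatedRing

  const~ : ∀ {f} → Const f → euler f ~ zeroS
  const~ f-const = truncated λ i j a b _ _ → f-const i j a b

  ν≐scal : ∀ n → ν n ≐ scal (fromℕ n)
  ν≐scal zero i j a b = ≡.sym (ℚ.*-zeroˡ (unit i j a b))
  ν≐scal (suc n) i j a b = ≡.trans (cong (_+_ (oneS i j a b)) (ν≐scal n i j a b)) (≡.sym (ℚ.*-distribʳ-+ (unit i j a b) 1ℚ (fromℕ n)))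

  scal-ν : ∀ x z n → x * fromℕ n ≡ z → scal x ⊗ ν n ~ scal z
  at~ (scal-ν x z n xn≡z) i j a b _ _ = begin
    (scal x ⊗ ν n) i j a b                 ≡⟨ scal-⊗ x (ν n) i j a b ⟩
    x * ν n i j a b                        ≡⟨ cong (x *_) (ν≐scal n i j a b) ⟩
    x * (fromℕ n * unit i j a b)           ≡⟨ ℚ.*-assoc x (fromℕ n) (unit i j a b) ⟨
    (x * fromℕ n) * unit i j a b           ≡⟨ cong (_* unit i j a b) xn≡z ⟩
    z * unit i j a b                       ∎
    where open ≡-Reasoning

  VanishesBelow₁ : ∀ {f} → (∀ i j → f i j 0 0 ≡ 0ℚ) → VanishesBelow 1 f
  vanishes (VanishesBelow₁ f0) i j zero zero _ _ _ = f0 i j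
  vanishes (VanishesBelow₁ f0) i j zero (suc b) _ _ (s≤s ())
  vanishes (VanishesBelow₁ f0) i j (suc a) b _ _ (s≤s ())

  u₁∈F₁ : VanishesBelow 1 u₁S
  u₁∈F₁ = VanishesBelow₁ u₁S-0

  u₃∈F₁ : VanishesBelow 1 u₃S
  u₃∈F₁ = VanishesBelow₁ u₃S-0

  ew₁∈F₁ : VanishesBelow 1 ew₁
  ew₁∈F₁ = F-+ {1} {u₁S} {tS ⊗ (oneS ⊖ qS) ⊗ u₃S} u₁∈F₁ (F-*ˡ (tS ⊗ (oneS ⊖ qS)) u₃∈F₁)

  ew₂∈F₁ : VanishesBelow 1 ew₂
  ew₂∈F₁ = F-neg {1} {tS ⊗ u₃S} (F-*ˡ tS u₃∈F₁)

  ez₁∈F₁ : VanishesBelow 1 ez₁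
  ez₁∈F₁ = F-+ {1} {u₁S} {⊝ ((oneS ⊖ tS) ⊗ (oneS ⊖ qS) ⊗ u₃S)} u₁∈F₁
    (F-neg {1} {(oneS ⊖ tS) ⊗ (oneS ⊖ qS) ⊗ u₃S} (F-*ˡ ((oneS ⊖ tS) ⊗ (oneS ⊖ qS)) u₃∈F₁))

  ez₂∈F₁ : VanishesBelow 1 ez₂
  ez₂∈F₁ = F-*ˡ (oneS ⊖ tS) u₃∈F₁

  scal-2 : scal (+ 2 / 1) ~ oneS ⊕ oneS
  scal-2 = truncated λ i j a b _ _ → ℚ.*-distribʳ-+ (unit i j a b) 1ℚ 1ℚ

  pow≡^~ : ∀ f n → pow f n ≡ f ^ n
  pow≡^~ f zero = ≡.refl
  pow≡^~ f (suc n) = cong (f ⊗_) (pow≡^~ f n)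

  -- Powers in the exact and in the truncated ring are separate instances over one carrier. They
  -- agree as series, not merely modulo the truncation.
  ^≡^ : ∀ f n → f ^ₛ n ≡ f ^ n
  ^≡^ f zero = ≡.refl
  ^≡^ f (suc n) = cong (f ⊗_) (^≡^ f n)

  module EF = ExponentialFormula.PowerSumSequences truncatedDifferentialRing ι (λ n → const~ (scal-Const (inv n))) (λ n → scal-ν (inv (suc n)) 1ℚ (suc n) (inv-fromℕ n))
    ew₁ ew₂ ez₁ ez₂ ew₁∈F₁ ew₂∈F₁ ez₁∈F₁ ez₂∈F₁ (powSum ew₁ ew₂) (powSum ez₁ ez₂)
    scal-2 (R.refl {ew₁}) (λ n → R.refl {powSum ew₁ ew₂ (suc (suc n))})
    scal-2 (R.refl {ez₁}) (λ n → R.refl {powSum ez₁ ez₂ (suc (suc n))})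

  ζ : ℕ → Series
  ζ n = ζq (n ∷ [])

  ζtr-∑ : ∀ n M → ζtr (suc (suc n) ∷ []) M ~ ∑ M (λ m → y m ^ suc n ⊗ (y m ⊖ c))
  ζtr-∑ n zero = R.refl {zeroS}
  ζtr-∑ n (suc M) = R.trans (≋⇒~ (ζtr-suc M (suc (suc n)) []))
    (R.+-cong {ζtr (suc (suc n) ∷ []) M} {∑ M (λ m → y m ^ suc n ⊗ (y m ⊖ c))} {τ M (suc (suc n)) ⊗ oneS} {y M ^ suc n ⊗ (y M ⊖ c)}
      (ζtr-∑ n M) (R.trans (R.*-identityʳ (τ M (suc (suc n))))
      (R.trans (≋⇒~ (τ≈ M n)) (R.reflexive (cong (_⊗ (y M ⊖ c)) (^≡^ (y M) (suc n)))))))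

  ζ-sum : ∀ n → ζ (suc (suc n)) ~ ∑ (suc I) (λ m → y m ^ suc n ⊗ (y m ⊖ c))
  ζ-sum n = R.trans (Convergence.ζq~ζtr I d (suc (suc n) ∷ []) ≡.refl) (ζtr-∑ n (suc I))

  module EX = EF.Exponent c (const~ c-Const) (suc I) y r (λ m → const~ (y-Const m)) (λ m → const~ (r-Const m)) (λ m → R.refl {y m})
    (≋⇒~ αw-c≋αz-c) ζ ζ-sum

  ΣS<≡∑ : ∀ n {f g} → (∀ k → f k ≡ g k) → ΣS< n f ≡ ∑ n g
  ΣS<≡∑ zero f≡g = ≡.refl
  ΣS<≡∑ (suc n) f≡g = cong₂ _⊕_ (ΣS<≡∑ n f≡g) (f≡g n)

  Xterm≡X-term : ∀ n m → Xterm n m ≡ EX.X-term n m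
  Xterm≡X-term n m = cong (λ p → ζ n ⊗ ι (m ℕ.+ n) ⊗ p ⊗ (powSum ew₁ ew₂ (m ℕ.+ n) ⊖ powSum ez₁ ez₂ (m ℕ.+ n))) (pow≡^~ c m)

  XN≡X-degree : ∀ N → XN N ≡ EX.X-degree N
  XN≡X-degree N = ΣS<≡∑ (suc N) (λ n → cong (if 2 ≤ᵇ n then_else zeroS) (Xterm≡X-term n (N ∸ n)))

  XN-vanishes : ∀ N → 2 ℕ.* d < N → VanishesBelow (suc d) (XN N)
  XN-vanishes N 2d<N = ≡.subst (VanishesBelow (suc d)) (≡.sym (XN≡X-degree N))
    -- 2 (d + 1) ≤ N + 1 is precisely 2 d < N, thanks to the sharp order of the power sums.
    (EX.X-degree-order (suc d) N (≡.subst (_≤ suc N) (≡.sym (ℕ.*-suc 2 d)) (s≤s 2d<N)) (ℕ.≤-trans (s≤s z≤n) 2d<N))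

XN≡0 : ∀ N i j a b → 2 ℕ.* (a ℕ.+ b) < N → XN N i j a b ≡ 0ℚ
XN≡0 N i j a b 2d<N = Truncation.vanishes (Instance.XN-vanishes i (a ℕ.+ b) N 2d<N) i j a b ℕ.≤-refl ℕ.≤-refl (ℕ.n<1+n (a ℕ.+ b))

ΣS<-stable : ∀ (f : ℕ → Series) n i j a b → (∀ N → n ≤ N → f N i j a b ≡ 0ℚ) → ∀ {m} → n ≤ m → ΣS< m f i j a b ≡ ΣS< n f i j a b
ΣS<-stable f n i j a b f≡0 {m} n≤m = ≡.subst (λ k → ΣS< k f i j a b ≡ ΣS< n f i j a b) (ℕ.m+[n∸m]≡n n≤m) (go (m ∸ n))
  where
  go : ∀ e → ΣS< (n ℕ.+ e) f i j a b ≡ ΣS< n f i j a b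
  go zero = cong (λ k → ΣS< k f i j a b) (ℕ.+-identityʳ n)
  go (suc e) = ≡.trans (cong (λ k → ΣS< k f i j a b) (ℕ.+-suc n e))
    (≡.trans (cong₂ _+_ (go e) (f≡0 (n ℕ.+ e) (ℕ.m≤m+n n e))) (ℚ.+-identityʳ (ΣS< n f i j a b)))

module Conclusion (I d : ℕ) where

  open Truncation I d
  open FilteredDifferentialRingTheory truncatedDifferentialRing using (∑; _^_)
  open Instance I d using (const~; scal-ν; pow≡^~; ΣS<≡∑; XN≡X-degree; module EX)
  private
    module R = CommutativeRing truncatedRing

  -- The least cut-off for which the logarithmic identities hold exactly modulo degree d + 1 by
  -- `α-D-L`.
  K : ℕ
  K = 2 ℕ.* suc d

  -- The cut-off in `Xser` depends on the coefficient. One uniform cut-off serves all of them, as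
  -- the additional terms do not reach the coefficient in question.
  Xser~ : Xser ~ ∑ (suc K) EX.X-degree
  at~ Xser~ i j a b _ a+b≤d = begin
    Xser i j a b
      ≡⟨ ΣS<-stable XN (suc (2 ℕ.* (a ℕ.+ b))) i j a b (λ N → XN≡0 N i j a b) (s≤s (ℕ.*-monoʳ-≤ 2 (ℕ.m≤n⇒m≤1+n a+b≤d))) ⟨
    ΣS< (suc K) XN i j a b
      ≡⟨ cong (λ f → f i j a b) (ΣS<≡∑ (suc K) XN≡X-degree) ⟩
    ∑ (suc K) EX.X-degree i j a b ∎
    where open ≡-Reasoning

  G~exp : G (suc I) ~ ∑ (suc d) (λ r → φ r ⊗ Xser ^ r)
  G~exp = EX.G≈exp K ℕ.≤-refl G (≋⇒~ G-0) (λ m → ≋⇒~ (G-product m)) Xser Xser~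
    φ (λ r → const~ (scal-Const (inv (fact r)))) (R.refl {oneS})
    (λ r → scal-ν (inv (fact (suc r))) (inv (fact r)) (suc r) (inv-fact r))

  summand : ℕ → Series
  summand r = if 1 ≤ᵇ r then φ r ⊗ pow Xser r else zeroS

  1+∑~exp : ∀ n → oneS ⊕ ΣS< (suc n) summand ~ ∑ (suc n) (λ r → φ r ⊗ Xser ^ r)
  1+∑~exp zero = R.trans (R.trans (R.+-congˡ {oneS} {zeroS ⊕ zeroS} {zeroS} (R.+-identityˡ zeroS)) (R.+-identityʳ oneS))
    (R.sym (R.trans (R.+-identityˡ (oneS ⊗ oneS)) (R.*-identityˡ oneS)))
  1+∑~exp (suc n) = R.trans (R.sym (R.+-assoc oneS (ΣS< (suc n) summand) (summand (suc n))))
    (R.+-cong {oneS ⊕ ΣS< (suc n) summand} {∑ (suc n) (λ r → φ r ⊗ Xser ^ r)} {summand (suc n)} {φ (suc n) ⊗ Xser ^ suc n}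
      (1+∑~exp n) (R.reflexive (cong (φ (suc n) ⊗_) (pow≡^~ Xser (suc n)))))

theorem2p4 : ∀ (i j a b : ℕ) → LHS i j a b ≡ RHS i j a b
theorem2p4 i j a b = +-cancelˡ (oneS i j a b) (LHS i j a b) (RHS i j a b) (begin
  oneS i j a b + LHS i j a b
    ≡⟨ 1+LHS≡G i j a b ⟩
  G (suc i) i j a b
    ≡⟨ at~ G~exp i j a b ℕ.≤-refl ℕ.≤-refl ⟩
  ∑ (suc (a ℕ.+ b)) (λ r → φ r ⊗ Xser ^ r) i j a b
    ≡⟨ at~ (1+∑~exp (a ℕ.+ b)) i j a b ℕ.≤-refl ℕ.≤-refl ⟨
  oneS i j a b + RHS i j a b ∎)
  where
  open ≡-Reasoning
  -- Each coefficient is compared in the truncation at its own q-order and degree. There the cut-off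
  -- r ≤ a + b in `RHS` is the full exponential sum.
  open Truncation i (a ℕ.+ b) using (at~; truncatedDifferentialRing)
  open FilteredDifferentialRingTheory truncatedDifferentialRing using (∑; _^_)
  open Conclusion i (a ℕ.+ b)
  open GroupProperties ℚ.+-0-group using () renaming (∙-cancelˡ to +-cancelˡ)
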